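{- There exists a constant $\gamma>0.04$ such that the following holds. Let $f:\{0,1\}^{m}\to\{0,1\}$, let $n\in\mathbb{N}$, and let $\Pi$ be a partially half-duplex protocol that solves $\mathit{KW}_f\circledast\mathit{MUX}_n$. For every $\gamma$-alive transcript $\pi_1$ of $\Pi$, the complexity of $\Pi$ is at least $|\pi_1|+n-O(\log(m\cdot n))$, where the $O(\cdot)$ hides a universal constant.
   Context: Logs base 2. For $g:\{0,1\}^n\to\{0,1\}$ and $X\in\{0,1\}^{m\times n}$, $g(X)\in\{0,1\}^m$ applies $g$ to each row, $(f\diamond g)(X)=f(g(X))$, and for $a\in\{0,1\}^m$, $g^{ -1}(a)=\{X: g(X)=a\}$. $\mathit{KW}_f\circledast\mathit{MUX}_n$: Alice gets $g_A:\{0,1\}^n\to\{0,1\}$ and $X\in\{0,1\}^{m\times n}$ with $(f\diamond g_A)(X)=1$; Bob gets $g_B$ and $Y$ with $(f\diamond g_B)(Y)=0$; with $a=g_A(X)$, $b=g_B(Y)$ they must output $(i,j)$ with $a_i\neq b_i$ and $X_{i,j}\neq Y_{i,j}$, or may output $\bot$ if $g_A\neq g_B$. Half-duplex protocol: a pair of full 4-ary trees $\Pi_A,\Pi_B$ of equal depth (the complexity). Each vertex $u$ of $\Pi_A$ is labeled by a set $\mathcal{X}_u$ of Alice inputs (root: all inputs); the children of internal $u$ are $u_{\mathrm{rcv}(0)},u_{\mathrm{rcv}(1)},u_{\mathrm{send}(0)},u_{\mathrm{send}(1)}$ with $\mathcal{X}_{u_{\mathrm{rcv}(0)}}=\mathcal{X}_{u_{\mathrm{rcv}(1)}}$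 and $\mathcal{X}_u$ the disjoint union of $\mathcal{X}_{u_{\mathrm{rcv}(0)}},\mathcal{X}_{u_{\mathrm{send}(0)}},\mathcal{X}_{u_{\mathrm{send}(1)}}$; similarly $\Pi_B$ with Bob's inputs. Leaves carry outputs. Execution from the roots $(u,v)$: if one player's input lies in a send set $\mathrm{send}(\sigma)$ and the other's in the receive set, both move along edges labeled $\mathrm{send}(\sigma)$ / $\mathrm{rcv}(\sigma)$ respectively (classical round); if both send $\sigma,\tau$, they move to $\mathrm{send}(\sigma)$, $\mathrm{send}(\tau)$ (wasted); if both receive, they move to $\mathrm{rcv}(\sigma)$, $\mathrm{rcv}(\tau)$ for adversarial $\sigma,\tau$ (silent). Both must reach leaves at the same round with the same output, and $\Pi$ solves the problem if all possible outputs are valid. $\Pi$ is partially half-duplex if whenever $g_A=g_B$ all rounds of every execution are classical. Transcripts: for $\pi\in\{0,1\}^*$, a vertex of $\Pi_A$ at depth $|\pi|$ is consistent with $\pi$ if the $i$-th edge on its root path is labeled $\mathrm{rcv}(\pi_i)$ or $\mathrm{send}(\pi_i)$ for all $i$; an Alice input is consistent with $\pi$ if it belongs to $\mathcal{X}_u$ for such a vertex $u$; similarly for Bob. $\mathcal{X}_\pi,\mathcal{Y}_\pi$ are the sets of consistent inputs of Alice and Bob; $\pi$ is a transcript if both are non-empty. For $g:\{0,1\}^n\to\{0,1\}$, $a\in f^{ -1}(1)$, $b\in f^{ -1}(0)$: $\mathcal{X}_\pi(g)=\{X:(g,X)\in\mathcal{X}_\pi\}$, $\mathcal{Y}_\pi(g)=\{Y:(g,Y)\in\mathcal{Y}_\pi\}$,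 $\mathcal{X}_\pi(g,a)=\mathcal{X}_\pi(g)\cap g^{ -1}(a)$, $\mathcal{Y}_\pi(g,b)=\mathcal{Y}_\pi(g)\cap g^{ -1}(b)$; $\mathcal{A}_\pi(g)$ ($\mathcal{B}_\pi(g)$) is the set of $a\in f^{ -1}(1)$ ($b\in f^{ -1}(0)$) with $\mathcal{X}_\pi(g,a)$ ($\mathcal{Y}_\pi(g,b)$) non-empty; $\mathcal{V}_\pi$ is the set of $g$ with both $\mathcal{A}_\pi(g),\mathcal{B}_\pi(g)$ non-empty. $\mathcal{V}_0$ is the set of balanced functions $\{0,1\}^n\to\{0,1\}$. Formula complexity of a rectangle: for disjoint $\mathcal{A},\mathcal{B}\subseteq\{0,1\}^m$, $\mathsf{L}(\mathcal{A}\times\mathcal{B})$ is the minimal number of leaves of a de Morgan formula $\phi$ with $\phi(\mathcal{A})=1$, $\phi(\mathcal{B})=0$ (defined as $0$ if either set is empty). Liveness (with the constant $\kappa=8$): a transcript $\pi_1$ is $\gamma$-alive if there is a set $\mathcal{V}\subseteq\mathcal{V}_{\pi_1}$ of balanced functions such that (i) $|\mathcal{V}|\ge2^{ -m}|\mathcal{V}_0|$; (ii) for every $g\in\mathcal{V}$, $\log\mathsf{L}(\mathcal{A}_{\pi_1}(g)\times\mathcal{B}_{\pi_1}(g))\ge(1-\gamma)m+\kappa\log m+\kappa$; (iii) for every $g\in\mathcal{V}$, $a\in\mathcal{A}_{\pi_1}(g)$, $b\in\mathcal{B}_{\pi_1}(g)$: $|\mathcal{X}_{\pi_1}(g,a)|\ge2^{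 -\gamma m+1}|g^{ -1}(a)|$ and $|\mathcal{Y}_{\pi_1}(g,b)|\ge2^{ -\gamma m+1}|g^{ -1}(b)|$. -}

module Defs where

open import Data.Bool using (Bool; true; false; if_then_else_)
open import Data.Bool.Properties using () renaming (_≟_ to _≟B_)
open import Data.Nat using (ℕ; zero; suc; _+_; _*_; _^_; _≤_)
open import Data.Nat.Properties using () renaming (_≟_ to _≟ℕ_)
open import Data.Fin using (Fin)
open import Data.Vec using (Vec; []; _∷_; lookup)
import Data.Vec as V
open import Data.Vec.Properties using (≡-dec)
open import Data.List using (List; []; _∷_; length; filter; cartesianProduct; map; _++_)
open import Data.List.Relation.Unary.All using (All)
open import Data.List.Relation.Unary.Unique.Propositional using (Unique)
open import Data.Maybe using (Maybe; just; nothing)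
open import Data.Product using (Σ; ∃; _×_; _,_; proj₁; proj₂)
open import Relation.Binary.PropositionalEquality using (_≡_; _≢_)
open import Relation.Nullary using (¬_)
open import Data.Unit using (⊤)
open import Data.Empty using (⊥)

-- Boolean functions {0,1}^n → {0,1}, represented canonically by their
-- truth tables (so that ≡ is extensional equality of functions and the
-- set of all such functions can be enumerated without repetition).

BFun : ℕ → Set
BFun zero    = Bool
BFun (suc n) = BFun n × BFun n

evalF : ∀ {n} → BFun n → Vec Bool n → Bool
evalF {zero}  b         []       = b
evalF {suc n} (g₀ , g₁) (x ∷ xs) = if x then evalF g₁ xs else evalF g₀ xs

vecsOver : ∀ {A : Set} → List A → (k : ℕ) → List (Vec A k)
vecsOver xs zero    = V.[] ∷ []
vecsOver xs (suc k) = map (λ p → proj₁ p V.∷ proj₂ p) (cartesianProduct xs (vecsOver xs k))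

allVecs : (n : ℕ) → List (Vec Bool n)
allVecs n = vecsOver (false ∷ true ∷ []) n

Mat : ℕ → ℕ → Set
Mat m n = Vec (Vec Bool n) m

allMats : (m n : ℕ) → List (Mat m n)
allMats m n = vecsOver (allVecs n) m

allBFun : (n : ℕ) → List (BFun n)
allBFun zero    = false ∷ true ∷ []
allBFun (suc n) = cartesianProduct (allBFun n) (allBFun n)

applyRows : ∀ {m n} → BFun n → Mat m n → Vec Bool m
applyRows g X = V.map (evalF g) X

ones zeros : ∀ {n} → BFun n → ℕ
ones  {n} g = length (filter (λ x → evalF g x ≟B true)  (allVecs n))
zeros {n} g = length (filter (λ x → evalF g x ≟B false) (allVecs n))

Balanced : ∀ {n} → BFun n → Set
Balanced g = ones g ≡ zeros g

numBalanced : ℕ → ℕ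
numBalanced n = length (filter (λ g → ones g ≟ℕ zeros g) (allBFun n))

preimageSize : ∀ {m n} → BFun n → Vec Bool m → ℕ
preimageSize {m} {n} g a = length (filter (λ X → ≡-dec _≟B_ (applyRows g X) a) (allMats m n))

AtLeast : ∀ {A : Set} → (A → Set) → ℕ → Set
AtLeast {A} S k = Σ (List A) λ xs → Unique xs × All S xs × k ≤ length xs

data Formula (m : ℕ) : Set where
  lit  : Fin m → Bool → Formula m
  and  : Formula m → Formula m → Formula m
  or   : Formula m → Formula m → Formula m

evalΦ : ∀ {m} → Formula m → Vec Bool m → Bool
evalΦ (lit i true)  x = lookup x i
evalΦ (lit i false) x = if lookup x i then false else true
evalΦ (and φ ψ)     x = if evalΦ φ x then evalΦ ψ x else false
evalΦ (or φ ψ)      x = if evalΦ φ x then true else evalΦ ψ x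

leaves : ∀ {m} → Formula m → ℕ
leaves (lit _ _) = 1
leaves (and φ ψ) = leaves φ + leaves ψ
leaves (or φ ψ)  = leaves φ + leaves ψ

Separates : ∀ {m} → Formula m → (Vec Bool m → Set) → (Vec Bool m → Set) → Set
Separates φ A B = (∀ a → A a → evalΦ φ a ≡ true) × (∀ b → B b → evalΦ φ b ≡ false)

-- "L(A × B) satisfies the (monotone) lower-bound predicate P":
-- L is the minimum of leaves φ over separating φ (0 if A or B is empty),
-- so for monotone P this says P(L(A × B)).
LSatisfies : ∀ {m} → (Vec Bool m → Set) → (Vec Bool m → Set) → (ℕ → Set) → Set
LSatisfies A B P =
  ((∃ A × ∃ B) → ∀ φ → Separates φ A B → P (leaves φ)) ×
  (¬ (∃ A × ∃ B) → P 0)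

Input : ℕ → ℕ → Set
Input m n = BFun n × Mat m n

Out : ℕ → ℕ → Set
Out m n = Maybe (Fin m × Fin n)

AliceIn : ∀ {m n} → (Vec Bool m → Bool) → Input m n → Set
AliceIn f (g , X) = f (applyRows g X) ≡ true

BobIn : ∀ {m n} → (Vec Bool m → Bool) → Input m n → Set
BobIn f (g , Y) = f (applyRows g Y) ≡ false

ValidOut : ∀ {m n} → Input m n → Input m n → Out m n → Set
ValidOut (gA , X) (gB , Y) (just (i , j)) =
  lookup (applyRows gA X) i ≢ lookup (applyRows gB Y) i ×
  lookup (lookup X i) j ≢ lookup (lookup Y i) j
ValidOut (gA , X) (gB , Y) nothing = gA ≢ gB

data Move : Set where
  rcv  : Move
  send : Bool → Move

-- A full 4-ary tree of depth d.  At an internal vertex u, the function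
-- α : I → Move partitions the inputs: the label of the children is
--   X_{rcv(σ)}  = X_u ∩ α⁻¹(rcv)  (σ = 0,1),   X_{send(σ)} = X_u ∩ α⁻¹(send σ);
-- the root label is the set of all inputs.  The children are
-- r σ = u_{rcv(σ)} and s σ = u_{send(σ)}.
data Tree (I O : Set) : ℕ → Set where
  leaf : O → Tree I O zero
  node : ∀ {d} → (α : I → Move) → (r s : Bool → Tree I O d) → Tree I O (suc d)

record Protocol (m n : ℕ) : Set where
  field
    depth : ℕ
    ΠA    : Tree (Input m n) (Out m n) depth
    ΠB    : Tree (Input m n) (Out m n) depth
open Protocol public

data Round : Set where
  classical wasted silent : Round

data Run {I O : Set} (x y : I) : ∀ {d} → Tree I O d → Tree I O d → List Round → O → O → Set where
  end     : ∀ {oa ob} → Run x y (leaf oa) (leaf ob) [] oa ob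
  sendA   : ∀ {d} {αA αB : I → Move} {rA sA rB sB : Bool → Tree I O d} {rs oa ob} (σ : Bool) →
            αA x ≡ send σ → αB y ≡ rcv →
            Run x y (sA σ) (rB σ) rs oa ob →
            Run x y (node αA rA sA) (node αB rB sB) (classical ∷ rs) oa ob
  sendB   : ∀ {d} {αA αB : I → Move} {rA sA rB sB : Bool → Tree I O d} {rs oa ob} (σ : Bool) →
            αA x ≡ rcv → αB y ≡ send σ →
            Run x y (rA σ) (sB σ) rs oa ob →
            Run x y (node αA rA sA) (node αB rB sB) (classical ∷ rs) oa ob
  bothSnd : ∀ {d} {αA αB : I → Move} {rA sA rB sB : Bool → Tree I O d} {rs oa ob} (σ τ : Bool) →
            αA x ≡ send σ → αB y ≡ send τ →
            Run x y (sA σ) (sB τ) rs oa ob →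
            Run x y (node αA rA sA) (node αB rB sB) (wasted ∷ rs) oa ob
  bothRcv : ∀ {d} {αA αB : I → Move} {rA sA rB sB : Bool → Tree I O d} {rs oa ob} (σ τ : Bool) →
            αA x ≡ rcv → αB y ≡ rcv →
            Run x y (rA σ) (rB τ) rs oa ob →
            Run x y (node αA rA sA) (node αB rB sB) (silent ∷ rs) oa ob

Solves : ∀ {m n} → (Vec Bool m → Bool) → Protocol m n → Set
Solves f Π = ∀ x y → AliceIn f x → BobIn f y →
  ∀ rs oa ob → Run x y (ΠA Π) (ΠB Π) rs oa ob → (oa ≡ ob) × ValidOut x y oa

PartiallyHalfDuplex : ∀ {m n} → (Vec Bool m → Bool) → Protocol m n → Set
PartiallyHalfDuplex f Π = ∀ x y → AliceIn f x → BobIn f y → proj₁ x ≡ proj₁ y →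
  ∀ rs oa ob → Run x y (ΠA Π) (ΠB Π) rs oa ob → All (_≡ classical) rs

data Edge : Set where
  rcvE sendE : Bool → Edge

bit : Edge → Bool
bit (rcvE σ)  = σ
bit (sendE σ) = σ

-- x ∈ X_w for the vertex w reached from the root of t along the edges es
InLabel : ∀ {I O d} → Tree I O d → List Edge → I → Set
InLabel t              []             x = ⊤
InLabel (leaf _)       (_ ∷ _)        x = ⊥
InLabel (node α r s)   (rcvE σ ∷ es)  x = (α x ≡ rcv)    × InLabel (r σ) es x
InLabel (node α r s)   (sendE σ ∷ es) x = (α x ≡ send σ) × InLabel (s σ) es x

Consistent : ∀ {I O d} → Tree I O d → List Bool → I → Set
Consistent t π x = Σ (List Edge) λ es → (map bit es ≡ π) × InLabel t es x

module _ {m n : ℕ} (f : Vec Bool m → Bool) (Π : Protocol m n) (π : List Bool) where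

  Xπ Yπ : Input m n → Set
  Xπ x = AliceIn f x × Consistent (ΠA Π) π x
  Yπ y = BobIn f y × Consistent (ΠB Π) π y

  IsTranscript : Set
  IsTranscript = ∃ Xπ × ∃ Yπ

  Xπga : BFun n → Vec Bool m → Mat m n → Set
  Xπga g a X = Xπ (g , X) × applyRows g X ≡ a

  Yπgb : BFun n → Vec Bool m → Mat m n → Set
  Yπgb g b Y = Yπ (g , Y) × applyRows g Y ≡ b

  Aπ Bπ : BFun n → Vec Bool m → Set
  Aπ g a = (f a ≡ true)  × ∃ (Xπga g a)
  Bπ g b = (f b ≡ false) × ∃ (Yπgb g b)

  Vπ : BFun n → Set
  Vπ g = ∃ (Aπ g) × ∃ (Bπ g)

-- π is γ-alive for the rational γ = p / q (q ≥ 1), with κ = 8.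
-- The real inequalities are raised to the q-th power / exponentiated:
--  (i)   |𝒱| ≥ 2^{-m}|𝒱₀|              ⇔  |𝒱₀| ≤ |𝒱| · 2^m
--  (ii)  log L ≥ (1-γ)m + 8 log m + 8   ⇔  2^{qm} · m^{8q} · 2^{8q} ≤ L^q · 2^{pm}
--  (iii) |S| ≥ 2^{-γm+1} |g⁻¹(a)|        ⇔  2^q · |g⁻¹(a)|^q ≤ |S|^q · 2^{pm}
Alive : ∀ {m n} → (Vec Bool m → Bool) → Protocol m n → (p q : ℕ) → List Bool → Set
Alive {m} {n} f Π p q π =
  Σ (List (BFun n)) λ 𝒱 →
    Unique 𝒱 ×
    All (λ g → Balanced g × Vπ f Π π g) 𝒱 ×
    numBalanced n ≤ length 𝒱 * 2 ^ m ×
    All (λ g →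
      LSatisfies (Aπ f Π π g) (Bπ f Π π g)
        (λ L → 2 ^ (q * m) * m ^ (8 * q) * 2 ^ (8 * q) ≤ L ^ q * 2 ^ (p * m)) ×
      (∀ a → Aπ f Π π g a → Σ ℕ λ k → AtLeast (Xπga f Π π g a) k ×
          2 ^ q * preimageSize g a ^ q ≤ k ^ q * 2 ^ (p * m)) ×
      (∀ b → Bπ f Π π g b → Σ ℕ λ k → AtLeast (Yπgb f Π π g b) k ×
          2 ^ q * preimageSize g b ^ q ≤ k ^ q * 2 ^ (p * m))) 𝒱

{-# OPTIONS --safe #-}

-- Suppose the protocol has only d < n - C log (m n) rounds left after π.
--
-- Colouring. For a function g, record along every continuation of π who speaks and whether the
-- continuation is possible for g; this takes fewer than 3 * 2 ^ d bits. On equal functions all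
-- rounds are classical and ⊥ is forbidden, so if gA and gB have the same colour then on inputs
-- (gA , X), (gB , Y) the players also reach a common leaf with an output other than ⊥. Hence
-- X and Y cannot weakly agree, i.e. satisfy X_i = Y_i wherever the evaluated rows differ.
--
-- Thick projections. If X ranges over a 2 ^ (1 - γ m) fraction of g⁻¹(a), then for at least a
-- 2 ^ (- γ m) fraction of the sets J ⊆ [m], the coordinates outside J carry a tree in which every
-- vertex has slightly more than half of the possible children; such J are closed under supersets.
-- If no J thick for both a ∈ A(g) and b ∈ B(g) had a_J = b_J, then "Alice announces J, Bob enlarges
-- it to J ∪ K, compare the coordinates in J ∪ K" would be a formula of size
-- about 2 ^ (2 γ m) (7 / 4) ^ m, contradicting liveness for γ = 1 / 16.
--
-- Conclusion. By pigeonhole, a family of functions of density about 2 ^ (- 3 * 2 ^ d) shares its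
-- colour and a triple (a , b , J). By isoperimetry it contains gA, gB that are almost
-- complementary, so outside J the trees for a_i ≠ b_i live on almost the same alphabet of which
-- each uses more than half. They therefore share a branch, which yields weakly agreeing X and Y.
module Submission where

open import Defs
open import Data.Bool using (Bool; true; false; _∧_; _∨_; not; if_then_else_)
open import Data.Bool.Properties using (∨-comm) renaming (_≟_ to _≟B_)
open import Data.Empty using (⊥; ⊥-elim)
open import Data.Fin using (Fin; zero; suc)
open import Data.List using (List; []; _∷_; _++_; length; map; filter; cartesianProduct; upTo)
open import Data.List.Membership.Propositional using (_∈_)
open import Data.List.Membership.Propositional.Properties using (∈-map⁺; ∈-cartesianProduct⁺; ∈-filter⁺; ∈-filter⁻; ∈-upTo⁺)
open import Data.List.Properties using (length-map; length-filter; length-upTo)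
open import Data.List.Relation.Unary.All as All using (All; []; _∷_)
open import Data.List.Relation.Unary.All.Properties using (map⁻)
open import Data.List.Relation.Unary.AllPairs using ([]; _∷_)
open import Data.List.Relation.Unary.Any using (here; there)
open import Data.List.Relation.Unary.Unique.Propositional using (Unique)
open import Data.List.Relation.Unary.Unique.Propositional.Properties using (filter⁺; upTo⁺)
open import Data.Maybe using (just; nothing)
open import Data.Nat
open import Data.Nat.DivMod using (m≡m%n+[m/n]*n; m%n<n)
open import Data.Nat.Induction using (<-rec)
open import Data.Nat.Logarithm using (⌈log₂_⌉; ⌈log₂⌉-mono-≤; ⌈log₂⌈n/2⌉⌉≡⌈log₂n⌉∸1)
open import Data.Nat.Properties
open import Data.Nat.Tactic.RingSolver using (solve-∀)
open import Data.Product using (Σ; ∃; _×_; _,_; proj₁; proj₂; map₂)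
open import Data.Sum using (_⊎_; inj₁; inj₂)
open import Data.Unit using (tt)
open import Data.Vec using (Vec; []; _∷_; lookup; zipWith) renaming (_++_ to _++ᵥ_)
open import Data.Vec.Properties using (≡-dec; ∷-injectiveˡ; ∷-injectiveʳ; ++-injectiveˡ; ++-injectiveʳ; zipWith-comm)
open import Function using (_∘_)
open import Relation.Binary.PropositionalEquality
open import Relation.Nullary using (Dec; yes; no; does; ¬_)
open import Relation.Nullary.Decidable using (dec-true; dec-false; toWitness)
open ≤-Reasoning

private variable
  A B I O : Set
  d m n : ℕ

-- Powers

-- With `s = j + r` this is `(1 + 1/s)^j ≤ s / (s - j)` cleared of denominators. Each induction step
-- keeps `s` fixed and uses `(s + 1) r ≤ s (r + 1)`, that is, `r ≤ s`.
1+s-power : ∀ j r → suc (j + r) ^ j * r ≤ (j + r) ^ suc j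
1+s-power zero    r = ≤-reflexive (zero-case r)
  where
  zero-case : ∀ r → 1 * r ≡ r * 1
  zero-case = solve-∀
1+s-power (suc j) r = begin
  (suc s * suc s ^ j) * r   ≡⟨ split s r (suc s ^ j) ⟩
  (r + s * r) * suc s ^ j   ≤⟨ *-monoˡ-≤ _ (+-monoˡ-≤ (s * r) (m≤n+m r (suc j))) ⟩
  (s + s * r) * suc s ^ j   ≡⟨ merge s r (suc s ^ j) ⟩
  s * (suc s ^ j * suc r)   ≤⟨ *-monoʳ-≤ s step ⟩
  s * s ^ suc j             ∎
  where
  s = suc j + r
  step : suc s ^ j * suc r ≤ s ^ suc j
  step = subst (λ z → suc z ^ j * suc r ≤ z ^ suc j) (+-suc j r) (1+s-power j (suc r))
  split : ∀ s r x → (suc s * x) * r ≡ (r + s * r) * x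
  split = solve-∀
  merge : ∀ s r x → (s + s * r) * x ≡ s * (x * suc r)
  merge = solve-∀

-- For `m ≤ s / 2` the bound `s / (s - m)` is at most 2. It pays, over all `m` rows together, for
-- replacing `s` by `s + 1` in the branching threshold.
1+s-power≤2 : ∀ m s → 1 ≤ m → m + m ≤ s → suc s ^ m ≤ 2 * s ^ m
1+s-power≤2 m s 1≤m 2m≤s with m≤n⇒∃[o]m+o≡n (≤-trans (m≤m+n m m) 2m≤s)
... | r , refl = *-cancelʳ-≤ _ _ r {{>-nonZero (≤-trans 1≤m m≤r)}} (begin
    suc (m + r) ^ m * r          ≤⟨ 1+s-power m r ⟩
    (m + r) * (m + r) ^ m        ≤⟨ *-monoˡ-≤ _ (+-monoˡ-≤ r m≤r) ⟩
    (r + r) * (m + r) ^ m        ≡⟨ double r ((m + r) ^ m) ⟩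
    2 * (m + r) ^ m * r          ∎)
  where
  m≤r : m ≤ r
  m≤r = +-cancelˡ-≤ m _ _ 2m≤s
  double : ∀ r x → (r + r) * x ≡ 2 * x * r
  double = solve-∀

-- The bound `s / (s - j)` degenerates at `j = s`, so the exponent is split into two halves that
-- contribute a factor 2 each.
1+s-power≤4 : ∀ h → 1 ≤ h → suc (h + h) ^ (h + h) ≤ 4 * (h + h) ^ (h + h)
1+s-power≤4 h 1≤h = begin
  suc s ^ (h + h)              ≡⟨ ^-distribˡ-+-* (suc s) h h ⟩
  suc s ^ h * suc s ^ h        ≤⟨ *-mono-≤ p p ⟩
  2 * s ^ h * (2 * s ^ h)      ≡⟨ square (s ^ h) ⟩
  4 * (s ^ h * s ^ h)          ≡⟨ cong (4 *_) (^-distribˡ-+-* s h h) ⟨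
  4 * s ^ (h + h)              ∎
  where
  s = h + h
  p = 1+s-power≤2 h s 1≤h ≤-refl
  square : ∀ x → 2 * x * (2 * x) ≡ 4 * (x * x)
  square = solve-∀

-- Bernoulli's inequality `1 + j/v ≤ (1 + 1/v)^j` without denominators; `j = v` gives the factor 2
-- used below.
bernoulli : ∀ v j → (v + j) * v ^ j ≤ v * suc v ^ j
bernoulli v zero    = ≤-reflexive (zero-case v)
  where
  zero-case : ∀ v → (v + 0) * 1 ≡ v * 1
  zero-case = solve-∀
bernoulli v (suc j) = begin
  (v + suc j) * (v * v ^ j)          ≡⟨ lhs v j (v ^ j) ⟩
  v ^ j * (v * v + v * j + v)        ≤⟨ *-monoʳ-≤ (v ^ j) (m≤m+n _ j) ⟩
  v ^ j * (v * v + v * j + v + j)    ≡⟨ rhs v j (v ^ j) ⟩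
  suc v * ((v + j) * v ^ j)          ≤⟨ *-monoʳ-≤ (suc v) (bernoulli v j) ⟩
  suc v * (v * suc v ^ j)            ≡⟨ swap₁ (suc v) v (suc v ^ j) ⟩
  v * (suc v * suc v ^ j)            ∎
  where
  lhs : ∀ v j x → (v + suc j) * (v * x) ≡ x * (v * v + v * j + v)
  lhs = solve-∀
  rhs : ∀ v j x → x * (v * v + v * j + v + j) ≡ suc v * ((v + j) * x)
  rhs = solve-∀
  swap₁ : ∀ a b c → a * (b * c) ≡ b * (a * c)
  swap₁ = solve-∀

2*v^v≤1+v^v : ∀ v → 1 ≤ v → 2 * v ^ v ≤ suc v ^ v
2*v^v≤1+v^v v 1≤v = *-cancelˡ-≤ v {{>-nonZero 1≤v}} (begin
  v * (2 * v ^ v)    ≡⟨ double v (v ^ v) ⟩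
  (v + v) * v ^ v    ≤⟨ bernoulli v v ⟩
  v * suc v ^ v      ∎)
  where
  double : ∀ v x → v * (2 * x) ≡ (v + v) * x
  double = solve-∀

*-distrib-^ : ∀ k x y → (x * y) ^ k ≡ x ^ k * y ^ k
*-distrib-^ zero    x y = refl
*-distrib-^ (suc k) x y =
  trans (cong ((x * y) *_) (*-distrib-^ k x y)) (regroup x y (x ^ k) (y ^ k))
  where
  regroup : ∀ x y a b → (x * y) * (a * b) ≡ (x * a) * (y * b)
  regroup = solve-∀

-- Finite sums and counting

∑ : List A → (A → ℕ) → ℕ
∑ []       f = 0
∑ (x ∷ xs) f = f x + ∑ xs f

𝟙 : Bool → ℕ
𝟙 false = 0
𝟙 true  = 1

∑-cong : ∀ (xs : List A) {f g} → (∀ x → f x ≡ g x) → ∑ xs f ≡ ∑ xs g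
∑-cong []       eq = refl
∑-cong (x ∷ xs) eq = cong₂ _+_ (eq x) (∑-cong xs eq)

∑-mono : ∀ (xs : List A) {f g} → (∀ x → f x ≤ g x) → ∑ xs f ≤ ∑ xs g
∑-mono []       le = z≤n
∑-mono (x ∷ xs) le = +-mono-≤ (le x) (∑-mono xs le)

∑-mono-All : ∀ {xs : List A} {f g} → All (λ x → f x ≤ g x) xs → ∑ xs f ≤ ∑ xs g
∑-mono-All []         = z≤n
∑-mono-All (le ∷ les) = +-mono-≤ le (∑-mono-All les)

∑-++ : ∀ (xs ys : List A) f → ∑ (xs ++ ys) f ≡ ∑ xs f + ∑ ys f
∑-++ []       ys f = refl
∑-++ (x ∷ xs) ys f = trans (cong (f x +_) (∑-++ xs ys f)) (sym (+-assoc (f x) _ _))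

∑-map : ∀ (xs : List A) (h : A → B) f → ∑ (map h xs) f ≡ ∑ xs (f ∘ h)
∑-map []       h f = refl
∑-map (x ∷ xs) h f = cong (f (h x) +_) (∑-map xs h f)

∑-+ : ∀ (xs : List A) f g → ∑ xs (λ x → f x + g x) ≡ ∑ xs f + ∑ xs g
∑-+ []       f g = refl
∑-+ (x ∷ xs) f g =
  trans (cong (f x + g x +_) (∑-+ xs f g)) (interchange (f x) (g x) (∑ xs f) (∑ xs g))
  where
  interchange : ∀ a b c d → a + b + (c + d) ≡ a + c + (b + d)
  interchange = solve-∀

∑-0 : ∀ (xs : List A) → ∑ xs (λ _ → 0) ≡ 0
∑-0 []       = refl
∑-0 (x ∷ xs) = ∑-0 xs

∑-const : ∀ (xs : List A) c → ∑ xs (λ _ → c) ≡ length xs * c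
∑-const []       c = refl
∑-const (x ∷ xs) c = cong (c +_) (∑-const xs c)

∑-*ˡ : ∀ (xs : List A) c f → ∑ xs (λ x → c * f x) ≡ c * ∑ xs f
∑-*ˡ []       c f = sym (*-zeroʳ c)
∑-*ˡ (x ∷ xs) c f = trans (cong (c * f x +_) (∑-*ˡ xs c f)) (sym (*-distribˡ-+ c (f x) _))

∑-*ʳ : ∀ (xs : List A) c f → ∑ xs (λ x → f x * c) ≡ ∑ xs f * c
∑-*ʳ xs c f = trans (∑-cong xs (λ x → *-comm (f x) c)) (trans (∑-*ˡ xs c f) (*-comm c _))

∑-swap : ∀ (xs : List A) (ys : List B) (f : A → B → ℕ) →
         ∑ xs (λ x → ∑ ys (f x)) ≡ ∑ ys (λ y → ∑ xs (λ x → f x y))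
∑-swap []       ys f = sym (∑-0 ys)
∑-swap (x ∷ xs) ys f =
  trans (cong (∑ ys (f x) +_) (∑-swap xs ys f)) (sym (∑-+ ys (f x) _))

∑-× : ∀ (xs : List A) (ys : List B) (f : A × B → ℕ) →
      ∑ (cartesianProduct xs ys) f ≡ ∑ xs (λ x → ∑ ys (λ y → f (x , y)))
∑-× []       ys f = refl
∑-× (x ∷ xs) ys f = trans (∑-++ (map (x ,_) ys) _ f)
  (cong₂ _+_ (∑-map ys (x ,_) f) (∑-× xs ys f))

∑-vecs : ∀ (xs : List A) k f →
         ∑ (vecsOver xs (suc k)) f ≡ ∑ xs (λ x → ∑ (vecsOver xs k) (λ v → f (x ∷ v)))
∑-vecs xs k f = trans (∑-map (cartesianProduct xs (vecsOver xs k)) _ f) (∑-× xs _ _)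

∑-∈ : ∀ {xs : List A} f {x} → x ∈ xs → f x ≤ ∑ xs f
∑-∈ f (here refl) = m≤m+n _ _
∑-∈ f (there i)   = ≤-trans (∑-∈ f i) (m≤n+m _ _)

∑-𝟙⇒∃ : ∀ (xs : List A) p → 1 ≤ ∑ xs (𝟙 ∘ p) → ∃ λ x → p x ≡ true
∑-𝟙⇒∃ (x ∷ xs) p le with p x in eq
... | true  = x , eq
... | false = ∑-𝟙⇒∃ xs p le

∃⇒∑-𝟙 : ∀ {xs : List A} p {x} → x ∈ xs → p x ≡ true → 1 ≤ ∑ xs (𝟙 ∘ p)
∃⇒∑-𝟙 p i eq = ≤-trans (≤-reflexive (sym (cong 𝟙 eq))) (∑-∈ (𝟙 ∘ p) i)

𝟙-mono : ∀ {b c} → (b ≡ true → c ≡ true) → 𝟙 b ≤ 𝟙 c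
𝟙-mono {false} h = z≤n
𝟙-mono {true}  h = ≤-reflexive (sym (cong 𝟙 (h refl)))

𝟙≤1 : ∀ b → 𝟙 b ≤ 1
𝟙≤1 false = z≤n
𝟙≤1 true  = ≤-refl

∃-below-average : ∀ (xs : List A) f g → 1 ≤ length xs → ∑ xs f ≤ ∑ xs g →
                  ∃ λ x → x ∈ xs × f x ≤ g x
∃-below-average (x ∷ xs) f g _ le with f x ≤? g x
∃-below-average (x ∷ xs) f g _ le | yes p = x , here refl , p
∃-below-average (x ∷ []) f g _ le | no ¬p =
  ⊥-elim (¬p (subst₂ _≤_ (+-identityʳ _) (+-identityʳ _) le))
∃-below-average (x ∷ xs@(_ ∷ _)) f g _ le | no ¬p =
  map₂ (λ (i , q) → there i , q) (∃-below-average xs f g (s≤s z≤n)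
    (+-cancelˡ-≤ (g x) _ _ (≤-trans (+-monoˡ-≤ _ (<⇒≤ (≰⇒> ¬p))) le)))

length-filter-𝟙 : ∀ {P : A → Set} (P? : ∀ (x : A) → Dec (P x)) xs →
                  length (filter P? xs) ≡ ∑ xs (λ x → 𝟙 (does (P? x)))
length-filter-𝟙 P? []       = refl
length-filter-𝟙 P? (x ∷ xs) with does (P? x)
... | true  = cong suc (length-filter-𝟙 P? xs)
... | false = length-filter-𝟙 P? xs

true-does : ∀ {C : Set} (d : Dec C) → does d ≡ true → C
true-does (yes c) _ = c

∑-Unique-≟ : ∀ {ys : List A} (_≟_ : ∀ (x y : A) → Dec (x ≡ y)) → Unique ys → ∀ x →
             ∑ ys (λ y → 𝟙 (does (x ≟ y))) ≤ 1
∑-Unique-≟ {ys = []}     _≟_ [] x = z≤n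
∑-Unique-≟ {ys = y ∷ ys} _≟_ (y∉ ∷ u) x with x ≟ y
... | no _ = ∑-Unique-≟ _≟_ u x
... | yes refl = s≤s (≤-trans (∑-mono-All (All.map absent y∉)) (≤-reflexive (∑-0 ys)))
  where
  absent : ∀ {z} → y ≢ z → 𝟙 (does (y ≟ z)) ≤ 0
  absent ne rewrite dec-false (y ≟ _) ne = z≤n

-- Counts pairs of equal elements: every `x` has a partner because `ys` is complete, and every `y`
-- meets at most one entry of the repetition-free `xs`.
Unique-length≤ : ∀ {xs ys : List A} (_≟_ : ∀ (x y : A) → Dec (x ≡ y)) (p : A → Bool) →
                 (∀ x → x ∈ ys) → Unique xs → All (λ x → p x ≡ true) xs →
                 length xs ≤ ∑ ys (𝟙 ∘ p)
Unique-length≤ {xs = xs} {ys} _≟_ p complete u ps = begin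
  length xs                                        ≡⟨ *-identityʳ _ ⟨
  length xs * 1                                    ≡⟨ ∑-const xs 1 ⟨
  ∑ xs (λ _ → 1)                                   ≤⟨ ∑-mono-All (All.map found ps) ⟩
  ∑ xs (λ x → ∑ ys (λ y → 𝟙 (p y) * 𝟙 (does (y ≟ x))))   ≡⟨ ∑-swap xs ys _ ⟩
  ∑ ys (λ y → ∑ xs (λ x → 𝟙 (p y) * 𝟙 (does (y ≟ x))))   ≤⟨ ∑-mono ys once ⟩
  ∑ ys (𝟙 ∘ p)                                     ∎
  where
  found : ∀ {x} → p x ≡ true → 1 ≤ ∑ ys (λ y → 𝟙 (p y) * 𝟙 (does (y ≟ x)))
  found {x} px = ≤-trans
    (≤-reflexive (sym (cong₂ _*_ (cong 𝟙 px) (cong 𝟙 (dec-true (x ≟ x) refl)))))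
    (∑-∈ (λ y → 𝟙 (p y) * 𝟙 (does (y ≟ x))) (complete x))
  once : ∀ y → ∑ xs (λ x → 𝟙 (p y) * 𝟙 (does (y ≟ x))) ≤ 𝟙 (p y)
  once y = begin
    ∑ xs (λ x → 𝟙 (p y) * 𝟙 (does (y ≟ x)))   ≡⟨ ∑-*ˡ xs (𝟙 (p y)) _ ⟩
    𝟙 (p y) * ∑ xs (λ x → 𝟙 (does (y ≟ x)))   ≤⟨ *-monoʳ-≤ (𝟙 (p y)) (∑-Unique-≟ _≟_ u y) ⟩
    𝟙 (p y) * 1                               ≡⟨ *-identityʳ _ ⟩
    𝟙 (p y)                                   ∎

-- Each `x` is related to some key, so averaged over the keys at least `length xs / length ks`
-- elements are related to one key.
pigeonhole : ∀ (xs : List A) (ks : List B) (R : A → B → Bool) → 1 ≤ length ks →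
             All (λ x → ∃ λ k → k ∈ ks × R x k ≡ true) xs →
             ∃ λ k → length xs ≤ ∑ xs (λ x → 𝟙 (R x k)) * length ks
pigeonhole xs ks R 1≤ks hit with ∃-below-average ks _ _ 1≤ks total
  where
  total : ∑ ks (λ _ → length xs) ≤ ∑ ks (λ k → ∑ xs (λ x → 𝟙 (R x k)) * length ks)
  total = begin
    ∑ ks (λ _ → length xs)                               ≡⟨ ∑-const ks _ ⟩
    length ks * length xs                                ≡⟨ *-comm (length ks) _ ⟩
    length xs * length ks                                ≡⟨ ∑-const xs _ ⟨
    ∑ xs (λ _ → length ks)
      ≤⟨ ∑-mono-All (All.map (λ (k , i , r) → ≤-trans (≤-reflexive (sym (*-identityˡ _)))
           (*-monoˡ-≤ (length ks) (∃⇒∑-𝟙 (R _) i r))) hit) ⟩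
    ∑ xs (λ x → ∑ ks (λ k → 𝟙 (R x k)) * length ks)      ≡⟨ ∑-*ʳ xs (length ks) _ ⟩
    ∑ xs (λ x → ∑ ks (λ k → 𝟙 (R x k))) * length ks      ≡⟨ cong (_* length ks) (∑-swap xs ks _) ⟩
    ∑ ks (λ k → ∑ xs (λ x → 𝟙 (R x k))) * length ks      ≡⟨ ∑-*ʳ ks (length ks) _ ⟨
    ∑ ks (λ k → ∑ xs (λ x → 𝟙 (R x k)) * length ks)      ∎
... | k , _ , le = k , le

-- Complete enumerations of vectors, matrices and functions

∈-vecsOver : ∀ {xs : List A} → (∀ x → x ∈ xs) → ∀ {k} (v : Vec A k) → v ∈ vecsOver xs k
∈-vecsOver c []      = here refl
∈-vecsOver c (x ∷ v) = ∈-map⁺ _ (∈-cartesianProduct⁺ (c x) (∈-vecsOver c v))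

∈-Bool : ∀ b → b ∈ false ∷ true ∷ []
∈-Bool false = here refl
∈-Bool true  = there (here refl)

∈-allVecs : ∀ {n} (x : Vec Bool n) → x ∈ allVecs n
∈-allVecs = ∈-vecsOver ∈-Bool

∈-allMats : ∀ {m n} (X : Mat m n) → X ∈ allMats m n
∈-allMats = ∈-vecsOver ∈-allVecs

∈-allBFun : ∀ {n} (g : BFun n) → g ∈ allBFun n
∈-allBFun {zero}  b       = ∈-Bool b
∈-allBFun {suc n} (g , h) = ∈-cartesianProduct⁺ (∈-allBFun g) (∈-allBFun h)

length-∑ : ∀ (xs : List A) → length xs ≡ ∑ xs (λ _ → 1)
length-∑ xs = sym (trans (∑-const xs 1) (*-identityʳ _))

length-× : ∀ (xs : List A) (ys : List B) → length (cartesianProduct xs ys) ≡ length xs * length ys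
length-× xs ys = trans (length-∑ (cartesianProduct xs ys)) (trans (∑-× xs ys _)
  (trans (∑-cong xs (λ _ → sym (length-∑ ys))) (∑-const xs _)))

length-vecsOver : ∀ (xs : List A) k → length (vecsOver xs k) ≡ length xs ^ k
length-vecsOver xs zero    = refl
length-vecsOver xs (suc k) = trans (length-map _ (cartesianProduct xs (vecsOver xs k)))
  (trans (length-× xs (vecsOver xs k)) (cong (length xs *_) (length-vecsOver xs k)))

length-allVecs : ∀ n → length (allVecs n) ≡ 2 ^ n
length-allVecs = length-vecsOver (false ∷ true ∷ [])

Σ-allBFun-suc : ∀ {n} (f : BFun (suc n) → ℕ) →
  ∑ (allBFun (suc n)) f ≡ ∑ (allBFun n) (λ g → ∑ (allBFun n) (λ h → f (g , h)))
Σ-allBFun-suc {n} f = ∑-× (allBFun n) (allBFun n) f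

_≟F_ : ∀ {n} (g h : BFun n) → Dec (g ≡ h)
_≟F_ {zero}  a b = a ≟B b
_≟F_ {suc n} (g₀ , g₁) (h₀ , h₁) with g₀ ≟F h₀ | g₁ ≟F h₁
... | yes refl | yes refl = yes refl
... | no ne    | _        = no (λ eq → ne (cong proj₁ eq))
... | yes _    | no ne    = no (λ eq → ne (cong proj₂ eq))

-- Almost complementary functions in large families

agree : BFun n → BFun n → ℕ
agree {zero}  a b = 𝟙 (does (a ≟B b))
agree {suc n} (g₀ , g₁) (h₀ , h₁) = agree g₀ h₀ + agree g₁ h₁

-- This is `(K - X)(K - Y) ≥ 0`, expanded so that no subtraction occurs.
cross-sum≤ : ∀ K X Y → X ≤ K → Y ≤ K → K * (X + Y) ≤ K * K + X * Y
cross-sum≤ K X Y X≤K Y≤K with m≤n⇒∃[o]m+o≡n X≤K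
... | r , refl = begin
  (X + r) * (X + Y)              ≡⟨ lhs X Y r ⟩
  (X + r) * X + X * Y + r * Y    ≤⟨ +-monoʳ-≤ ((X + r) * X + X * Y) (*-monoʳ-≤ r Y≤K) ⟩
  (X + r) * X + X * Y + r * (X + r)    ≡⟨ rhs X Y r ⟩
  (X + r) * (X + r) + X * Y      ∎
  where
  lhs : ∀ X Y r → (X + r) * (X + Y) ≡ (X + r) * X + X * Y + r * Y
  lhs = solve-∀
  rhs : ∀ X Y r → (X + r) * X + X * Y + r * (X + r) ≡ (X + r) * (X + r) + X * Y
  rhs = solve-∀

module Antipodal (u v : ℕ) (1≤v : 1 ≤ v) where

  -- A product kernel: `v` for each point of agreement and `u` for each point of disagreement, so
  -- that for `v < u` complementary pairs weigh most.
  wt : BFun n → BFun n → ℕ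
  wt {zero}  a b = if does (a ≟B b) then v else u
  wt {suc n} (g₀ , g₁) (h₀ , h₁) = wt g₀ h₀ * wt g₁ h₁

  wt-agree : ∀ (g h : BFun n) → wt g h * u ^ agree g h ≡ v ^ agree g h * u ^ (2 ^ n)
  wt-agree {zero} a b with does (a ≟B b)
  ... | true  = cong (_* (u * 1)) (sym (*-identityʳ v))
  ... | false = sym (*-identityˡ (u * 1))
  wt-agree {suc n} (g₀ , g₁) (h₀ , h₁) = begin-equality
    w₀ * w₁ * u ^ (a₀ + a₁)                  ≡⟨ cong (w₀ * w₁ *_) (^-distribˡ-+-* u a₀ a₁) ⟩
    w₀ * w₁ * (u ^ a₀ * u ^ a₁)              ≡⟨ regroup w₀ w₁ (u ^ a₀) (u ^ a₁) ⟩
    w₀ * u ^ a₀ * (w₁ * u ^ a₁)              ≡⟨ cong₂ _*_ (wt-agree g₀ h₀) (wt-agree g₁ h₁) ⟩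
    v ^ a₀ * u ^ N * (v ^ a₁ * u ^ N)        ≡⟨ regroup (v ^ a₀) (u ^ N) (v ^ a₁) (u ^ N) ⟩
    v ^ a₀ * v ^ a₁ * (u ^ N * u ^ N)        ≡⟨ cong₂ _*_ (^-distribˡ-+-* v a₀ a₁) (^-distribˡ-+-* u N N) ⟨
    v ^ (a₀ + a₁) * u ^ (N + N)              ≡⟨ cong (λ z → v ^ (a₀ + a₁) * u ^ (N + z)) (+-identityʳ N) ⟨
    v ^ (a₀ + a₁) * u ^ (2 ^ suc n)          ∎
    where
    w₀ = wt g₀ h₀ ; w₁ = wt g₁ h₁ ; a₀ = agree g₀ h₀ ; a₁ = agree g₁ h₁ ; N = 2 ^ n
    regroup : ∀ a b c d → a * b * (c * d) ≡ a * c * (b * d)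
    regroup = solve-∀

  -- Follows from `(K - xv)(K - yv) ≥ 0` once `xy = pq` is bounded by `(K/u)^2`. The argument
  -- cancels a factor `K`, hence the separate case `K = 0`.
  diagonal≤ : ∀ x y p q K → x * y ≡ p * q → x * v ≤ K → y * v ≤ K → p * u ≤ K → q * u ≤ K →
              u * u * v * (x + y) ≤ (u * u + v * v) * K
  diagonal≤ x y p q zero xy≡pq xv yv pu qu = ≤-trans (≤-reflexive (begin-equality
    u * u * v * (x + y)              ≡⟨ expand u v x y ⟩
    u * u * (x * v + y * v)          ≡⟨ cong₂ (λ a b → u * u * (a + b)) (n≤0⇒n≡0 xv) (n≤0⇒n≡0 yv) ⟩
    u * u * 0                        ≡⟨ *-zeroʳ (u * u) ⟩
    0                                ∎)) z≤n
    where
    expand : ∀ u v x y → u * u * v * (x + y) ≡ u * u * (x * v + y * v)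
    expand = solve-∀
  diagonal≤ x y p q K@(suc _) xy≡pq xv yv pu qu = *-cancelˡ-≤ K (begin
    K * (u * u * v * (x + y))                            ≡⟨ lhs K u v x y ⟩
    u * u * (K * (x * v + y * v))                        ≤⟨ *-monoʳ-≤ (u * u) (cross-sum≤ K _ _ xv yv) ⟩
    u * u * (K * K + x * v * (y * v))                    ≡⟨ mid K u v x y ⟩
    u * u * (K * K) + v * v * (u * u * (x * y))          ≡⟨ cong (λ z → u * u * (K * K) + v * v * (u * u * z)) xy≡pq ⟩
    u * u * (K * K) + v * v * (u * u * (p * q))          ≡⟨ rhs K u v p q ⟩
    u * u * (K * K) + v * v * (p * u * (q * u))          ≤⟨ +-monoʳ-≤ (u * u * (K * K)) (*-monoʳ-≤ (v * v) (*-mono-≤ pu qu)) ⟩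
    u * u * (K * K) + v * v * (K * K)                    ≡⟨ fin K u v ⟩
    K * ((u * u + v * v) * K)                            ∎)
    where
    lhs : ∀ K u v x y → K * (u * u * v * (x + y)) ≡ u * u * (K * (x * v + y * v))
    lhs = solve-∀
    mid : ∀ K u v x y → u * u * (K * K + x * v * (y * v)) ≡ u * u * (K * K) + v * v * (u * u * (x * y))
    mid = solve-∀
    rhs : ∀ K u v p q → u * u * (K * K) + v * v * (u * u * (p * q)) ≡ u * u * (K * K) + v * v * (p * u * (q * u))
    rhs = solve-∀
    fin : ∀ K u v → u * u * (K * K) + v * v * (K * K) ≡ K * ((u * u + v * v) * K)
    fin = solve-∀

  -- The off-diagonal products are bounded directly and the diagonal ones jointly; the constants add
  -- up as `2uv + u^2 + v^2 = (u + v)^2`.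
  two-point : ∀ f₀ f₁ h₀ h₁ K → f₀ * h₀ * v ≤ K → f₁ * h₁ * v ≤ K → f₀ * h₁ * u ≤ K → f₁ * h₀ * u ≤ K →
              (f₀ + f₁) * (h₀ + h₁) * (u * u * v) ≤ (u + v) * (u + v) * K
  two-point f₀ f₁ h₀ h₁ K le₀₀ le₁₁ le₀₁ le₁₀ = begin
    (f₀ + f₁) * (h₀ + h₁) * (u * u * v)                       ≡⟨ lhs f₀ f₁ h₀ h₁ u v ⟩
    u * v * (f₀ * h₁ * u + f₁ * h₀ * u) + u * u * v * (f₀ * h₀ + f₁ * h₁)
      ≤⟨ +-mono-≤ (*-monoʳ-≤ (u * v) (+-mono-≤ le₀₁ le₁₀))
           (diagonal≤ (f₀ * h₀) (f₁ * h₁) (f₀ * h₁) (f₁ * h₀) K (cross f₀ f₁ h₀ h₁) le₀₀ le₁₁ le₀₁ le₁₀) ⟩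
    u * v * (K + K) + (u * u + v * v) * K                     ≡⟨ rhs u v K ⟩
    (u + v) * (u + v) * K                                     ∎
    where
    lhs : ∀ f₀ f₁ h₀ h₁ u v → (f₀ + f₁) * (h₀ + h₁) * (u * u * v) ≡
          u * v * (f₀ * h₁ * u + f₁ * h₀ * u) + u * u * v * (f₀ * h₀ + f₁ * h₁)
    lhs = solve-∀
    cross : ∀ f₀ f₁ h₀ h₁ → f₀ * h₀ * (f₁ * h₁) ≡ f₀ * h₁ * (f₁ * h₀)
    cross = solve-∀
    rhs : ∀ u v K → u * v * (K + K) + (u * u + v * v) * K ≡ (u + v) * (u + v) * K
    rhs = solve-∀

  -- A two-function inequality of Prékopa–Leindler type: it holds for one bit and tensorises.
  ∑*∑≤ : ∀ n (f h : BFun n → ℕ) K → (∀ x y → f x * h y * wt x y ≤ K) →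
         ∑ (allBFun n) f * ∑ (allBFun n) h * (u * u * v) ^ (2 ^ n) ≤
         ((u + v) * (u + v)) ^ (2 ^ n) * K
  ∑*∑≤ zero f h K le = begin
    (f false + (f true + 0)) * (h false + (h true + 0)) * (c * 1)
      ≡⟨ simp (f false) (f true) (h false) (h true) c ⟩
    (f false + f true) * (h false + h true) * c
      ≤⟨ two-point (f false) (f true) (h false) (h true) K
           (le false false) (le true true) (le false true) (le true false) ⟩
    (u + v) * (u + v) * K                     ≡⟨ cong (_* K) (*-identityʳ ((u + v) * (u + v))) ⟨
    (u + v) * (u + v) * 1 * K                 ∎
    where
    c = u * u * v
    simp : ∀ a b d e c → (a + (b + 0)) * (d + (e + 0)) * (c * 1) ≡ (a + b) * (d + e) * c
    simp = solve-∀
  ∑*∑≤ (suc n) f h K le = begin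
    ∑ (allBFun (suc n)) f * ∑ (allBFun (suc n)) h * c ^ (2 ^ suc n)
      ≡⟨ cong₂ _*_ (cong₂ _*_ (Σ-allBFun-suc f) (Σ-allBFun-suc h)) (twice c) ⟩
    ∑ (allBFun n) F * ∑ (allBFun n) H * (c ^ N * c ^ N)
      ≡⟨ regroup (∑ (allBFun n) F) (∑ (allBFun n) H) (c ^ N) ⟩
    ∑ (allBFun n) F * c ^ N * ∑ (allBFun n) H * c ^ N
      ≡⟨ cong (λ z → z * ∑ (allBFun n) H * c ^ N) (∑-*ʳ (allBFun n) (c ^ N) F) ⟨
    ∑ (allBFun n) (λ x → F x * c ^ N) * ∑ (allBFun n) H * c ^ N
      ≤⟨ ∑*∑≤ n (λ x → F x * c ^ N) H (C ^ N * K) inner ⟩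
    C ^ N * (C ^ N * K)
      ≡⟨ *-assoc (C ^ N) (C ^ N) K ⟨
    C ^ N * C ^ N * K
      ≡⟨ cong (_* K) (twice C) ⟨
    C ^ (2 ^ suc n) * K ∎
    where
    c = u * u * v ; C = (u + v) * (u + v) ; N = 2 ^ n
    F H : BFun n → ℕ
    F x = ∑ (allBFun n) (λ x′ → f (x , x′))
    H y = ∑ (allBFun n) (λ y′ → h (y , y′))
    twice : ∀ b → b ^ (2 ^ suc n) ≡ b ^ N * b ^ N
    twice b = trans (cong (λ z → b ^ (N + z)) (+-identityʳ N)) (^-distribˡ-+-* b N N)
    regroup : ∀ a b x → a * b * (x * x) ≡ a * x * b * x
    regroup = solve-∀
    -- For fixed first halves the induction hypothesis is applied to the second halves, with
    -- `wt x y` absorbed into one of the two functions. The result is the pointwise hypothesis for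
    -- the marginals `F` and `H`.
    inner : ∀ x y → F x * c ^ N * H y * wt x y ≤ C ^ N * K
    inner x y = begin
      F x * c ^ N * H y * wt x y      ≡⟨ move (F x) (c ^ N) (H y) (wt x y) ⟩
      F x * (H y * wt x y) * c ^ N    ≡⟨ cong (λ z → F x * z * c ^ N) (∑-*ʳ (allBFun n) (wt x y) _) ⟨
      F x * ∑ (allBFun n) (λ y′ → h (y , y′) * wt x y) * c ^ N
        ≤⟨ ∑*∑≤ n (λ x′ → f (x , x′)) (λ y′ → h (y , y′) * wt x y) K
             (λ x′ y′ → ≤-trans (≤-reflexive (assoc (f (x , x′)) (h (y , y′)) (wt x y) (wt x′ y′)))
                                (le (x , x′) (y , y′))) ⟩
      C ^ N * K                       ∎
      where
      move : ∀ a b d e → a * b * d * e ≡ a * (d * e) * b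
      move = solve-∀
      assoc : ∀ a b d e → a * (b * d) * e ≡ a * b * (d * e)
      assoc = solve-∀

  -- The two-function inequality is applied to the indicator of `S` twice. Pairs that agree on at
  -- least `k` points have weight at most `v^k u^(N-k)`; moving `u^k` into the first function avoids
  -- the subtraction. Forced agreement thus costs the family a factor `(v/u)^k`.
  agreeing-family≤ : ∀ n (S : BFun n → Bool) k → v ≤ u →
    (∀ g h → S g ≡ true → S h ≡ true → k ≤ agree g h) →
    u ^ k * (∑ (allBFun n) (𝟙 ∘ S) * ∑ (allBFun n) (𝟙 ∘ S)) * (u * v) ^ (2 ^ n) ≤
    ((u + v) * (u + v)) ^ (2 ^ n) * v ^ k
  agreeing-family≤ n S k v≤u large = *-cancelʳ-≤ _ _ (u ^ N) {{m^n≢0 u N {{>-nonZero 1≤u}}}} (begin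
    u ^ k * (s * s) * (u * v) ^ N * u ^ N       ≡⟨ regroup (u ^ k) s ((u * v) ^ N) (u ^ N) ⟩
    u ^ k * s * s * (u ^ N * (u * v) ^ N)       ≡⟨ cong₂ (λ a b → a * s * b) (∑-*ˡ (allBFun n) (u ^ k) (𝟙 ∘ S))
                                                     (trans (cong (_^ N) (*-assoc u u v)) (*-distrib-^ N u (u * v))) ⟨
    ∑ (allBFun n) (λ x → u ^ k * 𝟙 (S x)) * s * (u * u * v) ^ N
      ≤⟨ ∑*∑≤ n (λ x → u ^ k * 𝟙 (S x)) (𝟙 ∘ S) (v ^ k * u ^ N) pointwise ⟩
    ((u + v) * (u + v)) ^ N * (v ^ k * u ^ N)   ≡⟨ *-assoc (((u + v) * (u + v)) ^ N) (v ^ k) (u ^ N) ⟨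
    ((u + v) * (u + v)) ^ N * v ^ k * u ^ N     ∎)
    where
    N = 2 ^ n ; s = ∑ (allBFun n) (𝟙 ∘ S)
    1≤u = ≤-trans 1≤v v≤u
    regroup : ∀ a s x y → a * (s * s) * x * y ≡ a * s * s * (y * x)
    regroup = solve-∀
    weight≤ : ∀ g h → k ≤ agree g h → u ^ k * wt g h ≤ v ^ k * u ^ N
    weight≤ g h k≤a with m≤n⇒∃[o]m+o≡n k≤a
    ... | j , k+j≡a = *-cancelʳ-≤ _ _ (u ^ j) {{m^n≢0 u j {{>-nonZero 1≤u}}}} (begin
      u ^ k * wt g h * u ^ j         ≡⟨ move (u ^ k) (wt g h) (u ^ j) ⟩
      wt g h * (u ^ k * u ^ j)       ≡⟨ cong (wt g h *_) (^-distribˡ-+-* u k j) ⟨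
      wt g h * u ^ (k + j)           ≡⟨ cong (λ z → wt g h * u ^ z) k+j≡a ⟩
      wt g h * u ^ agree g h         ≡⟨ wt-agree g h ⟩
      v ^ agree g h * u ^ N          ≡⟨ cong (λ z → v ^ z * u ^ N) k+j≡a ⟨
      v ^ (k + j) * u ^ N            ≡⟨ cong (_* u ^ N) (^-distribˡ-+-* v k j) ⟩
      v ^ k * v ^ j * u ^ N          ≤⟨ *-monoˡ-≤ (u ^ N) (*-monoʳ-≤ (v ^ k) (^-monoˡ-≤ j v≤u)) ⟩
      v ^ k * u ^ j * u ^ N          ≡⟨ move′ (v ^ k) (u ^ j) (u ^ N) ⟩
      v ^ k * u ^ N * u ^ j          ∎)
      where
      move : ∀ a b d → a * b * d ≡ b * (a * d)
      move = solve-∀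
      move′ : ∀ a b d → a * b * d ≡ a * d * b
      move′ = solve-∀
    pointwise : ∀ g h → u ^ k * 𝟙 (S g) * 𝟙 (S h) * wt g h ≤ v ^ k * u ^ N
    pointwise g h with S g in eg | S h in eh
    ... | true  | true  = ≤-trans (≤-reflexive (cong (_* wt g h) (simp (u ^ k)))) (weight≤ g h (large g h eg eh))
      where
      simp : ∀ a → a * 1 * 1 ≡ a
      simp = solve-∀
    ... | true  | false = ≤-trans (≤-reflexive (cong (_* wt g h) (*-zeroʳ (u ^ k * 1)))) z≤n
    ... | false | b     = ≤-trans (≤-reflexive (cong (λ z → z * 𝟙 b * wt g h) (*-zeroʳ (u ^ k)))) z≤n

-- Value counts and the number of balanced functions

cnt : Bool → BFun n → ℕ
cnt {n} b g = ∑ (allVecs n) (λ x → 𝟙 (does (evalF g x ≟B b)))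

ones≡cnt : ∀ (g : BFun n) → ones g ≡ cnt true g
ones≡cnt {n} g = length-filter-𝟙 (λ x → evalF g x ≟B true) (allVecs n)

zeros≡cnt : ∀ (g : BFun n) → zeros g ≡ cnt false g
zeros≡cnt {n} g = length-filter-𝟙 (λ x → evalF g x ≟B false) (allVecs n)

∑-allVecs-suc : ∀ n f → ∑ (allVecs (suc n)) f ≡
                ∑ (allVecs n) (f ∘ (false ∷_)) + ∑ (allVecs n) (f ∘ (true ∷_))
∑-allVecs-suc n f = trans (∑-vecs _ n f) (cong (∑ (allVecs n) (f ∘ (false ∷_)) +_) (+-identityʳ _))

cnt-pair : ∀ b (g h : BFun n) → cnt b (g , h) ≡ cnt b g + cnt b h
cnt-pair {n} b g h = ∑-allVecs-suc n (λ x → 𝟙 (does (evalF (g , h) x ≟B b)))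

cnt-true+false : ∀ (g : BFun n) → cnt true g + cnt false g ≡ 2 ^ n
cnt-true+false {zero}  true  = refl
cnt-true+false {zero}  false = refl
cnt-true+false {suc n} (g , h) = begin-equality
  cnt true (g , h) + cnt false (g , h)                     ≡⟨ cong₂ _+_ (cnt-pair true g h) (cnt-pair false g h) ⟩
  cnt true g + cnt true h + (cnt false g + cnt false h)    ≡⟨ interchange (cnt true g) (cnt true h) _ _ ⟩
  cnt true g + cnt false g + (cnt true h + cnt false h + 0)  ≡⟨ cong₂ (λ a b → a + (b + 0)) (cnt-true+false g) (cnt-true+false h) ⟩
  2 ^ suc n                                                ∎
  where
  interchange : ∀ a b c d → a + b + (c + d) ≡ a + c + (b + d + 0)
  interchange = solve-∀

neg : BFun n → BFun n
neg {zero}  b       = not b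
neg {suc n} (g , h) = neg g , neg h

∑-neg : ∀ n f → ∑ (allBFun n) (f ∘ neg) ≡ ∑ (allBFun n) f
∑-neg zero    f = swap₂ (f true) (f false)
  where
  swap₂ : ∀ a b → a + (b + 0) ≡ b + (a + 0)
  swap₂ = solve-∀
∑-neg (suc n) f = begin-equality
  ∑ (allBFun (suc n)) (f ∘ neg)                                     ≡⟨ Σ-allBFun-suc (f ∘ neg) ⟩
  ∑ (allBFun n) (λ g → ∑ (allBFun n) (λ h → f (neg g , neg h)))     ≡⟨ ∑-neg n (λ g → ∑ (allBFun n) (λ h → f (g , neg h))) ⟩
  ∑ (allBFun n) (λ g → ∑ (allBFun n) (λ h → f (g , neg h)))         ≡⟨ ∑-cong (allBFun n) (λ g → ∑-neg n (λ h → f (g , h))) ⟩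
  ∑ (allBFun n) (λ g → ∑ (allBFun n) (λ h → f (g , h)))             ≡⟨ Σ-allBFun-suc f ⟨
  ∑ (allBFun (suc n)) f                                             ∎

cnt-neg : ∀ b (g : BFun n) → cnt b (neg g) ≡ cnt (not b) g
cnt-neg {zero} false false = refl
cnt-neg {zero} false true  = refl
cnt-neg {zero} true  false = refl
cnt-neg {zero} true  true  = refl
cnt-neg {suc n} b (g , h) = trans (cnt-pair b (neg g) (neg h))
  (trans (cong₂ _+_ (cnt-neg b g) (cnt-neg b h)) (sym (cnt-pair (not b) g h)))

-- Cauchy-Schwarz against the constant 1, obtained by summing `2ab ≤ a^2 + b^2` over all pairs.
∑-square≤ : ∀ (xs : List A) c → ∑ xs c * ∑ xs c ≤ length xs * ∑ xs (λ x → c x * c x)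
∑-square≤ xs c = *-cancelˡ-≤ 2 (begin
  2 * (∑ xs c * ∑ xs c)                                      ≡⟨ cong (2 *_) (∑-*ʳ xs (∑ xs c) c) ⟨
  2 * ∑ xs (λ x → c x * ∑ xs c)                              ≡⟨ cong (2 *_) (∑-cong xs (λ x → sym (∑-*ˡ xs (c x) c))) ⟩
  2 * ∑ xs (λ x → ∑ xs (λ y → c x * c y))                    ≡⟨ trans (sym (∑-*ˡ xs 2 _)) (∑-cong xs (λ x → sym (∑-*ˡ xs 2 _))) ⟩
  ∑ xs (λ x → ∑ xs (λ y → 2 * (c x * c y)))                  ≤⟨ ∑-mono xs (λ x → ∑-mono xs (λ y → am-gm (c x) (c y))) ⟩
  ∑ xs (λ x → ∑ xs (λ y → c x * c x + c y * c y))            ≡⟨ ∑-cong xs (λ x → trans (∑-+ xs _ _) (cong (_+ q) (∑-const xs _))) ⟩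
  ∑ xs (λ x → length xs * (c x * c x) + q)                   ≡⟨ trans (∑-+ xs _ _) (cong₂ _+_ (∑-*ˡ xs (length xs) _) (∑-const xs q)) ⟩
  length xs * q + length xs * q                              ≡⟨ double (length xs * q) ⟩
  2 * (length xs * q)                                        ∎)
  where
  q = ∑ xs (λ x → c x * c x)
  double : ∀ a → a + a ≡ 2 * a
  double = solve-∀
  ordered : ∀ a b → a ≤ b → 2 * (a * b) ≤ a * a + b * b
  ordered a b a≤b with m≤n⇒∃[o]m+o≡n a≤b
  ... | r , refl = ≤-trans (m≤m+n _ (r * r)) (≤-reflexive (expand a r))
    where
    expand : ∀ a r → 2 * (a * (a + r)) + r * r ≡ a * a + (a + r) * (a + r)
    expand = solve-∀
  am-gm : ∀ a b → 2 * (a * b) ≤ a * a + b * b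
  am-gm a b with ≤-total a b
  ... | inj₁ le = ordered a b le
  ... | inj₂ ge = subst₂ _≤_ (cong (2 *_) (*-comm b a)) (+-comm (b * b) _) (ordered b a ge)

-- The class sizes `c j` sum to at least `length xs`, their squares sum to at most the number of
-- colliding ordered pairs, and Cauchy-Schwarz over the `K` classes links the two.
collisions : ∀ (xs : List A) (κ : A → ℕ) K → (∀ x → κ x < K) →
             length xs * length xs ≤ K * ∑ xs (λ x → ∑ xs (λ y → 𝟙 (does (κ x ≟ κ y))))
collisions xs κ K κ<K = begin
  length xs * length xs                       ≤⟨ *-mono-≤ total total ⟩
  ∑ (upTo K) c * ∑ (upTo K) c                 ≤⟨ ∑-square≤ (upTo K) c ⟩
  length (upTo K) * ∑ (upTo K) (λ j → c j * c j)   ≡⟨ cong (_* ∑ (upTo K) (λ j → c j * c j)) (length-upTo K) ⟩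
  K * ∑ (upTo K) (λ j → c j * c j)            ≤⟨ *-monoʳ-≤ K squares ⟩
  K * ∑ xs (λ x → ∑ xs (λ y → 𝟙 (does (κ x ≟ κ y))))   ∎
  where
  e : ℕ → _ → ℕ
  e j x = 𝟙 (does (κ x ≟ j))
  c : ℕ → ℕ
  c j = ∑ xs (e j)
  total : length xs ≤ ∑ (upTo K) c
  total = begin
    length xs                            ≡⟨ length-∑ xs ⟩
    ∑ xs (λ _ → 1)                       ≤⟨ ∑-mono xs (λ x → ≤-trans (≤-reflexive (sym (cong 𝟙 (dec-true (κ x ≟ κ x) refl))))
                                              (∑-∈ (λ j → e j x) (∈-upTo⁺ (κ<K x)))) ⟩
    ∑ xs (λ x → ∑ (upTo K) (λ j → e j x))   ≡⟨ ∑-swap xs (upTo K) _ ⟩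
    ∑ (upTo K) c                         ∎
  both : ∀ x y → ∑ (upTo K) (λ j → e j x * e j y) ≤ 𝟙 (does (κ x ≟ κ y))
  both x y with κ x ≟ κ y
  ... | yes eq = ≤-trans (∑-mono (upTo K) (λ j → *-monoʳ-≤ (e j x) (𝟙≤1 (does (κ y ≟ j)))))
                  (≤-trans (≤-reflexive (∑-cong (upTo K) (λ j → *-identityʳ (e j x)))) (≤-trans (∑-Unique-≟ _≟_ (upTo⁺ K) (κ x))
                  (≤-reflexive (sym (cong 𝟙 (dec-true (κ x ≟ κ y) eq))))))
  ... | no ne = ≤-trans (∑-mono (upTo K) zero-term) (≤-trans (≤-reflexive (∑-0 (upTo K))) z≤n)
    where
    zero-term : ∀ j → e j x * e j y ≤ 0
    zero-term j with κ x ≟ j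
    ... | no ne′ = ≤-reflexive (cong (λ b → 𝟙 b * e j y) (dec-false (κ x ≟ j) ne′))
    ... | yes refl = ≤-trans (≤-reflexive (cong (λ b → e j x * 𝟙 b) (dec-false (κ y ≟ κ x) (ne ∘ sym))))
                             (≤-reflexive (*-zeroʳ (e j x)))
  squares : ∑ (upTo K) (λ j → c j * c j) ≤ ∑ xs (λ x → ∑ xs (λ y → 𝟙 (does (κ x ≟ κ y))))
  squares = begin
    ∑ (upTo K) (λ j → c j * c j)
      ≡⟨ ∑-cong (upTo K) (λ j → trans (sym (∑-*ʳ xs (c j) (e j))) (∑-cong xs (λ x → sym (∑-*ˡ xs (e j x) (e j))))) ⟩
    ∑ (upTo K) (λ j → ∑ xs (λ x → ∑ xs (λ y → e j x * e j y)))
      ≡⟨ ∑-swap (upTo K) xs _ ⟩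
    ∑ xs (λ x → ∑ (upTo K) (λ j → ∑ xs (λ y → e j x * e j y)))
      ≡⟨ ∑-cong xs (λ x → ∑-swap (upTo K) xs _) ⟩
    ∑ xs (λ x → ∑ xs (λ y → ∑ (upTo K) (λ j → e j x * e j y)))
      ≤⟨ ∑-mono xs (λ x → ∑-mono xs (both x)) ⟩
    ∑ xs (λ x → ∑ xs (λ y → 𝟙 (does (κ x ≟ κ y)))) ∎

length-allBFun : ∀ n → length (allBFun n) ≡ 2 ^ (2 ^ n)
length-allBFun zero    = refl
length-allBFun (suc n) = trans (length-× (allBFun n) (allBFun n))
  (trans (cong₂ _*_ (length-allBFun n) (length-allBFun n))
    (trans (sym (^-distribˡ-+-* 2 (2 ^ n) (2 ^ n))) (cong (λ z → 2 ^ (2 ^ n + z)) (sym (+-identityʳ (2 ^ n))))))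

-- (g , neg h) is balanced as soon as g and h have the same number of ones.
numBalanced≥ : ∀ n → 1 ≤ n → 2 ^ (2 ^ n) ≤ numBalanced n * 2 ^ n
numBalanced≥ (suc n) _ = begin
  2 ^ (2 ^ suc n)                              ≡⟨ length-allBFun (suc n) ⟨
  length (allBFun (suc n))                     ≡⟨ length-× (allBFun n) (allBFun n) ⟩
  length (allBFun n) * length (allBFun n)      ≤⟨ collisions (allBFun n) (cnt true) (suc (2 ^ n)) cnt< ⟩
  suc (2 ^ n) * ∑ (allBFun n) (λ g → ∑ (allBFun n) (λ h → 𝟙 (does (cnt true g ≟ cnt true h))))
    ≤⟨ *-mono-≤ small (∑-mono (allBFun n) (λ g → ∑-mono (allBFun n) (λ h → 𝟙-mono (bal g h)))) ⟩
  2 ^ suc n * ∑ (allBFun n) (λ g → ∑ (allBFun n) (λ h → b (g , neg h)))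
    ≡⟨ cong (2 ^ suc n *_) (∑-cong (allBFun n) (λ g → ∑-neg n (λ h → b (g , h)))) ⟩
  2 ^ suc n * ∑ (allBFun n) (λ g → ∑ (allBFun n) (λ h → b (g , h)))
    ≡⟨ cong (2 ^ suc n *_) (Σ-allBFun-suc b) ⟨
  2 ^ suc n * ∑ (allBFun (suc n)) b
    ≡⟨ cong (2 ^ suc n *_) (length-filter-𝟙 (λ g → ones g ≟ zeros g) (allBFun (suc n))) ⟨
  2 ^ suc n * numBalanced (suc n)              ≡⟨ *-comm (2 ^ suc n) _ ⟩
  numBalanced (suc n) * 2 ^ suc n              ∎
  where
  b : BFun (suc n) → ℕ
  b g = 𝟙 (does (ones g ≟ zeros g))
  -- The number of ones takes a value in `0 , … , 2^n`, which gives `2^n + 1` classes, at most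
  -- `2^(n+1)`.
  cnt< : ∀ (g : BFun n) → cnt true g < suc (2 ^ n)
  cnt< g = s≤s (≤-trans (m≤m+n _ _) (≤-reflexive (cnt-true+false g)))
  small : suc (2 ^ n) ≤ 2 ^ suc n
  small = ≤-trans (+-monoˡ-≤ (2 ^ n) (m^n>0 2 n)) (≤-reflexive (cong (2 ^ n +_) (sym (+-identityʳ _))))
  balanced : ∀ (g h : BFun n) → cnt true g ≡ cnt true h → ones (g , neg h) ≡ zeros (g , neg h)
  balanced g h eq = begin-equality
    ones (g , neg h)                     ≡⟨ trans (ones≡cnt (g , neg h)) (cnt-pair true g (neg h)) ⟩
    cnt true g + cnt true (neg h)        ≡⟨ cong (cnt true g +_) (cnt-neg true h) ⟩
    cnt true g + cnt false h             ≡⟨ cong (_+ cnt false h) eq ⟩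
    cnt true h + cnt false h             ≡⟨ trans (cnt-true+false h) (sym (cnt-true+false g)) ⟩
    cnt true g + cnt false g             ≡⟨ trans (+-comm (cnt true g) _) (cong (cnt false g +_) eq) ⟩
    cnt false g + cnt true h             ≡⟨ cong (cnt false g +_) (cnt-neg false h) ⟨
    cnt false g + cnt false (neg h)      ≡⟨ trans (zeros≡cnt (g , neg h)) (cnt-pair false g (neg h)) ⟨
    zeros (g , neg h)                    ∎
  bal : ∀ g h → does (cnt true g ≟ cnt true h) ≡ true → does (ones (g , neg h) ≟ zeros (g , neg h)) ≡ true
  bal g h eq = dec-true (ones (g , neg h) ≟ zeros (g , neg h)) (balanced g h (true-does (cnt true g ≟ cnt true h) eq))

-- Thick sets of matrices

∧-true : ∀ {b c} → b ∧ c ≡ true → b ≡ true × c ≡ true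
∧-true {true} {true} _ = refl , refl

agreeOn : Vec Bool m → Vec Bool m → Vec Bool m → Bool
agreeOn []      []      []      = true
agreeOn (j ∷ J) (a ∷ as) (b ∷ bs) = (not j ∨ does (a ≟B b)) ∧ agreeOn J as bs

both : Bool → BFun n → BFun n → ℕ
both {n} c g h = ∑ (allVecs n) (λ x → 𝟙 (does (evalF g x ≟B c) ∧ does (evalF h x ≟B c)))

both≤agree : ∀ c (g h : BFun n) → both c g h ≤ agree g h
both≤agree {zero} false false false = ≤-refl
both≤agree {zero} false false true  = ≤-refl
both≤agree {zero} false true  _     = z≤n
both≤agree {zero} true  false _     = z≤n
both≤agree {zero} true  true  false = ≤-refl
both≤agree {zero} true  true  true  = ≤-refl
both≤agree {suc n} c (g₀ , g₁) (h₀ , h₁) = ≤-trans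
  (≤-reflexive (∑-allVecs-suc n (λ x → 𝟙 (does (evalF (g₀ , g₁) x ≟B c) ∧ does (evalF (h₀ , h₁) x ≟B c)))))
  (+-mono-≤ (both≤agree c g₀ h₀) (both≤agree c g₁ h₁))

module Thickness (n E : ℕ) where

  -- A coordinate in `J` is projected away, so one child suffices there; any other coordinate asks
  -- for more than `E` children.
  quota : Bool → ℕ
  quota true  = 1
  quota false = suc E

  1≤quota : ∀ j → 1 ≤ quota j
  1≤quota true  = ≤-refl
  1≤quota false = s≤s z≤n

  -- The prefix tree of W, projected to the coordinates outside J, contains a full-depth
  -- subtree all of whose vertices have more than E children.
  thick : (Mat m n → Bool) → Vec Bool m → Bool
  degree : (Mat (suc m) n → Bool) → Vec Bool m → ℕ
  thick W []      = W []
  thick W (j ∷ J) = does (quota j ≤? degree W J)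
  degree W J = ∑ (allVecs n) (λ x → 𝟙 (thick (W ∘ (x ∷_)) J))

  thick⇒quota : ∀ (W : Mat (suc m) n → Bool) j J → thick W (j ∷ J) ≡ true → quota j ≤ degree W J
  thick⇒quota W j J = true-does (quota j ≤? degree W J)

  thick⇒child : ∀ (W : Mat (suc m) n → Bool) j J → thick W (j ∷ J) ≡ true →
                ∃ λ x → thick (W ∘ (x ∷_)) J ≡ true
  thick⇒child W j J th = ∑-𝟙⇒∃ (allVecs n) _ (≤-trans (1≤quota j) (thick⇒quota W j J th))

  thick⇒∃ : ∀ (W : Mat m n → Bool) J → thick W J ≡ true → ∃ λ X → W X ≡ true
  thick⇒∃ W []      th = [] , th
  thick⇒∃ W (j ∷ J) th with thick⇒child W j J th
  ... | x , th′ with thick⇒∃ (W ∘ (x ∷_)) J th′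
  ... | X , w = x ∷ X , w

  -- Enlarging `J` only lowers quotas, and by induction it can only raise degrees.
  thick-∨ : ∀ (W : Mat m n → Bool) K J → thick W J ≡ true → thick W (zipWith _∨_ K J) ≡ true
  thick-∨ W []      []      th = th
  thick-∨ W (k ∷ K) (j ∷ J) th = dec-true (quota (k ∨ j) ≤? degree W (zipWith _∨_ K J)) (begin
    quota (k ∨ j)                     ≤⟨ quota-∨ k j ⟩
    quota j                           ≤⟨ thick⇒quota W j J th ⟩
    degree W J                        ≤⟨ ∑-mono (allVecs n) (λ x → 𝟙-mono (thick-∨ (W ∘ (x ∷_)) K J)) ⟩
    degree W (zipWith _∨_ K J)        ∎)
    where
    quota-∨ : ∀ k j → quota (k ∨ j) ≤ quota j
    quota-∨ false j = ≤-refl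
    quota-∨ true  j = 1≤quota j

  RowsEvalTo : (Mat m n → Bool) → BFun n → Vec Bool m → Set
  RowsEvalTo W g a = ∀ X → W X ≡ true → applyRows g X ≡ a

  thick-child-value : ∀ (W : Mat (suc m) n → Bool) g {c a} J {x} → RowsEvalTo W g (c ∷ a) →
                      thick (W ∘ (x ∷_)) J ≡ true → evalF g x ≡ c
  thick-child-value W g J {x} ev th with thick⇒∃ (W ∘ (x ∷_)) J th
  ... | X , w = ∷-injectiveˡ (ev (x ∷ X) w)

  -- A degree of at most `2E` is bounded by `E` times the number of thresholds, among `1` and
  -- `E + 1`, that it reaches. These are the two quotas.
  ≤E*thresholds : ∀ c → c ≤ E + E → c ≤ E * (𝟙 (does (suc E ≤? c)) + 𝟙 (does (1 ≤? c)))
  ≤E*thresholds zero    _  = z≤n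
  ≤E*thresholds (suc c) le with suc E ≤? suc c
  ... | yes p = ≤-trans le (≤-reflexive (trans (double E)
                  (cong (λ b → E * (𝟙 b + 1)) (sym (dec-true (suc E ≤? suc c) p)))))
    where
    double : ∀ E → E + E ≡ E * 2
    double = solve-∀
  ... | no ¬p = ≤-trans (≤-pred (≰⇒> ¬p)) (≤-trans (≤-reflexive (sym (*-identityʳ E)))
                  (*-monoʳ-≤ E (m≤n+m 1 (𝟙 (does (suc E ≤? suc c))))))

  -- Peeling off a row, each degree is replaced by `E` times two indicators, which are exactly those
  -- of thickness for `false ∷ J` and `true ∷ J`. Since `g⁻¹(a)` has about `(2E)^m` elements in the
  -- application, density of `W` turns into density of thick sets.
  size≤thick : ∀ (W : Mat m n → Bool) g a → RowsEvalTo W g a → (∀ c → cnt c g ≤ E + E) →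
               ∑ (allMats m n) (𝟙 ∘ W) ≤ E ^ m * ∑ (allVecs m) (𝟙 ∘ thick W)
  size≤thick {zero} W g [] ev half = ≤-reflexive (sym (+-identityʳ _))
  size≤thick {suc m} W g (c ∷ a) ev half = begin
    ∑ (allMats (suc m) n) (𝟙 ∘ W)
      ≡⟨ ∑-vecs (allVecs n) m (𝟙 ∘ W) ⟩
    ∑ (allVecs n) (λ x → ∑ (allMats m n) (λ X → 𝟙 (W (x ∷ X))))
      ≤⟨ ∑-mono (allVecs n) (λ x → size≤thick (W ∘ (x ∷_)) g a (λ X w → ∷-injectiveʳ (ev (x ∷ X) w)) half) ⟩
    ∑ (allVecs n) (λ x → E ^ m * ∑ (allVecs m) (λ J → 𝟙 (thick (W ∘ (x ∷_)) J)))
      ≡⟨ ∑-*ˡ (allVecs n) (E ^ m) _ ⟩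
    E ^ m * ∑ (allVecs n) (λ x → ∑ (allVecs m) (λ J → 𝟙 (thick (W ∘ (x ∷_)) J)))
      ≡⟨ cong (E ^ m *_) (∑-swap (allVecs n) (allVecs m) _) ⟩
    E ^ m * ∑ (allVecs m) (degree W)
      ≤⟨ *-monoʳ-≤ (E ^ m) (∑-mono (allVecs m) (λ J → ≤E*thresholds (degree W J) (degree≤ J))) ⟩
    E ^ m * ∑ (allVecs m) (λ J → E * (𝟙 (thick W (false ∷ J)) + 𝟙 (thick W (true ∷ J))))
      ≡⟨ cong (E ^ m *_) (∑-*ˡ (allVecs m) E _) ⟩
    E ^ m * (E * ∑ (allVecs m) (λ J → 𝟙 (thick W (false ∷ J)) + 𝟙 (thick W (true ∷ J))))
      ≡⟨ regroup (E ^ m) E _ ⟩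
    E * E ^ m * ∑ (allVecs m) (λ J → 𝟙 (thick W (false ∷ J)) + 𝟙 (thick W (true ∷ J)))
      ≡⟨ cong (E * E ^ m *_) (trans (∑-+ (allVecs m) _ _) (sym (∑-allVecs-suc m (𝟙 ∘ thick W)))) ⟩
    E ^ suc m * ∑ (allVecs (suc m)) (𝟙 ∘ thick W) ∎
    where
    regroup : ∀ a b c → a * (b * c) ≡ b * a * c
    regroup = solve-∀
    degree≤ : ∀ J → degree W J ≤ E + E
    degree≤ J = ≤-trans (∑-mono (allVecs n) (λ x → 𝟙-mono
      (λ th → dec-true (evalF g x ≟B c) (thick-child-value W g J ev th)))) (half c)

  -- Children of `V` lie in `g⁻¹(c)` and children of `W` in `h⁻¹(d)` with `d` the opposite bit. A
  -- point of the latter outside `g⁻¹(c)` has `g = h = d`, so both sets live on at most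
  -- `cnt c g + agree g h ≤ 2E` points. Each has more than `E`, hence they meet.
  common-child : ∀ (V W : Mat (suc m) n → Bool) g h {c d a b} J →
                 RowsEvalTo V g (c ∷ a) → RowsEvalTo W h (d ∷ b) → c ≢ d →
                 cnt c g + agree g h ≤ E + E →
                 suc E ≤ degree V J → suc E ≤ degree W J →
                 ∃ λ x → thick (V ∘ (x ∷_)) J ∧ thick (W ∘ (x ∷_)) J ≡ true
  common-child V W g h {c} {d} J evV evW c≢d few degV degW =
    ∑-𝟙⇒∃ (allVecs n) _ (+-cancelʳ-≤ (E + E) _ _ (begin
      1 + (E + E)                         ≤⟨ +-monoʳ-≤ 1 (+-monoʳ-≤ E (n≤1+n E)) ⟩
      suc E + suc E                       ≤⟨ +-mono-≤ degV degW ⟩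
      degree V J + degree W J             ≡⟨ ∑-+ (allVecs n) _ _ ⟨
      ∑ (allVecs n) (λ x → 𝟙 (P x) + 𝟙 (Q x))
        ≤⟨ ∑-mono (allVecs n) pointwise ⟩
      ∑ (allVecs n) (λ x → 𝟙 (P x ∧ Q x) + (𝟙 (does (evalF g x ≟B c)) +
                            𝟙 (does (evalF g x ≟B d) ∧ does (evalF h x ≟B d))))
        ≡⟨ trans (∑-+ (allVecs n) _ _) (cong (∑ (allVecs n) (λ x → 𝟙 (P x ∧ Q x)) +_) (∑-+ (allVecs n) _ _)) ⟩
      ∑ (allVecs n) (λ x → 𝟙 (P x ∧ Q x)) + (cnt c g + both d g h)
        ≤⟨ +-monoʳ-≤ (∑ (allVecs n) (λ x → 𝟙 (P x ∧ Q x)))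
             (≤-trans (+-monoʳ-≤ (cnt c g) (both≤agree d g h)) few) ⟩
      ∑ (allVecs n) (λ x → 𝟙 (P x ∧ Q x)) + (E + E) ∎))
    where
    P Q : Vec Bool n → Bool
    P x = thick (V ∘ (x ∷_)) J
    Q x = thick (W ∘ (x ∷_)) J
    cases : ∀ p q e f → (p ≡ true → e ≡ c) → (q ≡ true → f ≡ d) →
            𝟙 p + 𝟙 q ≤ 𝟙 (p ∧ q) + (𝟙 (does (e ≟B c)) + 𝟙 (does (e ≟B d) ∧ does (f ≟B d)))
    cases false false e f pe qf = z≤n
    cases true  true  e f pe qf =
      +-monoʳ-≤ 1 (≤-trans (≤-reflexive (cong 𝟙 (sym (dec-true (e ≟B c) (pe refl))))) (m≤m+n _ _))
    cases true  false e f pe qf =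
      ≤-trans (≤-reflexive (cong 𝟙 (sym (dec-true (e ≟B c) (pe refl))))) (m≤m+n _ _)
    cases false true  e f pe qf with e ≟B c | e ≟B d
    ... | yes _ | _      = s≤s z≤n
    ... | no _  | yes _  = ≤-reflexive (cong 𝟙 (sym (dec-true (f ≟B d) (qf refl))))
    ... | no ¬c | no ¬d  = ⊥-elim (third e c d ¬c ¬d c≢d)
      where
      third : ∀ e c d → e ≢ c → e ≢ d → c ≢ d → ⊥
      third false false d     e≢c e≢d c≢d = e≢c refl
      third false true  false e≢c e≢d c≢d = e≢d refl
      third false true  true  e≢c e≢d c≢d = c≢d refl
      third true  true  d     e≢c e≢d c≢d = e≢c refl
      third true  false true  e≢c e≢d c≢d = e≢d refl
      third true  false false e≢c e≢d c≢d = c≢d refl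
    pointwise : ∀ x → 𝟙 (P x) + 𝟙 (Q x) ≤ 𝟙 (P x ∧ Q x) + (𝟙 (does (evalF g x ≟B c)) +
                            𝟙 (does (evalF g x ≟B d) ∧ does (evalF h x ≟B d)))
    pointwise x = cases (P x) (Q x) (evalF g x) (evalF h x)
      (thick-child-value V g J evV) (thick-child-value W h J evW)

  -- Both trees are descended together. Where `a` and `b` have equal bits the two children are
  -- chosen independently; where they differ, agreement on `J` puts the coordinate outside `J`, and
  -- a common child exists.
  weak-intersection : ∀ (V W : Mat m n → Bool) g h a b J →
    RowsEvalTo V g a → RowsEvalTo W h b →
    (∀ c → cnt c g + agree g h ≤ E + E) →
    agreeOn J a b ≡ true → thick V J ≡ true → thick W J ≡ true →
    ∃ λ X → ∃ λ Y → V X ≡ true × W Y ≡ true ×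
      (∀ i → lookup a i ≢ lookup b i → lookup X i ≡ lookup Y i)
  weak-intersection V W g h [] [] [] evV evW few agr thV thW = [] , [] , thV , thW , λ ()
  weak-intersection V W g h (c ∷ a) (d ∷ b) (j ∷ J) evV evW few agr thV thW with ∧-true agr
  ... | agr₀ , agr₁ = go (c ≟B d)
    where
    recurse : ∀ x y → thick (V ∘ (x ∷_)) J ≡ true → thick (W ∘ (y ∷_)) J ≡ true → (c ≢ d → x ≡ y) →
              ∃ λ X → ∃ λ Y → V X ≡ true × W Y ≡ true ×
                (∀ i → lookup (c ∷ a) i ≢ lookup (d ∷ b) i → lookup X i ≡ lookup Y i)
    recurse x y thx thy x≡y with weak-intersection (V ∘ (x ∷_)) (W ∘ (y ∷_)) g h a b J
      (λ X w → ∷-injectiveʳ (evV (x ∷ X) w)) (λ Y w → ∷-injectiveʳ (evW (y ∷ Y) w)) few agr₁ thx thy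
    ... | X , Y , vX , wY , eq = x ∷ X , y ∷ Y , vX , wY , λ { zero → x≡y ; (suc i) → eq i }
    free : ∀ j → not j ∨ does (c ≟B d) ≡ true → c ≢ d → j ≡ false
    free false _ _   = refl
    free true  e c≢d = ⊥-elim (c≢d (true-does (c ≟B d) e))
    go : Dec (c ≡ d) → ∃ λ X → ∃ λ Y → V X ≡ true × W Y ≡ true ×
           (∀ i → lookup (c ∷ a) i ≢ lookup (d ∷ b) i → lookup X i ≡ lookup Y i)
    go (yes c≡d) with thick⇒child V j J thV | thick⇒child W j J thW
    ... | x , thx | y , thy = recurse x y thx thy (λ c≢d → ⊥-elim (c≢d c≡d))
    go (no c≢d) with free j agr₀ c≢d
    ... | refl with common-child V W g h J evV evW c≢d (few c) (thick⇒quota V false J thV) (thick⇒quota W false J thW)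
    ... | x , pq with ∧-true pq
    ... | thx , thy = recurse x x thx thy (λ _ → refl)

-- Formulas from covers

SepLists : Formula m → List (Vec Bool m) → List (Vec Bool m) → Set
SepLists φ A B = (∀ {a} → a ∈ A → evalΦ φ a ≡ true) × (∀ {b} → b ∈ B → evalΦ φ b ≡ false)

negΦ : Formula m → Formula m
negΦ (lit i b) = lit i (not b)
negΦ (and φ ψ) = or (negΦ φ) (negΦ ψ)
negΦ (or φ ψ)  = and (negΦ φ) (negΦ ψ)

leaves-neg : ∀ (φ : Formula m) → leaves (negΦ φ) ≡ leaves φ
leaves-neg (lit i b) = refl
leaves-neg (and φ ψ) = cong₂ _+_ (leaves-neg φ) (leaves-neg ψ)
leaves-neg (or φ ψ)  = cong₂ _+_ (leaves-neg φ) (leaves-neg ψ)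

evalΦ-neg : ∀ (φ : Formula m) x → evalΦ (negΦ φ) x ≡ not (evalΦ φ x)
evalΦ-neg (lit i true)  x with lookup x i
... | true  = refl
... | false = refl
evalΦ-neg (lit i false) x with lookup x i
... | true  = refl
... | false = refl
evalΦ-neg (and φ ψ) x rewrite evalΦ-neg φ x | evalΦ-neg ψ x with evalΦ φ x
... | true  = refl
... | false = refl
evalΦ-neg (or φ ψ) x rewrite evalΦ-neg φ x | evalΦ-neg ψ x with evalΦ φ x
... | true  = refl
... | false = refl

-- Exchanges the two sides at no cost in leaves, so the covering by disjunctions also serves for
-- covering Bob's side.
SepLists-neg : ∀ (φ : Formula m) {A B} → SepLists φ B A → SepLists (negΦ φ) A B
SepLists-neg φ (s , t) = (λ i → trans (evalΦ-neg φ _) (cong not (t i))) ,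
                               (λ i → trans (evalΦ-neg φ _) (cong not (s i)))

SepLists-or : ∀ (φ ψ : Formula m) {A A₁ A₀ B} → (∀ {a} → a ∈ A → a ∈ A₁ ⊎ a ∈ A₀) →
              SepLists φ A₁ B → SepLists ψ A₀ B → SepLists (or φ ψ) A B
SepLists-or φ ψ {A} {B = B} split (s₁ , t₁) (s₀ , t₀) = pos , neg′
  where
  pos : ∀ {a} → a ∈ A → evalΦ (or φ ψ) a ≡ true
  pos {a} i with split i
  ... | inj₁ i₁ rewrite s₁ i₁ = refl
  ... | inj₂ i₀ rewrite s₀ i₀ with evalΦ φ a
  ... | true  = refl
  ... | false = refl
  neg′ : ∀ {b} → b ∈ B → evalΦ (or φ ψ) b ≡ false
  neg′ i rewrite t₁ i = t₀ i

indices : Vec Bool m → List (Fin m)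
indices []          = []
indices (true  ∷ J) = zero ∷ map suc (indices J)
indices (false ∷ J) = map suc (indices J)

agreeOn-indices : ∀ J (a b : Vec Bool m) → All (λ i → lookup a i ≡ lookup b i) (indices J) →
                  agreeOn J a b ≡ true
agreeOn-indices []          []      []      eqs        = refl
agreeOn-indices (true  ∷ J) (a ∷ as) (b ∷ bs) (eq ∷ eqs)
  rewrite dec-true (a ≟B b) eq = agreeOn-indices J as bs (map⁻ eqs)
agreeOn-indices (false ∷ J) (a ∷ as) (b ∷ bs) eqs = agreeOn-indices J as bs (map⁻ eqs)

2^∣_∣ : Vec Bool m → ℕ
2^∣ [] ∣        = 1
2^∣ true  ∷ J ∣ = 2 * 2^∣ J ∣
2^∣ false ∷ J ∣ = 2^∣ J ∣

2^length-indices : ∀ (J : Vec Bool m) → 2 ^ length (indices J) ≡ 2^∣ J ∣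
2^length-indices []          = refl
2^length-indices (true  ∷ J) = cong (2 *_) (trans (cong (2 ^_) (length-map suc (indices J))) (2^length-indices J))
2^length-indices (false ∷ J) = trans (cong (2 ^_) (length-map suc (indices J))) (2^length-indices J)

1≤2^∣∣ : ∀ (J : Vec Bool m) → 1 ≤ 2^∣ J ∣
1≤2^∣∣ J = ≤-trans (m^n>0 2 (length (indices J))) (≤-reflexive (2^length-indices J))

-- The sum of `2^|J ∪ K|` over all `K`: a coordinate in `J` contributes `2 + 2`, any other `1 + 2`.
-- Summing over `J` as well gives `3 + 4 = 7` per coordinate, the origin of the base 7 below.
joinWeight : Vec Bool m → ℕ
joinWeight []          = 1
joinWeight (true  ∷ J) = 4 * joinWeight J
joinWeight (false ∷ J) = 3 * joinWeight J

∑-2^∣∨∣ : ∀ (J : Vec Bool m) → ∑ (allVecs m) (λ K → 2^∣ zipWith _∨_ K J ∣) ≡ joinWeight J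
∑-2^∣∨∣ [] = refl
∑-2^∣∨∣ {suc m} (true ∷ J) = trans (∑-allVecs-suc m _)
  (trans (cong₂ _+_ both-true both-true) (four (joinWeight J)))
  where
  both-true : ∑ (allVecs m) (λ K → 2 * 2^∣ zipWith _∨_ K J ∣) ≡ 2 * joinWeight J
  both-true = trans (∑-*ˡ (allVecs m) 2 _) (cong (2 *_) (∑-2^∣∨∣ J))
  four : ∀ a → 2 * a + 2 * a ≡ 4 * a
  four = solve-∀
∑-2^∣∨∣ {suc m} (false ∷ J) = trans (∑-allVecs-suc m _)
  (cong₂ _+_ (∑-2^∣∨∣ J) (trans (∑-*ˡ (allVecs m) 2 _) (cong (2 *_) (∑-2^∣∨∣ J))))

1≤joinWeight : ∀ (J : Vec Bool m) → 1 ≤ joinWeight J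
1≤joinWeight []          = ≤-refl
1≤joinWeight (true  ∷ J) = *-mono-≤ (s≤s {n = 3} z≤n) (1≤joinWeight J)
1≤joinWeight (false ∷ J) = *-mono-≤ (s≤s {n = 2} z≤n) (1≤joinWeight J)

∑-joinWeight : ∀ m → ∑ (allVecs m) joinWeight ≡ 7 ^ m
∑-joinWeight zero    = refl
∑-joinWeight (suc m) = trans (∑-allVecs-suc m joinWeight)
  (trans (cong₂ _+_ (trans (∑-*ˡ (allVecs m) 3 _) (cong (3 *_) (∑-joinWeight m)))
                    (trans (∑-*ˡ (allVecs m) 4 _) (cong (4 *_) (∑-joinWeight m)))) (seven (7 ^ m)))
  where
  seven : ∀ a → 3 * a + 4 * a ≡ 7 * a
  seven = solve-∀

𝟙-does-true : ∀ b → 𝟙 (does (b ≟B true)) ≡ 𝟙 b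
𝟙-does-true true  = refl
𝟙-does-true false = refl

module Split {A : Set} (p : A → Bool) where

  part : Bool → List A → List A
  part c = filter (λ x → p x ≟B c)

  ∈-part : ∀ {x xs} → x ∈ xs → x ∈ part true xs ⊎ x ∈ part false xs
  ∈-part {x} i with p x in eq
  ... | true  = inj₁ (∈-filter⁺ (λ x → p x ≟B true) i eq)
  ... | false = inj₂ (∈-filter⁺ (λ x → p x ≟B false) i eq)

  part-∈ : ∀ c {x xs} → x ∈ part c xs → x ∈ xs × p x ≡ c
  part-∈ c {xs = xs} = ∈-filter⁻ (λ x → p x ≟B c) {xs = xs}

  length-true : ∀ xs → length (part true xs) ≡ ∑ xs (𝟙 ∘ p)
  length-true xs = trans (length-filter-𝟙 (λ x → p x ≟B true) xs) (∑-cong xs (λ x → 𝟙-does-true (p x)))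

  length-parts : ∀ xs → length (part true xs) + length (part false xs) ≡ length xs
  length-parts xs = trans (cong₂ _+_ (length-filter-𝟙 (λ x → p x ≟B true) xs) (length-filter-𝟙 (λ x → p x ≟B false) xs))
    (trans (sym (∑-+ xs _ _)) (trans (∑-cong xs (λ x → one (p x))) (sym (length-∑ xs))))
    where
    one : ∀ b → 𝟙 (does (b ≟B true)) + 𝟙 (does (b ≟B false)) ≡ 1
    one true  = refl
    one false = refl

-- The term + 2 makes the recursion leaves (j ∷ js) = 2 + 2 * leaves js close; constants
-- cost two leaves, as formulas have none.
project : Fin m → ∀ js (A B : List (Vec Bool m)) →
          (∀ {a b} → a ∈ A → b ∈ B → ¬ All (λ j → lookup a j ≡ lookup b j) js) →
          ∃ λ φ → SepLists φ A B × leaves φ + 2 ≤ 4 * 2 ^ length js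
project z [] []      B       sep = and (lit z true) (lit z false) , ((λ ()) , λ {b} _ → const-false b) , ≤-refl
  where
  const-false : ∀ b → evalΦ (and (lit z true) (lit z false)) b ≡ false
  const-false b with lookup b z
  ... | true  = refl
  ... | false = refl
project z [] A@(_ ∷ _) []      sep = or (lit z true) (lit z false) , ((λ {a} _ → const-true a) , λ ()) , ≤-refl
  where
  const-true : ∀ a → evalΦ (or (lit z true) (lit z false)) a ≡ true
  const-true a with lookup a z
  ... | true  = refl
  ... | false = refl
project z [] (a ∷ A) (b ∷ B) sep = ⊥-elim (sep (here refl) (here refl) [])
project {m} z (j ∷ js) A B sep = go (half true) (half false)
  where
  open Split (λ (x : Vec Bool m) → lookup x j)
  half : ∀ c → ∃ λ φ → SepLists φ (part c A) (part c B) × leaves φ + 2 ≤ 4 * 2 ^ length js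
  half c = project z js (part c A) (part c B) (λ i k eqs →
    sep (proj₁ (part-∈ c i)) (proj₁ (part-∈ c k))
        (trans (proj₂ (part-∈ c {xs = A} i)) (sym (proj₂ (part-∈ c {xs = B} k))) ∷ eqs))
  go : _ → _ → ∃ λ φ → SepLists φ A B × leaves φ + 2 ≤ 4 * 2 ^ suc (length js)
  go (φ₁ , (s₁ , t₁) , l₁) (φ₀ , (s₀ , t₀) , l₀) = φ , (pos , neg′) , size
    where
    φ = or (and (lit j true) φ₁) (and (lit j false) φ₀)
    pos : ∀ {a} → a ∈ A → evalΦ φ a ≡ true
    pos {a} i with ∈-part i
    ... | inj₁ i₁ rewrite proj₂ (part-∈ true {xs = A} i₁) | s₁ i₁ = refl
    ... | inj₂ i₀ rewrite proj₂ (part-∈ false {xs = A} i₀) | s₀ i₀ = refl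
    neg′ : ∀ {b} → b ∈ B → evalΦ φ b ≡ false
    neg′ {b} i with ∈-part i
    ... | inj₁ i₁ rewrite proj₂ (part-∈ true {xs = B} i₁) | t₁ i₁ = refl
    ... | inj₂ i₀ rewrite proj₂ (part-∈ false {xs = B} i₀) | t₀ i₀ = refl
    size : leaves φ + 2 ≤ 4 * 2 ^ suc (length js)
    size = begin
      1 + leaves φ₁ + (1 + leaves φ₀) + 2              ≡⟨ lhs (leaves φ₁) (leaves φ₀) ⟩
      leaves φ₁ + 2 + (leaves φ₀ + 2)                  ≤⟨ +-mono-≤ l₁ l₀ ⟩
      4 * 2 ^ length js + 4 * 2 ^ length js            ≡⟨ rhs (2 ^ length js) ⟩
      4 * 2 ^ suc (length js)                          ∎
      where
      lhs : ∀ a b → 1 + a + (1 + b) + 2 ≡ a + 2 + (b + 2)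
      lhs = solve-∀
      rhs : ∀ a → 4 * a + 4 * a ≡ 4 * (2 * a)
      rhs = solve-∀

∈-nonempty : ∀ {A : Set} {xs : List A} → 1 ≤ length xs → ∃ (_∈ xs)
∈-nonempty {xs = x ∷ xs} _ = x , here refl

nonempty-∈ : ∀ {A : Set} {xs : List A} {x} → x ∈ xs → 1 ≤ length xs
nonempty-∈ {xs = x ∷ xs} _ = s≤s z≤n

-- Greedy weighted covering. The bound Z * (s / 2 ^ k + k) is, for every k, a linear
-- upper estimate of Z * (1 + log s), exact at s = 2 ^ k; it replaces harmonic sums.
module Cover {Ix : Set} (Is : List Ix) (mem : Vec Bool m → Ix → Bool) (cost : Ix → ℕ)
             (w q Z : ℕ) (B : List (Vec Bool m)) (1≤w : 1 ≤ w) (1≤cost : ∀ ι → 1 ≤ cost ι)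
             (∑cost≤Z : ∑ Is cost ≤ Z)
             (piece : ∀ ι A → 1 ≤ length A → (∀ {a} → a ∈ A → mem a ι ≡ true) →
                      ∃ λ φ → SepLists φ A B × leaves φ * q ≤ cost ι) where

  Covered : List (Vec Bool m) → Set
  Covered A = ∀ {a} → a ∈ A → w ≤ ∑ Is (𝟙 ∘ mem a)

  -- Each element lies in at least `w` pieces while the total cost is at most `Z`. By averaging,
  -- some piece costs at most `Z / (s * w)` per element of `A` that it contains, where
  -- `s = length A`.
  best : ∀ A → 1 ≤ length A → Covered A →
         ∃ λ ι → length A * (w * cost ι) ≤ Z * ∑ A (λ a → 𝟙 (mem a ι))
  best A 1≤A cov with ∃-below-average Is _ _ (indices≥1 Is (≤-trans 1≤w (cov (proj₂ (∈-nonempty 1≤A))))) total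
    where
    s = length A
    indices≥1 : ∀ (Is : List Ix) {f} → 1 ≤ ∑ Is f → 1 ≤ length Is
    indices≥1 (_ ∷ _) _ = s≤s z≤n
    total : ∑ Is (λ ι → s * (w * cost ι)) ≤ ∑ Is (λ ι → Z * ∑ A (λ a → 𝟙 (mem a ι)))
    total = begin
      ∑ Is (λ ι → s * (w * cost ι))        ≡⟨ trans (∑-*ˡ Is s _) (cong (s *_) (∑-*ˡ Is w cost)) ⟩
      s * (w * ∑ Is cost)                  ≤⟨ *-monoʳ-≤ s (*-monoʳ-≤ w ∑cost≤Z) ⟩
      s * (w * Z)                          ≡⟨ trans (sym (*-assoc s w Z)) (*-comm (s * w) Z) ⟩
      Z * (s * w)                          ≡⟨ cong (Z *_) (∑-const A w) ⟨
      Z * ∑ A (λ _ → w)                    ≤⟨ *-monoʳ-≤ Z (∑-mono-All (All.tabulate cov)) ⟩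
      Z * ∑ A (λ a → ∑ Is (𝟙 ∘ mem a))     ≡⟨ cong (Z *_) (∑-swap A Is _) ⟩
      Z * ∑ Is (λ ι → ∑ A (λ a → 𝟙 (mem a ι)))   ≡⟨ ∑-*ˡ Is Z _ ⟨
      ∑ Is (λ ι → Z * ∑ A (λ a → 𝟙 (mem a ι)))   ∎
  ... | ι , _ , le = ι , le

  -- While `2^k ≤ s`, with `s = length A`, removing `r` elements greedily costs at most
  -- `Z * r / (w * 2^k)`, which is the drop of the linear estimate. Once `s` falls below the power
  -- for the current exponent, the estimate for the next smaller exponent implies the required one.
  cover : ∀ fuel k A → length A ≤ fuel → 1 ≤ length A → Covered A →
          ∃ λ φ → SepLists φ A B × 2 ^ k * w * (leaves φ * q) ≤ Z * (length A + k * 2 ^ k)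
  cover-step : ∀ fuel k A → length A ≤ fuel → 1 ≤ length A → Covered A → 2 ^ k ≤ length A →
          ∃ λ φ → SepLists φ A B × 2 ^ k * w * (leaves φ * q) ≤ Z * (length A + k * 2 ^ k)

  cover fuel zero A A≤ 1≤A cov = cover-step fuel zero A A≤ 1≤A cov 1≤A
  cover fuel (suc k) A A≤ 1≤A cov with 2 ^ suc k ≤? length A
  ... | yes p = cover-step fuel (suc k) A A≤ 1≤A cov p
  ... | no ¬p with cover fuel k A A≤ 1≤A cov
  ... | φ , sep , le = φ , sep , (begin
    2 * 2 ^ k * w * (leaves φ * q)          ≡⟨ lhs (2 ^ k) w (leaves φ * q) ⟩
    2 * (2 ^ k * w * (leaves φ * q))        ≤⟨ *-monoʳ-≤ 2 le ⟩
    2 * (Z * (s + k * 2 ^ k))               ≡⟨ rhs Z s k (2 ^ k) ⟩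
    Z * (s + (s + k * (2 * 2 ^ k)))         ≤⟨ *-monoʳ-≤ Z (+-monoʳ-≤ s (+-monoˡ-≤ _ (<⇒≤ (≰⇒> ¬p)))) ⟩
    Z * (s + suc k * 2 ^ suc k)             ∎)
    where
    s = length A
    lhs : ∀ a w l → 2 * a * w * l ≡ 2 * (a * w * l)
    lhs = solve-∀
    rhs : ∀ Z s k a → 2 * (Z * (s + k * a)) ≡ Z * (s + (s + k * (2 * a)))
    rhs = solve-∀

  cover-step zero k A A≤ 1≤A cov _ = ⊥-elim (1+n≰n (≤-trans 1≤A A≤))
  cover-step (suc fuel) k A A≤ 1≤A cov 2^k≤ with best A 1≤A cov
  ... | ι , ιbest = go (part false A) refl
    where
    open Split (λ a → mem a ι)
    s = length A
    r = length (part true A)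
    Good : ℕ → Set
    Good l = 2 ^ k * w * (l * q) ≤ Z * (s + k * 2 ^ k)
    sw≤Zr : s * (w * cost ι) ≤ Z * r
    sw≤Zr = ≤-trans ιbest (≤-reflexive (cong (Z *_) (sym (length-true A))))
    -- The chosen piece has positive cost, so the averaging inequality forces it to contain an
    -- element of `A`; the recursion therefore shrinks `A` and the fuel lasts.
    1≤r : 1 ≤ r
    1≤r with r in r≡
    ... | suc _ = s≤s z≤n
    ... | zero  = ⊥-elim (1+n≰n (≤-trans (*-mono-≤ 1≤A (*-mono-≤ 1≤w (1≤cost ι)))
                    (≤-trans sw≤Zr (≤-reflexive (trans (cong (Z *_) r≡) (*-zeroʳ Z))))))
    first = piece ι (part true A) 1≤r (λ i → proj₂ (part-∈ true {xs = A} i))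
    first≤ : 2 ^ k * w * (leaves (proj₁ first) * q) ≤ Z * r
    first≤ = begin
      2 ^ k * w * (leaves (proj₁ first) * q)   ≤⟨ *-mono-≤ (*-monoˡ-≤ w 2^k≤) (proj₂ (proj₂ first)) ⟩
      s * w * cost ι                           ≡⟨ *-assoc s w (cost ι) ⟩
      s * (w * cost ι)                         ≤⟨ sw≤Zr ⟩
      Z * r                                    ∎
    go : ∀ A₀ → part false A ≡ A₀ → ∃ λ φ → SepLists φ A B × Good (leaves φ)
    go [] eq = proj₁ first , (pos , proj₂ (proj₁ (proj₂ first))) ,
      ≤-trans first≤ (*-monoʳ-≤ Z (≤-trans (≤-trans (m≤m+n r _) (≤-reflexive (length-parts A))) (m≤m+n s _)))
      where
      pos : ∀ {a} → a ∈ A → evalΦ (proj₁ first) a ≡ true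
      pos i with ∈-part i
      ... | inj₁ i₁ = proj₁ (proj₁ (proj₂ first)) i₁
      ... | inj₂ i₀ with subst (_ ∈_) eq i₀
      ... | ()
    go (a₀ ∷ A₀) eq with cover fuel k (part false A) shorter
                           (≤-trans (s≤s z≤n) (≤-reflexive (cong length (sym eq))))
                           (λ i → cov (proj₁ (part-∈ false i)))
      where
      shorter : length (part false A) ≤ fuel
      shorter = ≤-pred (begin
        suc (length (part false A))    ≤⟨ +-monoˡ-≤ _ 1≤r ⟩
        r + length (part false A)      ≡⟨ length-parts A ⟩
        s                              ≤⟨ A≤ ⟩
        suc fuel                       ∎)
    ... | ψ , sepψ , leψ = or (proj₁ first) ψ , SepLists-or (proj₁ first) ψ ∈-part (proj₁ (proj₂ first)) sepψ , (begin
      2 ^ k * w * ((leaves (proj₁ first) + leaves ψ) * q)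
        ≡⟨ distrib (2 ^ k * w) (leaves (proj₁ first)) (leaves ψ) q ⟩
      2 ^ k * w * (leaves (proj₁ first) * q) + 2 ^ k * w * (leaves ψ * q)
        ≤⟨ +-mono-≤ first≤ leψ ⟩
      Z * r + Z * (length (part false A) + k * 2 ^ k)
        ≡⟨ factor Z r (length (part false A)) (k * 2 ^ k) ⟩
      Z * (r + length (part false A) + k * 2 ^ k)
        ≡⟨ cong (λ z → Z * (z + k * 2 ^ k)) (length-parts A) ⟩
      Z * (s + k * 2 ^ k) ∎)
      where
      distrib : ∀ c a b q → c * ((a + b) * q) ≡ c * (a * q) + c * (b * q)
      distrib = solve-∀
      factor : ∀ Z r t e → Z * r + Z * (t + e) ≡ Z * (r + t + e)
      factor = solve-∀

  -- The choice `k = m` fits `length A ≤ 2^m` and turns the estimate into `Z * (m + 1)`.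
  covering-formula : ∀ A → length A ≤ 2 ^ m → 1 ≤ length A → Covered A →
                     ∃ λ φ → SepLists φ A B × w * (leaves φ * q) ≤ Z * suc m
  covering-formula A A≤ 1≤A cov with cover (length A) m A ≤-refl 1≤A cov
  ... | φ , sep , le = φ , sep , *-cancelˡ-≤ (2 ^ m) {{m^n≢0 2 m}} (begin
    2 ^ m * (w * (leaves φ * q))      ≡⟨ *-assoc (2 ^ m) w _ ⟨
    2 ^ m * w * (leaves φ * q)        ≤⟨ le ⟩
    Z * (length A + m * 2 ^ m)        ≤⟨ *-monoʳ-≤ Z (+-monoˡ-≤ _ A≤) ⟩
    Z * (suc m * 2 ^ m)               ≡⟨ regroup Z (suc m) (2 ^ m) ⟩
    2 ^ m * (Z * suc m)               ∎)
    where
    regroup : ∀ Z a b → Z * (a * b) ≡ b * (Z * a)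
    regroup = solve-∀

-- or over J of (and over K of a formula in the variables J ∪ K): Alice's J is announced first,
-- Bob then enlarges it. Enlarging is harmless because the families are closed under supersets.
separation : Fin m → ∀ (F G : Vec Bool m → Vec Bool m → Bool) →
  (∀ a K J → F a J ≡ true → F a (zipWith _∨_ K J) ≡ true) →
  (∀ b K J → G b J ≡ true → G b (zipWith _∨_ K J) ≡ true) →
  ∀ w (A B : List (Vec Bool m)) → 1 ≤ w →
  length A ≤ 2 ^ m → length B ≤ 2 ^ m → 1 ≤ length A → 1 ≤ length B →
  (∀ {a} → a ∈ A → w ≤ ∑ (allVecs m) (𝟙 ∘ F a)) →
  (∀ {b} → b ∈ B → w ≤ ∑ (allVecs m) (𝟙 ∘ G b)) →
  (∀ a b J → F a J ≡ true → G b J ≡ true → agreeOn J a b ≡ true → ⊥) →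
  ∃ λ φ → SepLists φ A B × w * (leaves φ * w) ≤ 4 * suc m * 7 ^ m * suc m
separation {m} z F G F-∨ G-∨ w A B 1≤w A≤ B≤ 1≤A 1≤B covA covB disagree = outer-result
  where
  V = Vec Bool m
  bob-cost : V → V → ℕ
  bob-cost J K = 4 * 2^∣ zipWith _∨_ K J ∣
  alice-cost : V → ℕ
  alice-cost J = 4 * suc m * joinWeight J

  inner : ∀ J A′ → 1 ≤ length A′ → (∀ {a} → a ∈ A′ → F a J ≡ true) →
          ∃ λ φ → SepLists φ A′ B × leaves φ * w ≤ alice-cost J
  inner J A′ 1≤A′ F-A′ with Cover.covering-formula (allVecs m) (λ b K → G b (zipWith _∨_ K J)) (bob-cost J) w 1
    (4 * joinWeight J) A′ 1≤w (λ K → *-mono-≤ (s≤s {n = 3} z≤n) (1≤2^∣∣ (zipWith _∨_ K J)))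
    (≤-reflexive (trans (∑-*ˡ (allVecs m) 4 _) (cong (4 *_) (∑-2^∣∨∣ J)))) piece B B≤ 1≤B cov
    where
    -- If `K` is good for `b`, so is `J ∪ K` by closure under supersets; hence each `b` is still
    -- covered by at least `w` indices.
    cov : ∀ {b} → b ∈ B → w ≤ ∑ (allVecs m) (λ K → 𝟙 (G b (zipWith _∨_ K J)))
    cov {b} i = ≤-trans (covB i) (∑-mono (allVecs m) (λ K → 𝟙-mono (λ g →
      subst (λ L → G b L ≡ true) (zipWith-comm ∨-comm J K) (G-∨ b J K g))))
    piece : ∀ K B′ → 1 ≤ length B′ → (∀ {b} → b ∈ B′ → G b (zipWith _∨_ K J) ≡ true) →
            ∃ λ φ → SepLists φ B′ A′ × leaves φ * 1 ≤ bob-cost J K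
    piece K B′ _ G-B′ with project z (indices (zipWith _∨_ K J)) B′ A′ (λ {b} {a} i k eqs →
      disagree a b (zipWith _∨_ K J) (F-∨ a K J (F-A′ k)) (G-B′ i)
        (agreeOn-indices (zipWith _∨_ K J) a b (All.map sym eqs)))
    ... | φ , sep , le = φ , sep , (begin
      leaves φ * 1                                  ≡⟨ *-identityʳ _ ⟩
      leaves φ                                      ≤⟨ m≤m+n _ 2 ⟩
      leaves φ + 2                                  ≤⟨ le ⟩
      4 * 2 ^ length (indices (zipWith _∨_ K J))    ≡⟨ cong (4 *_) (2^length-indices (zipWith _∨_ K J)) ⟩
      bob-cost J K                                  ∎)
  ... | φ , sep , le = negΦ φ , SepLists-neg φ sep , (begin
    leaves (negΦ φ) * w            ≡⟨ cong (_* w) (leaves-neg φ) ⟩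
    leaves φ * w                   ≡⟨ regroup (leaves φ) w ⟩
    w * (leaves φ * 1)             ≤⟨ le ⟩
    4 * joinWeight J * suc m       ≡⟨ regroup′ (joinWeight J) (suc m) ⟩
    alice-cost J                   ∎)
    where
    regroup : ∀ l w → l * w ≡ w * (l * 1)
    regroup = solve-∀
    regroup′ : ∀ j k → 4 * j * k ≡ 4 * k * j
    regroup′ = solve-∀

  outer-result : ∃ λ φ → SepLists φ A B × w * (leaves φ * w) ≤ 4 * suc m * 7 ^ m * suc m
  -- The inner covering bounds `leaves φ * w` rather than `leaves φ`, which is why the scaling
  -- parameter `q` of the outer covering is `w`.
  outer-result = Cover.covering-formula (allVecs m) F alice-cost w w (4 * suc m * 7 ^ m) B 1≤w
    (λ J → *-mono-≤ (*-mono-≤ (s≤s {n = 3} z≤n) (s≤s {n = m} z≤n)) (1≤joinWeight J))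
    (≤-reflexive (trans (∑-*ˡ (allVecs m) (4 * suc m) joinWeight) (cong (4 * suc m *_) (∑-joinWeight m))))
    inner A A≤ 1≤A covA

-- Colouring functions by transcripts

∧-intro : ∀ {b c} → b ≡ true → c ≡ true → b ∧ c ≡ true
∧-intro refl refl = refl

-- Consistency of a move with a transcript bit: a receiver can follow either bit, a sender only the
-- bit sent.
accepts : Move → Bool → Bool
accepts rcv      σ = true
accepts (send τ) σ = does (τ ≟B σ)

sends : Move → Bool
sends rcv      = false
sends (send _) = true

nextMove : Tree I O (suc d) → I → Move
nextMove (node α r s) x = α x

descend : Move → Tree I O d → Tree I O d → Tree I O d
descend rcv      r s = r
descend (send _) r s = s

child : Tree I O (suc d) → Bool → I → Tree I O d
child (node α r s) σ x = descend (α x) (r σ) (s σ)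

run-exists : ∀ {x y : I} (tA tB : Tree I O d) → ∃ λ rs → ∃ λ oa → ∃ λ ob → Run x y tA tB rs oa ob
run-exists (leaf oa) (leaf ob) = [] , oa , ob , end
run-exists {x = x} {y} (node αA rA sA) (node αB rB sB) with αA x in eA | αB y in eB
... | rcv    | rcv    with run-exists (rA false) (rB false)
... | _ , _ , _ , run = _ , _ , _ , bothRcv false false eA eB run
run-exists {x = x} {y} (node αA rA sA) (node αB rB sB) | rcv    | send τ with run-exists (rA τ) (sB τ)
... | _ , _ , _ , run = _ , _ , _ , sendB τ eA eB run
run-exists {x = x} {y} (node αA rA sA) (node αB rB sB) | send σ | rcv    with run-exists (sA σ) (rB σ)
... | _ , _ , _ , run = _ , _ , _ , sendA σ eA eB run
run-exists {x = x} {y} (node αA rA sA) (node αB rB sB) | send σ | send τ with run-exists (sA σ) (sB τ)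
... | _ , _ , _ , run = _ , _ , _ , bothSnd σ τ eA eB run

-- Even a silent or wasted round can be taken along a common bit σ.
run-extend : ∀ {x y : I} (tA tB : Tree I O (suc d)) σ {rs oa ob} →
             accepts (nextMove tA x) σ ≡ true → accepts (nextMove tB y) σ ≡ true →
             Run x y (child tA σ x) (child tB σ y) rs oa ob → ∃ λ r → Run x y tA tB (r ∷ rs) oa ob
run-extend {x = x} {y} (node αA rA sA) (node αB rB sB) σ accA accB run with αA x in eA | αB y in eB
... | rcv | rcv = silent , bothRcv σ σ eA eB run
... | rcv | send τ with refl ← true-does (τ ≟B σ) accB = classical , sendB σ eA eB run
... | send τ | rcv with refl ← true-does (τ ≟B σ) accA = classical , sendA σ eA eB run
... | send τ | send ρ with refl ← true-does (τ ≟B σ) accA | refl ← true-does (ρ ≟B σ) accB =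
  wasted , bothSnd σ σ eA eB run

-- Some run always exists, and its first round must be classical; this determines who sends and who
-- receives.
classical-round : ∀ {x y : I} (tA tB : Tree I O (suc d)) →
  (∀ rs oa ob → Run x y tA tB rs oa ob → All (_≡ classical) rs) →
  (∃ λ σ → nextMove tA x ≡ send σ × nextMove tB y ≡ rcv) ⊎ (∃ λ τ → nextMove tA x ≡ rcv × nextMove tB y ≡ send τ)
classical-round tA@(node _ _ _) tB@(node _ _ _) cl with run-exists tA tB
... | _ , _ , _ , run@(sendA σ eA eB _) = inj₁ (σ , eA , eB)
... | _ , _ , _ , run@(sendB τ eA eB _) = inj₂ (τ , eA , eB)
... | _ , _ , _ , run@(bothSnd _ _ _ _ _) with () ← All.head (cl _ _ _ run)
... | _ , _ , _ , run@(bothRcv _ _ _ _ _) with () ← All.head (cl _ _ _ run)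

-- A player's situation after some rounds: the inputs still consistent with the
-- transcript, and the vertex each of them has reached.
record Side (I O : Set) (d : ℕ) : Set where
  constructor side
  field
    tree : I → Tree I O d
    live : I → Bool
open Side

step : Bool → Side I O (suc d) → Side I O d
step σ S = side (λ x → child (tree S x) σ x) (λ x → live S x ∧ accepts (nextMove (tree S x) x) σ)

advance : ∀ π → Side I O (length π + d) → Side I O d
advance []      S = S
advance (σ ∷ π) S = advance π (step σ S)

consistent-child : ∀ (t : Tree I O (suc d)) σ π {x} → accepts (nextMove t x) σ ≡ true →
                   Consistent (child t σ x) π x → Consistent t (σ ∷ π) x
consistent-child (node α r s) σ π {x} acc (es , eq , lab) with α x in e
... | rcv = rcvE σ ∷ es , cong (σ ∷_) eq , e , lab
... | send τ with refl ← true-does (τ ≟B σ) acc = sendE σ ∷ es , cong (σ ∷_) eq , e , lab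

child-consistent : ∀ (t : Tree I O (suc d)) σ π {x} → Consistent t (σ ∷ π) x →
                   accepts (nextMove t x) σ ≡ true × Consistent (child t σ x) π x
child-consistent (node α r s) σ .(map bit es) (rcvE .σ ∷ es , refl , e , lab)
  rewrite e = refl , es , refl , lab
child-consistent (node α r s) σ .(map bit es) (sendE .σ ∷ es , refl , e , lab)
  rewrite e = dec-true (σ ≟B σ) refl , es , refl , lab

live-advance : ∀ π (S : Side I O (length π + d)) {x} → live (advance π S) x ≡ true →
               live S x ≡ true × Consistent (tree S x) π x
live-advance []      S l = l , [] , refl , tt
live-advance (σ ∷ π) S {x} l with live-advance π (step σ S) l
... | l′ , c with ∧-true {live S x} l′
... | l″ , acc = l″ , consistent-child (tree S x) σ π acc c

advance-live : ∀ π (S : Side I O (length π + d)) {x} → live S x ≡ true →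
               Consistent (tree S x) π x → live (advance π S) x ≡ true
advance-live []      S l c = l
advance-live (σ ∷ π) S {x} l c with child-consistent (tree S x) σ π c
... | acc , c′ = advance-live π (step σ S) (∧-intro l acc) c′

InLabel⇒length≤ : ∀ (t : Tree I O d) es {x} → InLabel t es x → length es ≤ d
InLabel⇒length≤ t            []             _         = z≤n
InLabel⇒length≤ (node α r s) (rcvE σ ∷ es)  (_ , lab) = s≤s (InLabel⇒length≤ (r σ) es lab)
InLabel⇒length≤ (node α r s) (sendE σ ∷ es) (_ , lab) = s≤s (InLabel⇒length≤ (s σ) es lab)

some : (Mat m n → Bool) → Bool
some {m} {n} p = does (1 ≤? ∑ (allMats m n) (𝟙 ∘ p))

some⁺ : ∀ (p : Mat m n → Bool) {X} → p X ≡ true → some p ≡ true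
some⁺ {m} {n} p {X} eq = dec-true (1 ≤? ∑ (allMats m n) (𝟙 ∘ p)) (∃⇒∑-𝟙 p (∈-allMats X) eq)

some⁻ : ∀ (p : Mat m n → Bool) → some p ≡ true → ∃ λ X → p X ≡ true
some⁻ {m} {n} p eq = ∑-𝟙⇒∃ (allMats m n) p (true-does (1 ≤? ∑ (allMats m n) (𝟙 ∘ p)) eq)

module Colouring (m n : ℕ) where

  Player : ℕ → Set
  Player = Side (Input m n) (Out m n)

  Correct : Player d → Player d → Set
  Correct SA SB = ∀ x y → live SA x ≡ true → live SB y ≡ true →
    ∀ rs oa ob → Run x y (tree SA x) (tree SB y) rs oa ob →
    (oa ≡ ob × ValidOut x y oa) × (proj₁ x ≡ proj₁ y → All (_≡ classical) rs)

  -- A run after the bit `σ` becomes a run before it by prepending one round, so validity carries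
  -- over unchanged and classicality by dropping that round.
  step-correct : ∀ σ (SA SB : Player (suc d)) → Correct SA SB → Correct (step σ SA) (step σ SB)
  step-correct σ SA SB ok x y lx ly rs oa ob run
    with ∧-true {live SA x} lx | ∧-true {live SB y} ly
  ... | lx′ , accA | ly′ , accB with run-extend (tree SA x) (tree SB y) σ accA accB run
  ... | r , run′ with ok x y lx′ ly′ (r ∷ rs) oa ob run′
  ... | valid , cl = valid , λ eq → All.tail (cl eq)

  advance-correct : ∀ π (SA SB : Player (length π + d)) → Correct SA SB →
                    Correct (advance π SA) (advance π SB)
  advance-correct []      SA SB ok = ok
  advance-correct (σ ∷ π) SA SB ok = advance-correct π (step σ SA) (step σ SB) (step-correct σ SA SB ok)

  -- Three bits for each internal vertex of the binary tree of continuations, in total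
  -- `3 * 2^d - 3`.
  bits : ℕ → ℕ
  bits zero    = 0
  bits (suc d) = 3 + (bits d + bits d)

  alive : Player d → Player d → BFun n → Bool
  alive SA SB g = some (λ X → live SA (g , X)) ∧ some (λ Y → live SB (g , Y))

  speaking : Player (suc d) → BFun n → Mat m n → Bool
  speaking S g X = live S (g , X) ∧ sends (nextMove (tree S (g , X)) (g , X))

  -- Only Alice's speaking is recorded: when `g` is alive every round on `g` is classical, so Bob
  -- speaks exactly when Alice does not, and the speaker is the same for all live inputs with `g`.
  colour : Player d → Player d → BFun n → Vec Bool (bits d)
  colour {zero}  SA SB g = []
  colour {suc d} SA SB g =
    some (speaking SA g) ∷ alive (step false SA) (step false SB) g ∷ alive (step true SA) (step true SB) g ∷
    colour (step false SA) (step false SB) g ++ᵥ colour (step true SA) (step true SB) g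

  alive⁺ : ∀ (SA SB : Player d) g {X Y} → live SA (g , X) ≡ true → live SB (g , Y) ≡ true →
           alive SA SB g ≡ true
  alive⁺ SA SB g lX lY = ∧-intro (some⁺ (λ X → live SA (g , X)) lX) (some⁺ (λ Y → live SB (g , Y)) lY)

  alive⁻ : ∀ (SA SB : Player d) g → alive SA SB g ≡ true →
           (∃ λ X → live SA (g , X) ≡ true) × (∃ λ Y → live SB (g , Y) ≡ true)
  alive⁻ SA SB g eq with ∧-true {some (λ X → live SA (g , X))} eq
  ... | eA , eB = some⁻ _ eA , some⁻ _ eB

  colour-step : ∀ (SA SB : Player (suc d)) g h → colour SA SB g ≡ colour SA SB h → ∀ σ →
    alive (step σ SA) (step σ SB) g ≡ alive (step σ SA) (step σ SB) h ×
    colour (step σ SA) (step σ SB) g ≡ colour (step σ SA) (step σ SB) h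
  colour-step SA SB g h eq false =
    ∷-injectiveˡ (∷-injectiveʳ eq) , ++-injectiveˡ _ _ (∷-injectiveʳ (∷-injectiveʳ (∷-injectiveʳ eq)))
  colour-step SA SB g h eq true =
    ∷-injectiveˡ (∷-injectiveʳ (∷-injectiveʳ eq)) ,
    ++-injectiveʳ (colour (step false SA) (step false SB) g) (colour (step false SA) (step false SB) h)
      (∷-injectiveʳ (∷-injectiveʳ (∷-injectiveʳ eq)))

  -- Follows the mixed execution on `gA` and `gB`. Equal colours give equal speakers, so the mixed
  -- round is classical. The bit sent keeps the sender's function alive, and the colour transfers
  -- this to the other function.
  same-colour⇒solved : ∀ (SA SB : Player d) → Correct SA SB → ∀ gA gB X Y →
    live SA (gA , X) ≡ true → live SB (gB , Y) ≡ true →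
    alive SA SB gA ≡ true → alive SA SB gB ≡ true → colour SA SB gA ≡ colour SA SB gB →
    ∃ λ ij → ValidOut (gA , X) (gB , Y) (just ij)
  same-colour⇒solved {zero} SA SB ok gA gB X Y lX lY alA _ _ with alive⁻ SA SB gA alA
  ... | _ , Y′ , lY′ = go (tree SA (gA , X)) refl (tree SB (gB , Y)) refl (tree SB (gA , Y′)) refl
    where
    go : ∀ tA → tree SA (gA , X) ≡ tA → ∀ tB → tree SB (gB , Y) ≡ tB →
         ∀ tB′ → tree SB (gA , Y′) ≡ tB′ → ∃ λ ij → ValidOut (gA , X) (gB , Y) (just ij)
    -- The output at Alice's leaf is tested against a live `Y′` with the same function `gA`, for
    -- which `⊥` would claim `gA ≢ gA`.
    go (leaf nothing) eA (leaf ob) eB (leaf ob′) eB′ = ⊥-elim (proj₂ (proj₁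
      (ok (gA , X) (gA , Y′) lX lY′ [] nothing ob′ (subst₂ (λ s t → Run _ _ s t _ _ _) (sym eA) (sym eB′) end))) refl)
    go (leaf (just ij)) eA (leaf ob) eB (leaf ob′) eB′ = ij , proj₂ (proj₁
      (ok (gA , X) (gB , Y) lX lY [] (just ij) ob (subst₂ (λ s t → Run _ _ s t _ _ _) (sym eA) (sym eB) end)))
  same-colour⇒solved {suc d} SA SB ok gA gB X Y lX lY alA alB eq
    with alive⁻ SA SB gA alA | alive⁻ SA SB gB alB
  ... | _ , Y′ , lY′ | (X′ , lX′) , _ = go (round gA X Y′ lX lY′)
    where
    mA : BFun n → Mat m n → Move
    mA g Z = nextMove (tree SA (g , Z)) (g , Z)
    mB : BFun n → Mat m n → Move
    mB g Z = nextMove (tree SB (g , Z)) (g , Z)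
    round : ∀ g X Y → live SA (g , X) ≡ true → live SB (g , Y) ≡ true →
      (∃ λ σ → mA g X ≡ send σ × mB g Y ≡ rcv) ⊎ (∃ λ τ → mA g X ≡ rcv × mB g Y ≡ send τ)
    round g X Y lX lY = classical-round (tree SA (g , X)) (tree SB (g , Y))
      (λ rs oa ob run → proj₂ (ok (g , X) (g , Y) lX lY rs oa ob run) refl)
    accept-rcv : ∀ {mv} σ → mv ≡ rcv → accepts mv σ ≡ true
    accept-rcv σ refl = refl
    accept-send : ∀ {mv} σ → mv ≡ send σ → accepts mv σ ≡ true
    accept-send σ refl = dec-true (σ ≟B σ) refl
    continue : ∀ σ → live (step σ SA) (gA , X) ≡ true → live (step σ SB) (gB , Y) ≡ true →
               alive (step σ SA) (step σ SB) gA ≡ true → alive (step σ SA) (step σ SB) gB ≡ true →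
               ∃ λ ij → ValidOut (gA , X) (gB , Y) (just ij)
    continue σ kX kY kA kB = same-colour⇒solved (step σ SA) (step σ SB) (step-correct σ SA SB ok)
      gA gB X Y kX kY kA kB (proj₂ (colour-step SA SB gA gB eq σ))
    go : (∃ λ σ → mA gA X ≡ send σ × mB gA Y′ ≡ rcv) ⊎ (∃ λ τ → mA gA X ≡ rcv × mB gA Y′ ≡ send τ) →
         ∃ λ ij → ValidOut (gA , X) (gB , Y) (just ij)
    go (inj₁ (σ , Xσ , Y′rcv)) = continue σ kX kY kA
        (trans (sym (proj₁ (colour-step SA SB gA gB eq σ))) kA)
      where
      -- The first colour bit yields a `Z` that makes Alice speak under `gB`; classicality of the
      -- round on `Z` and `Y` then forces Bob to receive on `Y`.
      gB-speaks : some (speaking SA gB) ≡ true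
      gB-speaks = trans (sym (∷-injectiveˡ eq)) (some⁺ (speaking SA gA) (∧-intro lX (cong sends Xσ)))
      Yrcv : mB gB Y ≡ rcv
      Yrcv with some⁻ (speaking SA gB) gB-speaks
      ... | Z , sZ with ∧-true {live SA (gB , Z)} sZ
      ... | lZ , Zsends with round gB Z Y lZ lY
      ... | inj₁ (_ , _ , e) = e
      ... | inj₂ (_ , e , _) with () ← trans (sym Zsends) (cong sends e)
      kX : live (step σ SA) (gA , X) ≡ true
      kX = ∧-intro lX (accept-send σ Xσ)
      kY : live (step σ SB) (gB , Y) ≡ true
      kY = ∧-intro lY (accept-rcv σ Yrcv)
      kA : alive (step σ SA) (step σ SB) gA ≡ true
      kA = alive⁺ (step σ SA) (step σ SB) gA kX (∧-intro lY′ (accept-rcv σ Y′rcv))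
    go (inj₂ (_ , Xrcv , Y′τ)) with round gB X′ Y lX′ lY
    -- If Alice spoke under `gB`, the colour would make her speak under `gA` too, for some `Z`. But
    -- Bob sends on `Y′`, so the round on `Z` and `Y′` would not be classical.
    ... | inj₁ (ρ , X′ρ , _) = ⊥-elim absurd
      where
      gA-speaks : some (speaking SA gA) ≡ true
      gA-speaks = trans (∷-injectiveˡ eq) (some⁺ (speaking SA gB) (∧-intro lX′ (cong sends X′ρ)))
      absurd : ⊥
      absurd with some⁻ (speaking SA gA) gA-speaks
      ... | Z , sZ with ∧-true {live SA (gA , Z)} sZ
      ... | lZ , Zsends with round gA Z Y′ lZ lY′
      ... | inj₁ (_ , _ , e) with () ← trans (sym e) Y′τ
      ... | inj₂ (_ , e , _) with () ← trans (sym Zsends) (cong sends e)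
    ... | inj₂ (τ , X′rcv , Yτ) = continue τ kX kY
        (trans (proj₁ (colour-step SA SB gA gB eq τ)) kB) kB
      where
      kX : live (step τ SA) (gA , X) ≡ true
      kX = ∧-intro lX (accept-rcv τ Xrcv)
      kY : live (step τ SB) (gB , Y) ≡ true
      kY = ∧-intro lY (accept-send τ Yτ)
      kB : alive (step τ SA) (step τ SB) gB ≡ true
      kB = alive⁺ (step τ SA) (step τ SB) gB (∧-intro lX′ (accept-rcv τ X′rcv)) kY

-- Numerical estimates

^-swap : ∀ a j k → (a ^ j) ^ k ≡ (a ^ k) ^ j
^-swap a j k = trans (^-*-assoc a j k) (trans (cong (a ^_) (*-comm j k)) (sym (^-*-assoc a k j)))

n≤2^⌈log₂n⌉ : ∀ n → n ≤ 2 ^ ⌈log₂ n ⌉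
n≤2^⌈log₂n⌉ = <-rec (λ n → n ≤ 2 ^ ⌈log₂ n ⌉) go
  where
  go : ∀ n → (∀ {k} → k < n → k ≤ 2 ^ ⌈log₂ k ⌉) → n ≤ 2 ^ ⌈log₂ n ⌉
  go 0 rec = z≤n
  go 1 rec = m^n>0 2 ⌈log₂ 1 ⌉
  go n@(suc (suc k)) rec = begin
    n                              ≡⟨ ⌊n/2⌋+⌈n/2⌉≡n n ⟨
    ⌊ n /2⌋ + ⌈ n /2⌉              ≤⟨ +-monoˡ-≤ ⌈ n /2⌉ (⌊n/2⌋≤⌈n/2⌉ n) ⟩
    ⌈ n /2⌉ + ⌈ n /2⌉              ≤⟨ +-mono-≤ half half ⟩
    2 ^ (⌈log₂ n ⌉ ∸ 1) + 2 ^ (⌈log₂ n ⌉ ∸ 1)   ≡⟨ cong (2 ^ (⌈log₂ n ⌉ ∸ 1) +_) (+-identityʳ _) ⟨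
    2 ^ suc (⌈log₂ n ⌉ ∸ 1)        ≡⟨ cong (2 ^_) (m+[n∸m]≡n (⌈log₂⌉-mono-≤ {2} {n} (s≤s (s≤s z≤n)))) ⟩
    2 ^ ⌈log₂ n ⌉                  ∎
    where
    half : ⌈ n /2⌉ ≤ 2 ^ (⌈log₂ n ⌉ ∸ 1)
    half = subst (λ z → ⌈ n /2⌉ ≤ 2 ^ z) (⌈log₂⌈n/2⌉⌉≡⌈log₂n⌉∸1 n) (rec (⌈n/2⌉<n k))

-- With N = 2 ^ n and v = 2 ^ r, two members of a family of density above 2 ^ (- N / (4 * v ^ 2))
-- agree on fewer than N / v points.
agreeing-family-density : ∀ r y (S : BFun (r + r + 1 + suc y) → Bool) → 1 ≤ r →
  (∀ g h → S g ≡ true → S h ≡ true → 2 ^ r * 2 ^ suc (suc y) ≤ agree g h) →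
  ∑ (allBFun (r + r + 1 + suc y)) (𝟙 ∘ S) * ∑ (allBFun (r + r + 1 + suc y)) (𝟙 ∘ S) * 2 ^ (2 ^ suc y) ≤
  4 ^ (2 ^ (r + r + 1 + suc y))
agreeing-family-density r y S 1≤r large =
  *-cancelʳ-≤ _ _ (Z * (v ^ k * (u * v) ^ N)) {{>-nonZero (*-mono-≤ (m^n>0 2 (2 ^ suc y)) (*-mono-≤ 1≤v^k 1≤uv^N))}} (begin
    σ * σ * Z * (Z * (v ^ k * (u * v) ^ N))          ≡⟨ move₁ (σ * σ) Z (v ^ k) ((u * v) ^ N) ⟩
    Z * Z * v ^ k * (σ * σ) * (u * v) ^ N            ≤⟨ *-monoˡ-≤ ((u * v) ^ N) (*-monoˡ-≤ (σ * σ) gain) ⟩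
    u ^ k * (σ * σ) * (u * v) ^ N                    ≤⟨ Antipodal.agreeing-family≤ u v 1≤v (r + r + 1 + suc y) S k (n≤1+n v) large ⟩
    ((u + v) * (u + v)) ^ N * v ^ k                  ≡⟨ cong (λ z → z ^ N * v ^ k) (complete-square v) ⟩
    suc (4 * (u * v)) ^ N * v ^ k                    ≤⟨ *-monoˡ-≤ (v ^ k) loss ⟩
    Z * (4 * (u * v)) ^ N * v ^ k                    ≡⟨ cong (λ z → Z * z * v ^ k) (*-distrib-^ N 4 (u * v)) ⟩
    Z * (4 ^ N * (u * v) ^ N) * v ^ k                ≡⟨ move₂ Z (4 ^ N) ((u * v) ^ N) (v ^ k) ⟩
    4 ^ N * (Z * (v ^ k * (u * v) ^ N))              ∎)
  where
  N = 2 ^ (r + r + 1 + suc y)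
  v = 2 ^ r
  u = suc v
  k = v * 2 ^ suc (suc y)
  Z = 2 ^ (2 ^ suc y)
  W = 4 * (v * v)
  σ = ∑ (allBFun (r + r + 1 + suc y)) (𝟙 ∘ S)
  1≤v : 1 ≤ v
  1≤v = m^n>0 2 r
  1≤v^k : 1 ≤ v ^ k
  1≤v^k = m^n>0 v {{>-nonZero 1≤v}} k
  1≤uv^N : 1 ≤ (u * v) ^ N
  1≤uv^N = m^n>0 (u * v) {{>-nonZero (*-mono-≤ (s≤s {n = v} z≤n) 1≤v)}} N
  move₁ : ∀ a Z b c → a * Z * (Z * (b * c)) ≡ Z * Z * b * a * c
  move₁ = solve-∀
  move₂ : ∀ Z a b c → Z * (a * b) * c ≡ a * (Z * (c * b))
  move₂ = solve-∀
  complete-square : ∀ v → (suc v + v) * (suc v + v) ≡ suc (4 * (suc v * v))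
  complete-square = solve-∀
  -- The power `(1 + 1/v)^v ≥ 2`, taken `2^(y+2)` times, gains two factors `Z`. One is lost in
  -- `loss`, and the other is the asserted saving.
  gain : Z * Z * v ^ k ≤ u ^ k
  gain = begin
    Z * Z * v ^ k                              ≡⟨ cong₂ _*_ (sym (^-distribˡ-+-* 2 (2 ^ suc y) (2 ^ suc y))) (sym (^-*-assoc v v (2 ^ suc (suc y)))) ⟩
    2 ^ (2 ^ suc y + 2 ^ suc y) * (v ^ v) ^ (2 ^ suc (suc y))
      ≡⟨ cong (λ z → 2 ^ (2 ^ suc y + z) * (v ^ v) ^ (2 ^ suc (suc y))) (sym (+-identityʳ (2 ^ suc y))) ⟩
    2 ^ (2 ^ suc (suc y)) * (v ^ v) ^ (2 ^ suc (suc y))    ≡⟨ *-distrib-^ (2 ^ suc (suc y)) 2 (v ^ v) ⟨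
    (2 * v ^ v) ^ (2 ^ suc (suc y))            ≤⟨ ^-monoˡ-≤ (2 ^ suc (suc y)) (2*v^v≤1+v^v v 1≤v) ⟩
    (u ^ v) ^ (2 ^ suc (suc y))                ≡⟨ ^-*-assoc u v (2 ^ suc (suc y)) ⟩
    u ^ k                                      ∎
  N≡ : N ≡ W * 2 ^ y
  N≡ = begin-equality
    2 ^ (r + r + 1 + suc y)                    ≡⟨ ^-distribˡ-+-* 2 (r + r + 1) (suc y) ⟩
    2 ^ (r + r + 1) * (2 * 2 ^ y)              ≡⟨ cong (_* (2 * 2 ^ y)) (^-distribˡ-+-* 2 (r + r) 1) ⟩
    2 ^ (r + r) * 2 * (2 * 2 ^ y)              ≡⟨ cong (λ z → z * 2 * (2 * 2 ^ y)) (^-distribˡ-+-* 2 r r) ⟩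
    v * v * 2 * (2 * 2 ^ y)                    ≡⟨ four (v * v) (2 ^ y) ⟩
    W * 2 ^ y                                  ∎
    where
    four : ∀ a b → a * 2 * (2 * b) ≡ 4 * a * b
    four = solve-∀
  1≤vv : 1 ≤ v * v
  1≤vv = *-mono-≤ 1≤v 1≤v
  W≡ : W ≡ 2 * (v * v) + 2 * (v * v)
  W≡ = four (v * v)
    where
    four : ∀ a → 4 * a ≡ 2 * a + 2 * a
    four = solve-∀
  1+W^N : suc W ^ N ≤ Z * W ^ N
  1+W^N = begin
    suc W ^ N                  ≡⟨ trans (cong (suc W ^_) N≡) (sym (^-*-assoc (suc W) W (2 ^ y))) ⟩
    (suc W ^ W) ^ (2 ^ y)      ≤⟨ ^-monoˡ-≤ (2 ^ y) (subst (λ z → suc z ^ z ≤ 4 * z ^ z) (sym W≡)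
                                    (1+s-power≤4 (2 * (v * v)) (*-mono-≤ (s≤s {n = 1} z≤n) 1≤vv))) ⟩
    (4 * W ^ W) ^ (2 ^ y)      ≡⟨ *-distrib-^ (2 ^ y) 4 (W ^ W) ⟩
    4 ^ (2 ^ y) * (W ^ W) ^ (2 ^ y)   ≡⟨ cong₂ _*_ (^-*-assoc 2 2 (2 ^ y)) (trans (^-*-assoc W W (2 ^ y)) (cong (W ^_) (sym N≡))) ⟩
    Z * W ^ N                  ∎
  -- Here `(u + v)^2 / (4uv) = 1 + 1/(4uv)`, which is at most `1 + 1/W` because `v ≤ u`. As
  -- `N = W * 2^y`, its `N`-th power is at most `4^(2^y) = Z`.
  loss : suc (4 * (u * v)) ^ N ≤ Z * (4 * (u * v)) ^ N
  loss = *-cancelʳ-≤ _ _ (W ^ N) {{m^n≢0 W N {{>-nonZero (*-mono-≤ (s≤s {n = 3} z≤n) 1≤vv)}}}} (begin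
    suc (4 * (u * v)) ^ N * W ^ N              ≡⟨ *-distrib-^ N (suc (4 * (u * v))) W ⟨
    (suc (4 * (u * v)) * W) ^ N                ≤⟨ ^-monoˡ-≤ N ratio ⟩
    (suc W * (4 * (u * v))) ^ N                ≡⟨ *-distrib-^ N (suc W) (4 * (u * v)) ⟩
    suc W ^ N * (4 * (u * v)) ^ N              ≤⟨ *-monoˡ-≤ _ 1+W^N ⟩
    Z * W ^ N * (4 * (u * v)) ^ N              ≡⟨ move Z (W ^ N) ((4 * (u * v)) ^ N) ⟩
    Z * (4 * (u * v)) ^ N * W ^ N              ∎)
    where
    move : ∀ a b c → a * b * c ≡ a * c * b
    move = solve-∀
    ratio : suc (4 * (u * v)) * W ≤ suc W * (4 * (u * v))
    ratio = begin
      W + 4 * (u * v) * W                ≤⟨ +-monoˡ-≤ (4 * (u * v) * W) (*-monoʳ-≤ 4 (*-monoˡ-≤ v (n≤1+n v))) ⟩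
      4 * (u * v) + 4 * (u * v) * W      ≡⟨ cong (4 * (u * v) +_) (*-comm (4 * (u * v)) W) ⟩
      suc W * (4 * (u * v))              ∎

-- With γ = 1 / q, the hypothesis 7 ^ q * 8 ≤ 8 ^ q says 2 ^ (2 γ) * (7 / 4) ≤ 2 ^ (1 - γ).
complexity-contradiction : ∀ q m e L → 1 ≤ q → 1 ≤ m → 7 ^ q * 8 ≤ 8 ^ q →
  q * m ≤ q * e + q + m →
  2 ^ e * (L * 2 ^ e) ≤ 4 * suc m * 7 ^ m * suc m →
  2 ^ (q * m) * m ^ (8 * q) * 2 ^ (8 * q) ≤ L ^ q * 2 ^ (1 * m) → ⊥
complexity-contradiction q m e L 1≤q 1≤m seven e-large upper lower =
  <⇒≱ gap (*-cancelˡ-≤ (T^q * T^q * T^q) {{>-nonZero (*-mono-≤ (*-mono-≤ 1≤T^q 1≤T^q) 1≤T^q)}} chain)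
  where
  T^q = 2 ^ (q * m)
  1≤T^q = m^n>0 2 (q * m)
  M = m * m
  D = 2 ^ e
  D^q = D ^ q
  T = 2 ^ m
  -- The `q`-th power of `2^m ≤ 2^e * 2 * 2^(γ m)`: the factor `2 ^ q` pays for rounding `e` down.
  scale : T^q ≤ D^q * 2 ^ q * T
  scale = begin
    2 ^ (q * m)                ≤⟨ ^-monoʳ-≤ 2 e-large ⟩
    2 ^ (q * e + q + m)        ≡⟨ trans (^-distribˡ-+-* 2 (q * e + q) m) (cong (_* T) (^-distribˡ-+-* 2 (q * e) q)) ⟩
    2 ^ (q * e) * 2 ^ q * T    ≡⟨ cong (λ z → z * 2 ^ q * T) (trans (cong (2 ^_) (*-comm q e)) (sym (^-*-assoc 2 e q))) ⟩
    D^q * 2 ^ q * T            ∎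
  upper′ : L * D * D ≤ 16 * M * 7 ^ m
  upper′ = begin
    L * D * D                          ≡⟨ lhs L D ⟩
    D * (L * D)                        ≤⟨ upper ⟩
    4 * suc m * 7 ^ m * suc m          ≤⟨ *-mono-≤ (*-monoˡ-≤ (7 ^ m) (*-monoʳ-≤ 4 sm)) sm ⟩
    4 * (m + m) * 7 ^ m * (m + m)      ≡⟨ rhs m (7 ^ m) ⟩
    16 * M * 7 ^ m                     ∎
    where
    sm : suc m ≤ m + m
    sm = +-monoˡ-≤ m 1≤m
    lhs : ∀ L D → L * D * D ≡ D * (L * D)
    lhs = solve-∀
    rhs : ∀ m s → 4 * (m + m) * s * (m + m) ≡ 16 * (m * m) * s
    rhs = solve-∀
  upper^q : L ^ q * D^q * D^q ≤ 16 ^ q * M ^ q * (7 ^ m) ^ q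
  upper^q = begin
    L ^ q * D^q * D^q                  ≡⟨ trans (*-distrib-^ q (L * D) D) (cong (_* D^q) (*-distrib-^ q L D)) ⟨
    (L * D * D) ^ q                    ≤⟨ ^-monoˡ-≤ q upper′ ⟩
    (16 * M * 7 ^ m) ^ q               ≡⟨ trans (*-distrib-^ q (16 * M) (7 ^ m)) (cong (_* (7 ^ m) ^ q) (*-distrib-^ q 16 M)) ⟩
    16 ^ q * M ^ q * (7 ^ m) ^ q       ∎
  seven^m : (7 ^ m) ^ q * (T * T * T) ≤ T^q * T^q * T^q
  seven^m = begin
    (7 ^ m) ^ q * (T * T * T)          ≡⟨ cong₂ _*_ (^-swap 7 m q) (trans (cong (_* T) (sym (*-distrib-^ m 2 2))) (sym (*-distrib-^ m 4 2))) ⟩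
    (7 ^ q) ^ m * 8 ^ m                ≡⟨ *-distrib-^ m (7 ^ q) 8 ⟨
    (7 ^ q * 8) ^ m                    ≤⟨ ^-monoˡ-≤ m seven ⟩
    (8 ^ q) ^ m                        ≡⟨ cong (_^ m) (trans (*-distrib-^ q 4 2) (cong (_* 2 ^ q) (*-distrib-^ q 2 2))) ⟩
    (2 ^ q * 2 ^ q * 2 ^ q) ^ m        ≡⟨ trans (*-distrib-^ m (2 ^ q * 2 ^ q) (2 ^ q)) (cong (_* (2 ^ q) ^ m) (*-distrib-^ m (2 ^ q) (2 ^ q))) ⟩
    (2 ^ q) ^ m * (2 ^ q) ^ m * (2 ^ q) ^ m    ≡⟨ cong (λ z → z * z * z) (^-*-assoc 2 q m) ⟩
    T^q * T^q * T^q                    ∎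
  chain : T^q * T^q * T^q * (m ^ (8 * q) * 2 ^ (8 * q)) ≤ T^q * T^q * T^q * (16 ^ q * M ^ q * (2 ^ q * 2 ^ q))
  chain = begin
    T^q * T^q * T^q * (m ^ (8 * q) * 2 ^ (8 * q))
      ≡⟨ move₁ T^q (m ^ (8 * q)) (2 ^ (8 * q)) ⟩
    T^q * m ^ (8 * q) * 2 ^ (8 * q) * (T^q * T^q)
      ≤⟨ *-mono-≤ lower (*-mono-≤ scale scale) ⟩
    L ^ q * 2 ^ (1 * m) * (D^q * 2 ^ q * T * (D^q * 2 ^ q * T))
      ≡⟨ cong (λ z → L ^ q * 2 ^ z * (D^q * 2 ^ q * T * (D^q * 2 ^ q * T))) (*-identityˡ m) ⟩
    L ^ q * T * (D^q * 2 ^ q * T * (D^q * 2 ^ q * T))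
      ≡⟨ move₂ (L ^ q) T D^q (2 ^ q) ⟩
    L ^ q * D^q * D^q * (T * T * T * (2 ^ q * 2 ^ q))
      ≤⟨ *-monoˡ-≤ (T * T * T * (2 ^ q * 2 ^ q)) upper^q ⟩
    16 ^ q * M ^ q * (7 ^ m) ^ q * (T * T * T * (2 ^ q * 2 ^ q))
      ≡⟨ move₃ (16 ^ q) (M ^ q) ((7 ^ m) ^ q) (T * T * T) (2 ^ q * 2 ^ q) ⟩
    (7 ^ m) ^ q * (T * T * T) * (16 ^ q * M ^ q * (2 ^ q * 2 ^ q))
      ≤⟨ *-monoˡ-≤ (16 ^ q * M ^ q * (2 ^ q * 2 ^ q)) seven^m ⟩
    T^q * T^q * T^q * (16 ^ q * M ^ q * (2 ^ q * 2 ^ q)) ∎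
    where
    move₁ : ∀ t a b → t * t * t * (a * b) ≡ t * a * b * (t * t)
    move₁ = solve-∀
    move₂ : ∀ l t d z → l * t * (d * z * t * (d * z * t)) ≡ l * d * d * (t * t * t * (z * z))
    move₂ = solve-∀
    move₃ : ∀ a b c d e → a * b * c * (d * e) ≡ c * d * (a * b * e)
    move₃ = solve-∀
  M≤m^8 : M ≤ m ^ 8
  M≤m^8 = ≤-trans (≤-reflexive (cong (m *_) (sym (*-identityʳ m)))) (^-monoʳ-≤ m {{>-nonZero 1≤m}} {2} {8} (s≤s (s≤s z≤n)))
  -- The slack `κ = 8` of liveness is spent here: the formula bound leaves `m^2` and the constant
  -- `16 * 2 * 2 = 64`, against `m^8` and `2^8 = 256`.
  gap : 16 ^ q * M ^ q * (2 ^ q * 2 ^ q) < m ^ (8 * q) * 2 ^ (8 * q)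
  gap = begin-strict
    16 ^ q * M ^ q * (2 ^ q * 2 ^ q)       ≡⟨ move (16 ^ q) (M ^ q) (2 ^ q) ⟩
    M ^ q * (16 ^ q * 2 ^ q * 2 ^ q)       ≡⟨ cong (M ^ q *_) (trans (*-distrib-^ q 32 2) (cong (_* 2 ^ q) (*-distrib-^ q 16 2))) ⟨
    M ^ q * 64 ^ q                         ≤⟨ *-monoˡ-≤ (64 ^ q) (^-monoˡ-≤ q M≤m^8) ⟩
    (m ^ 8) ^ q * 64 ^ q                   <⟨ *-monoʳ-< ((m ^ 8) ^ q) {{m^n≢0 (m ^ 8) q {{m^n≢0 m 8 {{>-nonZero 1≤m}}}}}}
                                                (^-monoˡ-< q {{>-nonZero 1≤q}} (toWitness {a? = 64 <? 256} _)) ⟩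
    (m ^ 8) ^ q * (2 ^ 8) ^ q              ≡⟨ cong₂ _*_ (^-*-assoc m 8 q) (^-*-assoc 2 8 q) ⟩
    m ^ (8 * q) * 2 ^ (8 * q)              ∎
    where
    move : ∀ a b z → a * b * (z * z) ≡ b * (a * z * z)
    move = solve-∀

-- The quantity `(2E)^m` with `E = b * suc s` exceeds `P` by at most a factor 2, and this is
-- absorbed by the `+1` in the exponent of the density condition. What remains is
-- `c ≥ 2^((1 - 1/q) m) ≥ 2^e`.
thick-count≥ : ∀ q m e b s P k c → 1 ≤ q → 1 ≤ m → 1 ≤ b → m + m ≤ s →
  q * e + m ≤ q * m → (b * (s + s)) ^ m ≤ P → k ≤ (b * suc s) ^ m * c →
  2 ^ q * P ^ q ≤ k ^ q * 2 ^ (1 * m) → 2 ^ e ≤ c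
thick-count≥ q m e b s P k c 1≤q 1≤m 1≤b 2m≤s e-small P≥ k≤ dense with 2 ^ e ≤? c
... | yes p = p
... | no ¬p = ⊥-elim (<⇒≱ gap (*-cancelˡ-≤ (2 ^ q * P ^ q) {{>-nonZero (*-mono-≤ (m^n>0 2 q) 1≤P^q)}} chain))
  where
  T = 2 ^ m
  1≤s : 1 ≤ s
  1≤s = ≤-trans 1≤m (≤-trans (m≤m+n m m) 2m≤s)
  1≤P : 1 ≤ P
  1≤P = ≤-trans (m^n>0 (b * (s + s)) {{>-nonZero (*-mono-≤ 1≤b (≤-trans 1≤s (m≤m+n s s)))}} m) P≥
  1≤P^q : 1 ≤ P ^ q
  1≤P^q = m^n>0 P {{>-nonZero 1≤P}} q
  E^m : (b * suc s) ^ m * T ≤ 2 * P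
  E^m = begin
    (b * suc s) ^ m * T          ≡⟨ cong (_* T) (*-distrib-^ m b (suc s)) ⟩
    b ^ m * suc s ^ m * T        ≤⟨ *-monoˡ-≤ T (*-monoʳ-≤ (b ^ m) (1+s-power≤2 m s 1≤m 2m≤s)) ⟩
    b ^ m * (2 * s ^ m) * T      ≡⟨ move (b ^ m) (s ^ m) T ⟩
    2 * (b ^ m * (s ^ m * T))    ≡⟨ cong (2 *_) (trans (cong (b ^ m *_) (sym (*-distrib-^ m s 2))) (sym (*-distrib-^ m b (s * 2)))) ⟩
    2 * (b * (s * 2)) ^ m        ≡⟨ cong (λ z → 2 * (b * z) ^ m) (double s) ⟩
    2 * (b * (s + s)) ^ m        ≤⟨ *-monoʳ-≤ 2 P≥ ⟩
    2 * P                        ∎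
    where
    move : ∀ b s t → b * (2 * s) * t ≡ 2 * (b * (s * t))
    move = solve-∀
    double : ∀ s → s * 2 ≡ s + s
    double = solve-∀
  chain : 2 ^ q * P ^ q * T ^ q ≤ 2 ^ q * P ^ q * (c ^ q * T)
  chain = begin
    2 ^ q * P ^ q * T ^ q                    ≤⟨ *-monoˡ-≤ (T ^ q) dense ⟩
    k ^ q * 2 ^ (1 * m) * T ^ q              ≡⟨ cong (λ z → k ^ q * 2 ^ z * T ^ q) (*-identityˡ m) ⟩
    k ^ q * T * T ^ q                        ≡⟨ move₁ (k ^ q) T (T ^ q) ⟩
    k ^ q * T ^ q * T                        ≡⟨ cong (_* T) (*-distrib-^ q k T) ⟨
    (k * T) ^ q * T                          ≤⟨ *-monoˡ-≤ T (^-monoˡ-≤ q (≤-trans (*-monoˡ-≤ T k≤)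
                                                  (≤-trans (≤-reflexive (move₂ ((b * suc s) ^ m) c T)) (*-monoˡ-≤ c E^m)))) ⟩
    (2 * P * c) ^ q * T                      ≡⟨ cong (_* T) (trans (*-distrib-^ q (2 * P) c) (cong (_* c ^ q) (*-distrib-^ q 2 P))) ⟩
    2 ^ q * P ^ q * c ^ q * T                ≡⟨ *-assoc (2 ^ q * P ^ q) (c ^ q) T ⟩
    2 ^ q * P ^ q * (c ^ q * T)              ∎
    where
    move₁ : ∀ a b c → a * b * c ≡ a * c * b
    move₁ = solve-∀
    move₂ : ∀ a c t → a * c * t ≡ a * t * c
    move₂ = solve-∀
  gap : c ^ q * T < T ^ q
  gap = begin-strict
    c ^ q * T              <⟨ *-monoˡ-< T {{m^n≢0 2 m}} (^-monoˡ-< q {{>-nonZero 1≤q}} (≰⇒> ¬p)) ⟩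
    (2 ^ e) ^ q * T        ≡⟨ cong (_* T) (trans (^-*-assoc 2 e q) (cong (2 ^_) (*-comm e q))) ⟩
    2 ^ (q * e) * T        ≡⟨ ^-distribˡ-+-* 2 (q * e) m ⟨
    2 ^ (q * e + m)        ≤⟨ ^-monoʳ-≤ 2 e-small ⟩
    2 ^ (q * m)            ≡⟨ trans (cong (2 ^_) (*-comm q m)) (sym (^-*-assoc 2 m q)) ⟩
    T ^ q                  ∎

-- Preimages under balanced functions

preimage-∑ : ∀ (g : BFun n) (a : Vec Bool m) →
  preimageSize g a ≡ ∑ (allMats m n) (λ X → 𝟙 (does (≡-dec _≟B_ (applyRows g X) a)))
preimage-∑ {n} {m} g a = length-filter-𝟙 (λ X → ≡-dec _≟B_ (applyRows g X) a) (allMats m n)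

preimageSize≥ : ∀ (g : BFun n) h → (∀ c → h ≤ cnt c g) → ∀ (a : Vec Bool m) → h ^ m ≤ preimageSize g a
preimageSize≥ {n} {m} g h h≤ a = ≤-trans (rows a) (≤-reflexive (sym (preimage-∑ g a)))
  where
  factor≤ : ∀ {m} x c (v a : Vec Bool m) →
    𝟙 (does (x ≟B c)) * 𝟙 (does (≡-dec _≟B_ v a)) ≤ 𝟙 (does (≡-dec _≟B_ (x ∷ v) (c ∷ a)))
  factor≤ x c v a with x ≟B c | ≡-dec _≟B_ v a
  ... | yes refl | yes refl = ≤-refl
  ... | yes _    | no _     = z≤n
  ... | no _     | _        = z≤n
  rows : ∀ {m} (a : Vec Bool m) → h ^ m ≤ ∑ (allMats m n) (λ X → 𝟙 (does (≡-dec _≟B_ (applyRows g X) a)))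
  rows [] = ≤-refl
  rows {suc m} (c ∷ a) = begin
    h * h ^ m                         ≤⟨ *-mono-≤ (h≤ c) (rows a) ⟩
    cnt c g * rest                    ≡⟨ ∑-*ʳ (allVecs n) rest _ ⟨
    ∑ (allVecs n) (λ x → 𝟙 (does (evalF g x ≟B c)) * rest)
      ≡⟨ ∑-cong (allVecs n) (λ x → sym (∑-*ˡ (allMats m n) (𝟙 (does (evalF g x ≟B c))) _)) ⟩
    ∑ (allVecs n) (λ x → ∑ (allMats m n) (λ X → 𝟙 (does (evalF g x ≟B c)) * 𝟙 (does (≡-dec _≟B_ (applyRows g X) a))))
      ≤⟨ ∑-mono (allVecs n) (λ x → ∑-mono (allMats m n) (λ X → factor≤ (evalF g x) c (applyRows g X) a)) ⟩
    ∑ (allVecs n) (λ x → ∑ (allMats m n) (λ X → 𝟙 (does (≡-dec _≟B_ (applyRows g (x ∷ X)) (c ∷ a)))))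
      ≡⟨ ∑-vecs (allVecs n) m (λ X → 𝟙 (does (≡-dec _≟B_ (applyRows g X) (c ∷ a)))) ⟨
    ∑ (allMats (suc m) n) (λ X → 𝟙 (does (≡-dec _≟B_ (applyRows g X) (c ∷ a)))) ∎
    where rest = ∑ (allMats m n) (λ X → 𝟙 (does (≡-dec _≟B_ (applyRows g X) a)))

cnt-balanced : ∀ (g : BFun (suc n)) → Balanced g → ∀ c → cnt c g ≡ 2 ^ n
cnt-balanced {n} g bal c = *-cancelˡ-≡ _ _ 2 (trans (two (cnt c g)) (trans (both-halves c) (cnt-true+false g)))
  where
  ones≡zeros : cnt true g ≡ cnt false g
  ones≡zeros = trans (sym (ones≡cnt g)) (trans bal (zeros≡cnt g))
  two : ∀ a → 2 * a ≡ a + a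
  two = solve-∀
  both-halves : ∀ c → cnt c g + cnt c g ≡ cnt true g + cnt false g
  both-halves true  = cong (cnt true g +_) ones≡zeros
  both-halves false = cong (_+ cnt false g) (sym ones≡zeros)

-- The weak intersection

open Side

-- Conditions (ii) and (iii) of liveness for a single function, with `γ = 1/q`.
DenselyAlive : ∀ {m n} → (Vec Bool m → Bool) → Protocol m n → List Bool → ℕ → BFun n → Set
DenselyAlive {m} f Π π q g =
  LSatisfies (Aπ f Π π g) (Bπ f Π π g)
    (λ L → 2 ^ (q * m) * m ^ (8 * q) * 2 ^ (8 * q) ≤ L ^ q * 2 ^ (1 * m)) ×
  (∀ a → Aπ f Π π g a → Σ ℕ λ k → AtLeast (Xπga f Π π g a) k ×
      2 ^ q * preimageSize g a ^ q ≤ k ^ q * 2 ^ (1 * m)) ×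
  (∀ b → Bπ f Π π g b → Σ ℕ λ k → AtLeast (Yπgb f Π π g b) k ×
      2 ^ q * preimageSize g b ^ q ≤ k ^ q * 2 ^ (1 * m))

-- Writing the depth as `length π + d` lets the types record that `d` rounds remain after `π`.
module Argument {m n d : ℕ} (f : Vec Bool m → Bool) (π : List Bool)
                (tA tB : Tree (Input m n) (Out m n) (length π + d)) where

  Π : Protocol m n
  Π = record { depth = length π + d ; ΠA = tA ; ΠB = tB }

  open Colouring m n

  startA startB : Player (length π + d)
  startA = side (λ _ → tA) (λ (g , X) → does (f (applyRows g X) ≟B true))
  startB = side (λ _ → tB) (λ (g , Y) → does (f (applyRows g Y) ≟B false))

  SA SB : Player d
  SA = advance π startA
  SB = advance π startB

  SA⇒Xπ : ∀ {x} → live SA x ≡ true → Xπ f Π π x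
  SA⇒Xπ {g , X} l with live-advance π startA l
  ... | l′ , c = true-does (f (applyRows g X) ≟B true) l′ , c

  SB⇒Yπ : ∀ {y} → live SB y ≡ true → Yπ f Π π y
  SB⇒Yπ {g , Y} l with live-advance π startB l
  ... | l′ , c = true-does (f (applyRows g Y) ≟B false) l′ , c

  Xπ⇒SA : ∀ {x} → Xπ f Π π x → live SA x ≡ true
  Xπ⇒SA {g , X} (inA , c) = advance-live π startA (dec-true (f (applyRows g X) ≟B true) inA) c

  Yπ⇒SB : ∀ {y} → Yπ f Π π y → live SB y ≡ true
  Yπ⇒SB {g , Y} (inB , c) = advance-live π startB (dec-true (f (applyRows g Y) ≟B false) inB) c

  correct : PartiallyHalfDuplex f Π → Solves f Π → Correct SA SB
  correct phd solves = advance-correct π startA startB (λ { (g , X) (h , Y) lX lY rs oa ob run →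
    let inA = true-does (f (applyRows g X) ≟B true) lX
        inB = true-does (f (applyRows h Y) ≟B false) lY
    in solves (g , X) (h , Y) inA inB rs oa ob run ,
       λ g≡h → phd (g , X) (h , Y) inA inB g≡h rs oa ob run })

  WA WB : BFun n → Vec Bool m → Mat m n → Bool
  WA g a X = live SA (g , X) ∧ does (≡-dec _≟B_ (applyRows g X) a)
  WB g b Y = live SB (g , Y) ∧ does (≡-dec _≟B_ (applyRows g Y) b)

  WA⁺ : ∀ {g a X} → Xπga f Π π g a X → WA g a X ≡ true
  WA⁺ {g} {a} {X} (x , eq) = ∧-intro (Xπ⇒SA x) (dec-true (≡-dec _≟B_ (applyRows g X) a) eq)

  WB⁺ : ∀ {g b Y} → Yπgb f Π π g b Y → WB g b Y ≡ true
  WB⁺ {g} {b} {Y} (y , eq) = ∧-intro (Yπ⇒SB y) (dec-true (≡-dec _≟B_ (applyRows g Y) b) eq)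

  WA⁻ : ∀ {g a} X → WA g a X ≡ true → live SA (g , X) ≡ true × applyRows g X ≡ a
  WA⁻ {g} {a} X w = map₂ (true-does (≡-dec _≟B_ (applyRows g X) a)) (∧-true {live SA (g , X)} w)

  WB⁻ : ∀ {g b} Y → WB g b Y ≡ true → live SB (g , Y) ≡ true × applyRows g Y ≡ b
  WB⁻ {g} {b} Y w = map₂ (true-does (≡-dec _≟B_ (applyRows g Y) b)) (∧-true {live SB (g , Y)} w)

  WA⇒Aπ : ∀ {g a X} → WA g a X ≡ true → Aπ f Π π g a
  WA⇒Aπ {g} {a} {X} w with WA⁻ {g} {a} X w
  ... | l , refl = proj₁ (SA⇒Xπ l) , X , SA⇒Xπ l , refl

  WB⇒Bπ : ∀ {g b Y} → WB g b Y ≡ true → Bπ f Π π g b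
  WB⇒Bπ {g} {b} {Y} w with WB⁻ {g} {b} Y w
  ... | l , refl = proj₁ (SB⇒Yπ l) , Y , SB⇒Yπ l , refl

  _≟M_ : ∀ (X Y : Mat m n) → Dec (X ≡ Y)
  _≟M_ = ≡-dec (≡-dec _≟B_)

  AtLeast⇒≤ : ∀ {P : Mat m n → Set} {k} (W : Mat m n → Bool) → (∀ {X} → P X → W X ≡ true) →
              AtLeast P k → k ≤ ∑ (allMats m n) (𝟙 ∘ W)
  AtLeast⇒≤ W P⇒W (Xs , u , ps , k≤) =
    ≤-trans k≤ (Unique-length≤ _≟M_ W ∈-allMats u (All.map P⇒W ps))

  -- Each value class of a balanced function has `2bs` points, and `E = b * (s + 1)` is slightly
  -- more than half of it. The excess tolerates an agreement of up to `2b` points, as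
  -- `2bs + 2b = 2E`, while `s ≥ 2m` keeps the loss over `m` rows within a factor 2.
  module WithScale (b s : ℕ) (1≤m : 1 ≤ m) (1≤b : 1 ≤ b) (2m≤s : m + m ≤ s) where

    open Thickness n (b * suc s)

    Half : BFun n → Set
    Half g = ∀ c → cnt c g ≡ b * (s + s)

    half≤ : ∀ c → c ≡ b * (s + s) → c ≤ b * suc s + b * suc s
    half≤ c refl = ≤-trans (m≤m+n _ (b + b)) (≤-reflexive (expand b s))
      where
      expand : ∀ b s → b * (s + s) + (b + b) ≡ b * suc s + b * suc s
      expand = solve-∀

    Triple : Set
    Triple = Vec Bool m × Vec Bool m × Vec Bool m

    matches : BFun n → Triple → Bool
    matches g (a , b , J) = agreeOn J a b ∧ (thick (WA g a) J ∧ thick (WB g b) J)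

    triples : List Triple
    triples = cartesianProduct (allVecs m) (cartesianProduct (allVecs m) (allVecs m))

    ∈-triples : ∀ t → t ∈ triples
    ∈-triples (a , b , J) = ∈-cartesianProduct⁺ (∈-allVecs a) (∈-cartesianProduct⁺ (∈-allVecs b) (∈-allVecs J))

    many-thick : ∀ q e g a W k → 1 ≤ q → q * e + m ≤ q * m → Half g → RowsEvalTo W g a →
      k ≤ ∑ (allMats m n) (𝟙 ∘ W) → 2 ^ q * preimageSize g a ^ q ≤ k ^ q * 2 ^ (1 * m) →
      2 ^ e ≤ ∑ (allVecs m) (𝟙 ∘ thick W)
    many-thick q e g a W k 1≤q e-small half ev k≤ dense =
      thick-count≥ q m e b s (preimageSize g a) k _ 1≤q 1≤m 1≤b 2m≤s e-small
        (preimageSize≥ g (b * (s + s)) (λ c → ≤-reflexive (sym (half c))) a)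
        (≤-trans k≤ (size≤thick W g a ev (λ c → half≤ _ (half c)))) dense

    -- Without a matching triple, `separation` yields a formula smaller than liveness allows.
    -- Existence is decided by counting over the finite list of triples, so the contradiction
    -- produces an actual witness.
    ∃-matching : ∀ q e g → 1 ≤ q → 7 ^ q * 8 ≤ 8 ^ q → q * e + m ≤ q * m → q * m ≤ q * e + q + m →
                 Half g → Vπ f Π π g → DenselyAlive f Π π q g → ∃ λ t → matches g t ≡ true
    ∃-matching q e g 1≤q seven e-small e-large half ((a₀ , A₀) , (b₀ , B₀)) (L-large , denseA , denseB)
      with 1 ≤? ∑ triples (𝟙 ∘ matches g)
    ... | yes p = ∑-𝟙⇒∃ triples (matches g) p
    ... | no ¬p = ⊥-elim (complexity-contradiction q m e (leaves φ) 1≤q 1≤m seven e-large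
                    (proj₂ (proj₂ formula)) (proj₁ L-large ((a₀ , A₀) , (b₀ , B₀)) φ separates))
      where
      open module SplitA = Split (λ a → some (WA g a)) using () renaming (part to partA; part-∈ to partA-∈)
      open module SplitB = Split (λ b → some (WB g b)) using () renaming (part to partB; part-∈ to partB-∈)
      As Bs : List (Vec Bool m)
      As = partA true (allVecs m)
      Bs = partB true (allVecs m)
      ∈-As : ∀ {a} → Aπ f Π π g a → a ∈ As
      ∈-As {a} (_ , X , x) = ∈-filter⁺ (λ a → some (WA g a) ≟B true) (∈-allVecs a) (some⁺ (WA g a) (WA⁺ x))
      ∈-Bs : ∀ {b} → Bπ f Π π g b → b ∈ Bs
      ∈-Bs {b} (_ , Y , y) = ∈-filter⁺ (λ b → some (WB g b) ≟B true) (∈-allVecs b) (some⁺ (WB g b) (WB⁺ y))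
      thick-As : ∀ {a} → a ∈ As → 2 ^ e ≤ ∑ (allVecs m) (𝟙 ∘ thick (WA g a))
      thick-As {a} i with some⁻ (WA g a) (proj₂ (partA-∈ true {xs = allVecs m} i))
      ... | X , w with denseA a (WA⇒Aπ {X = X} w)
      ... | k , many , dense = many-thick q e g a (WA g a) k 1≤q e-small half (λ Z z → proj₂ (WA⁻ Z z))
        (AtLeast⇒≤ (WA g a) WA⁺ many) dense
      thick-Bs : ∀ {b} → b ∈ Bs → 2 ^ e ≤ ∑ (allVecs m) (𝟙 ∘ thick (WB g b))
      thick-Bs {b} i with some⁻ (WB g b) (proj₂ (partB-∈ true {xs = allVecs m} i))
      ... | Y , w with denseB b (WB⇒Bπ {Y = Y} w)
      ... | k , many , dense = many-thick q e g b (WB g b) k 1≤q e-small half (λ Z z → proj₂ (WB⁻ Z z))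
        (AtLeast⇒≤ (WB g b) WB⁺ many) dense
      a-index : ∀ {m} → 1 ≤ m → Fin m
      a-index {suc m} _ = zero
      formula : ∃ λ φ → SepLists φ As Bs × 2 ^ e * (leaves φ * 2 ^ e) ≤ 4 * suc m * 7 ^ m * suc m
      formula = separation (a-index 1≤m) (λ a → thick (WA g a)) (λ b → thick (WB g b))
        (λ a → thick-∨ (WA g a)) (λ b → thick-∨ (WB g b)) (2 ^ e) As Bs (m^n>0 2 e)
        (≤-trans (length-filter (λ a → some (WA g a) ≟B true) (allVecs m)) (≤-reflexive (length-allVecs m)))
        (≤-trans (length-filter (λ b → some (WB g b) ≟B true) (allVecs m)) (≤-reflexive (length-allVecs m)))
        (nonempty-∈ (∈-As A₀)) (nonempty-∈ (∈-Bs B₀)) thick-As thick-Bs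
        (λ a b J thA thB agr → ¬p (∃⇒∑-𝟙 (matches g) (∈-triples (a , b , J)) (∧-intro agr (∧-intro thA thB))))
      φ = proj₁ formula
      separates : Separates φ (Aπ f Π π g) (Bπ f Π π g)
      separates = (λ a Aa → proj₁ (proj₁ (proj₂ formula)) (∈-As Aa)) ,
                  (λ b Bb → proj₂ (proj₁ (proj₂ formula)) (∈-Bs Bb))

    Key : Set
    Key = Vec Bool (bits d) × Triple

    keys : List Key
    keys = cartesianProduct (allVecs (bits d)) triples

    length-keys : length keys ≡ 2 ^ (bits d + (m + (m + m)))
    length-keys = begin-equality
      length keys                              ≡⟨ trans (length-× (allVecs (bits d)) triples)
                                                    (cong (length (allVecs (bits d)) *_) (trans (length-× (allVecs m) _)
                                                      (cong (length (allVecs m) *_) (length-× (allVecs m) (allVecs m))))) ⟩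
      length (allVecs (bits d)) * (length (allVecs m) * (length (allVecs m) * length (allVecs m)))
        ≡⟨ cong₂ (λ c z → c * (z * (z * z))) (length-allVecs (bits d)) (length-allVecs m) ⟩
      2 ^ bits d * (2 ^ m * (2 ^ m * 2 ^ m))
        ≡⟨ trans (^-distribˡ-+-* 2 (bits d) (m + (m + m))) (cong (2 ^ bits d *_)
             (trans (^-distribˡ-+-* 2 m (m + m)) (cong (2 ^ m *_) (^-distribˡ-+-* 2 m m)))) ⟨
      2 ^ (bits d + (m + (m + m)))             ∎

    hasKey : BFun n → Key → Bool
    hasKey g (κ , t) = does (≡-dec _≟B_ (colour SA SB g) κ) ∧ matches g t

    ∃-hasKey : ∀ g → (∃ λ t → matches g t ≡ true) → ∃ λ key → key ∈ keys × hasKey g key ≡ true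
    ∃-hasKey g (t , mt) = (colour SA SB g , t) , ∈-cartesianProduct⁺ (∈-allVecs (colour SA SB g)) (∈-triples t) ,
      ∧-intro (dec-true (≡-dec _≟B_ (colour SA SB g) (colour SA SB g)) refl) mt

    keys-nonempty : 1 ≤ length keys
    keys-nonempty = ≤-trans (m^n>0 2 (bits d + (m + (m + m)))) (≤-reflexive (sym length-keys))

    -- A weak intersection at the end of π would leave only the output ⊥, which a shared
    -- colour excludes.
    same-key⇒agree : Correct SA SB → ∀ key gA gB → Half gA → hasKey gA key ≡ true → hasKey gB key ≡ true →
                     b + b ≤ agree gA gB
    same-key⇒agree ok (κ , a , c , J) gA gB half keyA keyB with b + b ≤? agree gA gB
    ... | yes p = p
    ... | no ¬p = ⊥-elim contradictory
      where
      few : ∀ e → cnt e gA + agree gA gB ≤ b * suc s + b * suc s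
      few e = begin
        cnt e gA + agree gA gB       ≤⟨ +-mono-≤ (≤-reflexive (half e)) (<⇒≤ (≰⇒> ¬p)) ⟩
        b * (s + s) + (b + b)        ≡⟨ expand b s ⟩
        b * suc s + b * suc s        ∎
        where
        expand : ∀ b s → b * (s + s) + (b + b) ≡ b * suc s + b * suc s
        expand = solve-∀
      unpack : ∀ g → hasKey g (κ , a , c , J) ≡ true →
        colour SA SB g ≡ κ × agreeOn J a c ≡ true × thick (WA g a) J ≡ true × thick (WB g c) J ≡ true
      unpack g key with ∧-true {does (≡-dec _≟B_ (colour SA SB g) κ)} key
      ... | col , rest with ∧-true {agreeOn J a c} rest
      ... | agr , th = true-does (≡-dec _≟B_ (colour SA SB g) κ) col , agr , ∧-true th
      both-alive : ∀ g → thick (WA g a) J ≡ true → thick (WB g c) J ≡ true → alive SA SB g ≡ true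
      both-alive g thA thB with thick⇒∃ (WA g a) J thA | thick⇒∃ (WB g c) J thB
      ... | X , wX | Y , wY = alive⁺ SA SB g (proj₁ (WA⁻ {a = a} X wX)) (proj₁ (WB⁻ {b = c} Y wY))
      contradictory : ⊥
      contradictory with unpack gA keyA | unpack gB keyB
      ... | colA , agr , thAA , thAB | colB , _ , thBA , thBB
        with weak-intersection (WA gA a) (WB gB c) gA gB a c J
               (λ Z z → proj₂ (WA⁻ Z z)) (λ Z z → proj₂ (WB⁻ Z z)) few agr thAA thBB
      ... | X , Y , wX , wY , same with WA⁻ {gA} {a} X wX | WB⁻ {gB} {c} Y wY
      ... | lX , refl | lY , refl
        with same-colour⇒solved SA SB ok gA gB X Y lX lY (both-alive gA thAA thAB) (both-alive gB thBA thBB)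
               (trans colA (sym colB))
      ... | (i , j) , a≢c , X≢Y = X≢Y (cong (λ v → lookup v j) (same i a≢c))

    -- The most useful key is fixed by pigeonhole. `S` collects all balanced functions with that
    -- key, since any two of them are forced to agree on `2b` points.
    large-family : Correct SA SB → ∀ 𝒱 → Unique 𝒱 → All Balanced 𝒱 → All (λ g → ∃ λ t → matches g t ≡ true) 𝒱 →
      (∀ g → Balanced g → Half g) →
      Σ (BFun n → Bool) λ S → (∀ g h → S g ≡ true → S h ≡ true → b + b ≤ agree g h) ×
        length 𝒱 ≤ ∑ (allBFun n) (𝟙 ∘ S) * 2 ^ (bits d + (m + (m + m)))
    large-family ok 𝒱 u bal hit halves
      with pigeonhole 𝒱 keys hasKey keys-nonempty (All.map (λ {g} → ∃-hasKey g) hit)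
    ... | key , le = S , agreeing , (begin
      length 𝒱                                            ≤⟨ le ⟩
      ∑ 𝒱 (λ g → 𝟙 (hasKey g key)) * length keys          ≡⟨ cong₂ _*_ (sym (length-true 𝒱)) length-keys ⟩
      length (part true 𝒱) * 2 ^ (bits d + (m + (m + m)))
        ≤⟨ *-monoˡ-≤ (2 ^ (bits d + (m + (m + m)))) (Unique-length≤ _≟F_ S ∈-allBFun
             (filter⁺ (λ g → hasKey g key ≟B true) u) (All.tabulate in-S)) ⟩
      ∑ (allBFun n) (𝟙 ∘ S) * 2 ^ (bits d + (m + (m + m)))    ∎)
      where
      open Split (λ g → hasKey g key)
      S : BFun n → Bool
      S g = does (ones g ≟ zeros g) ∧ hasKey g key
      in-S : ∀ {g} → g ∈ part true 𝒱 → S g ≡ true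
      in-S {g} i with part-∈ true {xs = 𝒱} i
      ... | i′ , k = ∧-intro (dec-true (ones g ≟ zeros g) (All.lookup bal i′)) k
      agreeing : ∀ g h → S g ≡ true → S h ≡ true → b + b ≤ agree g h
      agreeing g h Sg Sh with ∧-true {does (ones g ≟ zeros g)} Sg | ∧-true {does (ones h ≟ zeros h)} Sh
      ... | bal-g , kg | _ , kh =
        same-key⇒agree ok key g h (halves g (true-does (ones g ≟ zeros g) bal-g)) kg kh

bits≤ : ∀ {m n} d → Colouring.bits m n d + 3 ≡ 3 * 2 ^ d
bits≤ zero = refl
bits≤ {m} {n} (suc d) = trans (regroup (Colouring.bits m n d)) (trans (cong₂ _+_ (bits≤ {m} {n} d) (bits≤ {m} {n} d)) (double (2 ^ d)))
  where
  regroup : ∀ c → 3 + (c + c) + 3 ≡ (c + 3) + (c + 3)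
  regroup = solve-∀
  double : ∀ a → 3 * a + 3 * a ≡ 3 * (2 * a)
  double = solve-∀

𝒱-nonempty : ∀ {m n} (𝒱 : List (BFun n)) → 1 ≤ n → numBalanced n ≤ length 𝒱 * 2 ^ m → 1 ≤ length 𝒱
𝒱-nonempty (_ ∷ _) _ _ = s≤s z≤n
𝒱-nonempty {n = n} [] 1≤n le = ⊥-elim (1+n≰n {0} (begin
  1                          ≤⟨ m^n>0 2 (2 ^ n) ⟩
  2 ^ (2 ^ n)                ≤⟨ numBalanced≥ n 1≤n ⟩
  numBalanced n * 2 ^ n      ≤⟨ *-monoˡ-≤ (2 ^ n) le ⟩
  0                          ∎))

positive-factor : ∀ a {k} → 1 ≤ a * k → 1 ≤ a
positive-factor (suc a) _ = s≤s z≤n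

-- `Q` adds up the logarithmic losses: colour, triple `(a , b , J)`, density `2^(-m)` of the live
-- functions, and density `2^(-n)` of the balanced ones. The family thus has at least `2^(N-Q)`
-- members, too many for the isoperimetric bound when `2Q < 2^(y+1)`.
scale-contradiction : ∀ q e m r′ y d (f : Vec Bool m → Bool) π
  (tA tB : Tree (Input m (suc r′ + suc r′ + 1 + suc y)) (Out m (suc r′ + suc r′ + 1 + suc y)) (length π + d)) →
  let n = suc r′ + suc r′ + 1 + suc y
      Π = record { depth = length π + d ; ΠA = tA ; ΠB = tB }
      Q = Colouring.bits m n d + (m + (m + m)) + m + n in
  1 ≤ q → 7 ^ q * 8 ≤ 8 ^ q → q * e + m ≤ q * m → q * m ≤ q * e + q + m →
  1 ≤ m → m + m ≤ 2 ^ r′ → Q + Q < 2 ^ suc y →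
  PartiallyHalfDuplex f Π → Solves f Π → Alive f Π 1 q π → ⊥
scale-contradiction q e m r′ y d f π tA tB 1≤q seven e-small e-large 1≤m 2m≤s Q-small phd solves (𝒱 , u , alive𝒱 , 𝒱-large , dense) =
  <⇒≱ (^-monoʳ-< 2 (s≤s (s≤s z≤n)) Q-small)
    (*-cancelˡ-≤ (σ * σ) {{>-nonZero 1≤σσ}} (begin
      σ * σ * 2 ^ (2 ^ suc y)             ≤⟨ agreeing-family-density (suc r′) y S (s≤s z≤n)
                                               (λ g h Sg Sh → ≤-trans (≤-reflexive (sym threshold)) (agreeing g h Sg Sh)) ⟩
      4 ^ N                               ≡⟨ *-distrib-^ N 2 2 ⟩
      2 ^ N * 2 ^ N                       ≤⟨ *-mono-≤ σ-large σ-large ⟩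
      σ * 2 ^ Q * (σ * 2 ^ Q)             ≡⟨ regroup σ (2 ^ Q) ⟩
      σ * σ * (2 ^ Q * 2 ^ Q)             ≡⟨ cong (σ * σ *_) (^-distribˡ-+-* 2 Q Q) ⟨
      σ * σ * 2 ^ (Q + Q)                 ∎))
  where
  p = r′ + suc r′ + 1 + suc y
  N = 2 ^ suc p
  b = 2 ^ (suc r′ + suc y)
  s = 2 ^ r′
  Q = Colouring.bits m (suc p) d + (m + (m + m)) + m + suc p
  open Argument {m} {suc p} {d} f π tA tB
  open WithScale b s 1≤m (m^n>0 2 (suc r′ + suc y)) 2m≤s
  2^p : 2 ^ p ≡ b * (s + s)
  2^p = begin-equality
    2 ^ p                              ≡⟨ cong (2 ^_) (rearrange r′ y) ⟩
    2 ^ (suc r′ + suc y + suc r′)      ≡⟨ ^-distribˡ-+-* 2 (suc r′ + suc y) (suc r′) ⟩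
    b * 2 ^ suc r′                     ≡⟨ cong (λ z → b * (s + z)) (+-identityʳ s) ⟩
    b * (s + s)                        ∎
    where
    rearrange : ∀ r y → r + suc r + 1 + suc y ≡ suc r + suc y + suc r
    rearrange = solve-∀
  -- The tolerated agreement `2b` equals `N / v` with `v = 2^(r′+1)`, the threshold of the density
  -- bound.
  threshold : b + b ≡ 2 ^ suc r′ * 2 ^ suc (suc y)
  threshold = begin-equality
    b + b                              ≡⟨ cong (b +_) (+-identityʳ b) ⟨
    2 ^ suc (suc r′ + suc y)           ≡⟨ cong (2 ^_) (+-suc (suc r′) (suc y)) ⟨
    2 ^ (suc r′ + suc (suc y))         ≡⟨ ^-distribˡ-+-* 2 (suc r′) (suc (suc y)) ⟩
    2 ^ suc r′ * 2 ^ suc (suc y)       ∎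
  half : ∀ g → Balanced g → Half g
  half g bal c = trans (cnt-balanced g bal c) 2^p
  matched : All (λ g → ∃ λ t → matches g t ≡ true) 𝒱
  matched = All.zipWith (λ {g} ((bal , v) , live) →
    ∃-matching q e g 1≤q seven e-small e-large (half g bal) v live) (alive𝒱 , dense)
  family = large-family (correct phd solves) 𝒱 u (All.map proj₁ alive𝒱) matched half
  S = proj₁ family
  agreeing = proj₁ (proj₂ family)
  σ = ∑ (allBFun (suc p)) (𝟙 ∘ S)
  K = Colouring.bits m (suc p) d + (m + (m + m))
  σ-large : 2 ^ N ≤ σ * 2 ^ Q
  σ-large = begin
    2 ^ N                                     ≤⟨ numBalanced≥ (suc p) (s≤s z≤n) ⟩
    numBalanced (suc p) * 2 ^ suc p           ≤⟨ *-monoˡ-≤ (2 ^ suc p) 𝒱-large ⟩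
    length 𝒱 * 2 ^ m * 2 ^ suc p              ≤⟨ *-monoˡ-≤ (2 ^ suc p) (*-monoˡ-≤ (2 ^ m) (proj₂ (proj₂ family))) ⟩
    σ * 2 ^ K * 2 ^ m * 2 ^ suc p             ≡⟨ assoc₄ σ (2 ^ K) (2 ^ m) (2 ^ suc p) ⟩
    σ * (2 ^ K * 2 ^ m * 2 ^ suc p)           ≡⟨ cong (λ z → σ * (z * 2 ^ suc p)) (^-distribˡ-+-* 2 K m) ⟨
    σ * (2 ^ (K + m) * 2 ^ suc p)             ≡⟨ cong (σ *_) (^-distribˡ-+-* 2 (K + m) (suc p)) ⟨
    σ * 2 ^ Q                                 ∎
    where
    assoc₄ : ∀ a b c d → a * b * c * d ≡ a * (b * c * d)
    assoc₄ = solve-∀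
  1≤σ : 1 ≤ σ
  1≤σ = positive-factor σ (≤-trans (m^n>0 2 N) σ-large)
  1≤σσ : 1 ≤ σ * σ
  1≤σσ = *-mono-≤ 1≤σ 1≤σ
  regroup : ∀ a z → a * z * (a * z) ≡ a * a * (z * z)
  regroup = solve-∀

-- The depth bound

-- This fixes `γ = 1/16`: 16 is the least exponent `q` with `(8/7)^q ≥ 8`.
7^16*8≤8^16 : 7 ^ 16 * 8 ≤ 8 ^ 16
7^16*8≤8^16 = toWitness {a? = 7 ^ 16 * 8 ≤? 8 ^ 16} _

-- The exponent `e` is `(1 - γ) m` rounded down; the two inequalities bound the rounding error by 0
-- and 1.
16*[15m/16] : ∀ m → 16 * (15 * m / 16) + m ≤ 16 * m × 16 * m ≤ 16 * (15 * m / 16) + 16 + m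
16*[15m/16] m = lower , upper
  where
  e = 15 * m / 16
  ρ = 15 * m % 16
  15m≡ : 15 * m ≡ ρ + e * 16
  15m≡ = m≡m%n+[m/n]*n (15 * m) 16
  lower : 16 * e + m ≤ 16 * m
  lower = begin
    16 * e + m                  ≡⟨ cong (_+ m) (*-comm 16 e) ⟩
    e * 16 + m                  ≤⟨ +-monoˡ-≤ m (≤-trans (m≤n+m (e * 16) ρ) (≤-reflexive (sym 15m≡))) ⟩
    15 * m + m                  ≡⟨ +-comm (15 * m) m ⟩
    16 * m                      ∎
  upper : 16 * m ≤ 16 * e + 16 + m
  upper = begin
    16 * m                      ≡⟨ +-comm m (15 * m) ⟩
    15 * m + m                  ≡⟨ cong (_+ m) 15m≡ ⟩
    ρ + e * 16 + m              ≤⟨ +-monoˡ-≤ m (+-monoˡ-≤ (e * 16) (<⇒≤ (m%n<n (15 * m) 16))) ⟩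
    16 + e * 16 + m             ≡⟨ cong (_+ m) (trans (+-comm 16 (e * 16)) (cong (_+ 16) (*-comm e 16))) ⟩
    16 * e + 16 + m             ∎

no-small-depth : ∀ q e {m n d} l (f : Vec Bool m → Bool) π (tA tB : Tree (Input m n) (Out m n) (length π + d)) →
  let Π = record { depth = length π + d ; ΠA = tA ; ΠB = tB } in
  1 ≤ q → 7 ^ q * 8 ≤ 8 ^ q → q * e + m ≤ q * m → q * m ≤ q * e + q + m →
  1 ≤ m → m ≤ 2 ^ suc l → n ≤ 2 ^ suc l → d + 12 * suc l < n →
  PartiallyHalfDuplex f Π → Solves f Π → Alive f Π 1 q π → ⊥
no-small-depth q e {m} {n} {d} l f π tA tB 1≤q seven e-small e-large 1≤m m≤ n≤ shallow with m≤n⇒∃[o]m+o≡n shallow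
... | o , eq = go n (trans (rearrange l d o) eq) tA tB n≤
  where
  -- Chosen so that `2^r` is at least `2m`, as the scale `s` requires.
  r = suc (suc l)
  -- What remains of `n` after `2 * (r + 1) + 2` bits. It needs to be at least `d + l + 5`, since
  -- `2Q` is at most `2^(d+l+5)`; the constant 12 leaves room for this.
  y = d + 10 * l + 5 + o
  rearrange : ∀ l d o → suc (suc (suc l)) + suc (suc (suc l)) + 1 + suc (d + 10 * l + 5 + o) ≡ suc (d + 12 * suc l) + o
  rearrange = solve-∀
  2m≤2^r : m + m ≤ 2 ^ r
  2m≤2^r = ≤-trans (+-mono-≤ m≤ m≤) (≤-reflexive (cong (2 ^ suc l +_) (sym (+-identityʳ _))))
  D = 2 ^ d
  L = 2 ^ suc l
  Q<2^y : ∀ n → n ≤ L → let Q = Colouring.bits m n d + (m + (m + m)) + m + n in Q + Q < 2 ^ suc y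
  Q<2^y n n≤L = begin-strict
    Q + Q                            ≤⟨ +-mono-≤ Q≤ Q≤ ⟩
    8 * (D * L) + 8 * (D * L)        ≡⟨ sixteen D L ⟩
    16 * D * L                       ≡⟨ cong (_* L) (^-distribˡ-+-* 2 4 d) ⟨
    2 ^ (4 + d) * L                  ≡⟨ ^-distribˡ-+-* 2 (4 + d) (suc l) ⟨
    2 ^ (4 + d + suc l)              <⟨ ^-monoʳ-< 2 (s≤s (s≤s z≤n)) (s≤s exponents) ⟩
    2 ^ suc y                        ∎
    where
    Q = Colouring.bits m n d + (m + (m + m)) + m + n
    1≤D = m^n>0 2 d
    1≤L = m^n>0 2 (suc l)
    exponents : 4 + d + suc l ≤ y
    exponents = ≤-trans (m≤m+n _ (9 * l + o)) (≤-reflexive (collect d l o))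
      where
      collect : ∀ d l o → 4 + d + suc l + (9 * l + o) ≡ d + 10 * l + 5 + o
      collect = solve-∀
    sixteen : ∀ a b → 8 * (a * b) + 8 * (a * b) ≡ 16 * a * b
    sixteen = solve-∀
    Q≤ : Q ≤ 8 * (D * L)
    Q≤ = begin
      Q                                    ≤⟨ +-mono-≤ (+-mono-≤ (+-mono-≤ (≤-trans (m≤m+n _ 3) (≤-reflexive (bits≤ {m} {n} d)))
                                                (+-mono-≤ m≤ (+-mono-≤ m≤ m≤))) m≤) n≤L ⟩
      3 * D + (L + (L + L)) + L + L        ≡⟨ gather D L ⟩
      3 * (D * 1) + 5 * (1 * L)            ≤⟨ +-mono-≤ (*-monoʳ-≤ 3 (*-monoʳ-≤ D 1≤L)) (*-monoʳ-≤ 5 (*-monoˡ-≤ L 1≤D)) ⟩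
      3 * (D * L) + 5 * (D * L)            ≡⟨ *-distribʳ-+ (D * L) 3 5 ⟨
      8 * (D * L)                          ∎
      where
      gather : ∀ D L → 3 * D + (L + (L + L)) + L + L ≡ 3 * (D * 1) + 5 * (1 * L)
      gather = solve-∀
  -- The dimension is generalised so that its decomposition can be matched with `refl`.
  go : ∀ n → suc r + suc r + 1 + suc y ≡ n → (tA tB : Tree (Input m n) (Out m n) (length π + d)) → n ≤ L →
    let Π = record { depth = length π + d ; ΠA = tA ; ΠB = tB } in
    PartiallyHalfDuplex f Π → Solves f Π → Alive f Π 1 q π → ⊥
  go _ refl tA tB n≤ phd solves live =
    scale-contradiction q e m r y d f π tA tB 1≤q seven e-small e-large 1≤m 2m≤2^r (Q<2^y _ n≤) phd solves live

-- Makes the logarithm in the bound at least 1 when `n ≥ 1`. For `m = 0` the function `f` would take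
-- both values at one point; for `m = 1` a single literal separates, which is too small a formula
-- for liveness.
alive⇒2≤m : ∀ q {m n} (f : Vec Bool m → Bool) (Π : Protocol m n) π → 1 ≤ q → 1 ≤ n → Alive f Π 1 q π → 2 ≤ m
alive⇒2≤m q {suc (suc m)} f Π π 1≤q 1≤n _ = s≤s (s≤s z≤n)
alive⇒2≤m q {m} {n} f Π π 1≤q 1≤n ([] , _ , _ , large , _) = ⊥-elim (1+n≰n (𝒱-nonempty {m} {n} [] 1≤n large))
alive⇒2≤m q {zero} f Π π 1≤q 1≤n (g ∷ _ , _ , (_ , ([] , fa , _) , ([] , fb , _)) ∷ _ , _ , _)
  with () ← trans (sym fa) fb
alive⇒2≤m q {suc zero} f Π π 1≤q 1≤n
  (g ∷ _ , _ , (_ , (a ∷ [] , A) , (b ∷ [] , B)) ∷ _ , _ , (L-large , _) ∷ _) =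
  ⊥-elim (<⇒≱ one-leaf
    (proj₁ L-large ((a ∷ [] , A) , (b ∷ [] , B)) (lit zero a) (pos , negative)))
  where
  one-leaf : 1 ^ q * 2 ^ (1 * 1) < 2 ^ (q * 1) * 1 ^ (8 * q) * 2 ^ (8 * q)
  one-leaf = begin-strict
    1 ^ q * 2 ^ (1 * 1)                            ≡⟨ cong (_* 2) (^-zeroˡ q) ⟩
    2                                              <⟨ s≤s (s≤s (s≤s z≤n)) ⟩
    1 * 1 * 2 ^ 8                                  ≤⟨ *-mono-≤ (*-mono-≤ (m^n>0 2 (q * 1)) (m^n>0 1 (8 * q)))
                                                       (^-monoʳ-≤ 2 (*-monoʳ-≤ 8 1≤q)) ⟩
    2 ^ (q * 1) * 1 ^ (8 * q) * 2 ^ (8 * q)        ∎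
  differ : ∀ {x y} → f (x ∷ []) ≡ true → f (y ∷ []) ≡ false → x ≢ y
  differ fx fy refl with () ← trans (sym fx) fy
  lit-true : ∀ a c b → a ≢ b → c ≢ b → evalΦ (lit zero a) (c ∷ []) ≡ true
  lit-true true  true  b _ _ = refl
  lit-true false false b _ _ = refl
  lit-true true  false false _ c≢b = ⊥-elim (c≢b refl)
  lit-true true  false true  a≢b _ = ⊥-elim (a≢b refl)
  lit-true false true  true  _ c≢b = ⊥-elim (c≢b refl)
  lit-true false true  false a≢b _ = ⊥-elim (a≢b refl)
  lit-false : ∀ a c → a ≢ c → evalΦ (lit zero a) (c ∷ []) ≡ false
  lit-false true  true  a≢c = ⊥-elim (a≢c refl)
  lit-false true  false _   = refl
  lit-false false true  _   = refl
  lit-false false false a≢c = ⊥-elim (a≢c refl)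
  pos : ∀ c → Aπ f Π π g c → evalΦ (lit zero a) c ≡ true
  pos (c ∷ []) (fc , _) = lit-true a c b (differ (proj₁ A) (proj₁ B)) (differ fc (proj₁ B))
  negative : ∀ c → Bπ f Π π g c → evalΦ (lit zero a) c ≡ false
  negative (c ∷ []) (fc , _) = lit-false a c (differ (proj₁ A) fc)

transcript-length≤ : ∀ {m n} (f : Vec Bool m → Bool) (Π : Protocol m n) π → IsTranscript f Π π → length π ≤ depth Π
transcript-length≤ f Π π ((_ , _ , es , eq , lab) , _) = subst (_≤ depth Π)
  (trans (sym (length-map bit es)) (cong length eq)) (InLabel⇒length≤ (ΠA Π) es lab)

depth-bound : ∀ q → 1 ≤ q → 7 ^ q * 8 ≤ 8 ^ q →
  (∀ m → ∃ λ e → q * e + m ≤ q * m × q * m ≤ q * e + q + m) → ∀ (m n : ℕ) (f : Vec Bool m → Bool) (Π : Protocol m n) →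
  PartiallyHalfDuplex f Π → Solves f Π →
  ∀ (π : List Bool) → IsTranscript f Π π → Alive f Π 1 q π →
  length π + n ≤ depth Π + 12 * ⌈log₂ (m * n) ⌉
depth-bound q 1≤q seven floor m zero f Π phd solves π tr live =
  -- For `n = 0` the claim only says that a transcript is no longer than the depth.
  ≤-trans (≤-reflexive (+-identityʳ _)) (≤-trans (transcript-length≤ f Π π tr) (m≤m+n _ _))
depth-bound q 1≤q seven floor m n@(suc n′) f Π phd solves π tr live with length π + n ≤? depth Π + 12 * ⌈log₂ (m * n) ⌉
... | yes p = p
... | no ¬p with ⌈log₂ (m * n) ⌉ in log≡
                | ⌈log₂⌉-mono-≤ (*-mono-≤ (alive⇒2≤m q f Π π 1≤q (s≤s z≤n) live) (s≤s (z≤n {n′})))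
... | suc l | _ = ⊥-elim (split (depth Π) (proj₁ gap) (proj₂ gap) (ΠA Π) (ΠB Π) phd solves live ¬p)
  where
  gap = m≤n⇒∃[o]m+o≡n (transcript-length≤ f Π π tr)
  2≤m = alive⇒2≤m q f Π π 1≤q (s≤s z≤n) live
  mn≤ : m * n ≤ 2 ^ suc l
  mn≤ = subst (λ z → m * n ≤ 2 ^ z) log≡ (n≤2^⌈log₂n⌉ (m * n))
  -- The depth is generalised together with the trees so that it can be replaced by `length π + d`.
  split : ∀ D d → length π + d ≡ D → (tA tB : Tree (Input m n) (Out m n) D) →
    let Π = record { depth = D ; ΠA = tA ; ΠB = tB } in
    PartiallyHalfDuplex f Π → Solves f Π → Alive f Π 1 q π → ¬ (length π + n ≤ D + 12 * suc l) → ⊥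
  split _ d refl tA tB phd solves live ¬p = no-small-depth q (proj₁ (floor m)) l f π tA tB 1≤q seven
    (proj₁ (proj₂ (floor m))) (proj₂ (proj₂ (floor m))) (≤-trans (s≤s z≤n) 2≤m)
    (≤-trans (≤-trans (≤-reflexive (sym (*-identityʳ m))) (*-monoʳ-≤ m (s≤s z≤n))) mn≤)
    (≤-trans (≤-trans (≤-reflexive (sym (*-identityˡ n))) (*-monoˡ-≤ n (≤-trans (s≤s z≤n) 2≤m))) mn≤)
    (+-cancelˡ-< (length π) _ _ (≤-trans (s≤s (≤-reflexive (sym (+-assoc (length π) d _)))) (≰⇒> ¬p)))
    phd solves live
... | zero | ()

theorem3p9 : Σ ℕ λ p → Σ ℕ λ q → (1 ≤ q) × (q < 25 * p) ×
    Σ ℕ λ C →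
    ∀ (m n : ℕ) (f : Vec Bool m → Bool) (Π : Protocol m n) →
    PartiallyHalfDuplex f Π → Solves f Π →
    ∀ (π₁ : List Bool) → IsTranscript f Π π₁ → Alive f Π p q π₁ →
    length π₁ + n ≤ depth Π + C * ⌈log₂ (m * n) ⌉
-- The value `γ = 1/16` exceeds `1/25 = 0.04`, and `C = 12`.
theorem3p9 = 1 , 16 , s≤s z≤n , toWitness {a? = 16 <? 25 * 1} _ , 12 ,
  depth-bound 16 (s≤s z≤n) 7^16*8≤8^16 (λ m → 15 * m / 16 , 16*[15m/16] m)
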